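{- Let $i,j\ge 1$ be integers with $N:=i+j$ even, and let $p,q$ be relatively prime positive integers with $p<q$. Let $p'$ be an integer with $p'p\equiv 1\pmod q$. Then $$R(i,j)\,q^{N-2}\,s_{ij}(p,q)\;-\;\frac{p'^{\,i}\,\alpha_N r_N\binom{N-1}{i}+p^{\,j}\,\alpha_N r_N\binom{N-1}{j}}{q}$$ is an integer, where $R(i,j):=\binom{N}{i}\beta_N r_N$.
   Context: Bernoulli numbers $B_k$ are defined by $\frac{z}{e^z-1}=\sum_{k\ge0}\frac{B_k}{k!}z^k$ (so $B_1=-\tfrac12$), and Bernoulli polynomials by $\frac{ze^{xz}}{e^z-1}=\sum_k \frac{B_k(x)}{k!}z^k$. For real $x$, $\langle x\rangle=x-\lfloor x\rfloor\in[0,1)$. The periodic Bernoulli function $\bar B_k$ is $\bar B_k(x)=B_k(\langle x\rangle)$ for $x\notin\mathbb Z$, $\bar B_k(x)=B_k$ for $k\ge2$ and $x\in\mathbb Z$, and $\bar B_1(x)=0$ for $x\in\mathbb Z$. The generalized Dedekind sum is $s_{ij}(p,q)=\sum_{k=0}^{q-1}\bar B_i\!\left(\tfrac kq\right)\bar B_j\!\left(\tfrac{pk}{q}\right)$. For even $N$, write $B_N=\alpha_N/\beta_N$ in lowest terms with $\beta_N>0$, and let $r_N$ be the least common multiple of the denominators of the rational numbers $\beta_N\binom{N}{i+1}B_{i+1}B_{N-i-1}$ over all odd $i$ with $0\le i\le N-2$ (an empty lcm being $1$). -}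

module Defs where

open import Data.Nat as ℕ using (ℕ; zero; suc; _∸_)
open import Data.Nat.Combinatorics using (_C_)
open import Data.Nat.LCM using (lcm)
open import Data.Nat.Divisibility using (_∣_)
open import Data.Integer as ℤ using (ℤ; +_)
open import Data.Rational as ℚ using (ℚ; 0ℚ; 1ℚ; _/_; ↥_; ↧ₙ_; floor)
open import Data.List using (List; []; _∷_; _++_; [_]; length; lookup)
open import Data.Fin using (Fin; fromℕ<)
open import Data.Bool using (Bool; true; false; if_then_else_)

sumℚ : ℕ → (ℕ → ℚ) → ℚ
sumℚ zero    f = 0ℚ
sumℚ (suc n) f = sumℚ n f ℚ.+ f n

powℚ : ℚ → ℕ → ℚ
powℚ x zero    = 1ℚ
powℚ x (suc n) = x ℚ.* powℚ x n

ℕ→ℚ : ℕ → ℚ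
ℕ→ℚ n = (+ n) / 1

ℤ→ℚ : ℤ → ℚ
ℤ→ℚ z = z / 1

at : List ℚ → ℕ → ℚ
at []       _       = 0ℚ
at (x ∷ xs) zero    = x
at (x ∷ xs) (suc k) = at xs k

-- Given l = [B_0, …, B_{m-1}] (m = length l), compute B_m from the recurrence
--   Σ_{k=0}^{m} C(m+1,k) B_k = 0   (m ≥ 1), which is equivalent to
--   z/(e^z-1) = Σ B_k z^k/k!  (so B_1 = -1/2).
nextBern : List ℚ → ℚ
nextBern l =
  ℚ.- (((+ 1) / suc m) ℚ.* sumℚ m (λ k → ℕ→ℚ (suc m C k) ℚ.* at l k))
  where m = length l

bernList : ℕ → List ℚ
bernList zero    = [ 1ℚ ]
bernList (suc n) = bernList n ++ [ nextBern (bernList n) ]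

B : ℕ → ℚ
B n = at (bernList n) n

Bpoly : ℕ → ℚ → ℚ
Bpoly k x = sumℚ (suc k) (λ m → ℕ→ℚ (k C m) ℚ.* B m ℚ.* powℚ x (k ∸ m))

frac : ℚ → ℚ
frac x = x ℚ.- ℤ→ℚ (floor x)

isInt : ℚ → Bool
isInt x with ↧ₙ x
... | 1 = true
... | _ = false

Bbar : ℕ → ℚ → ℚ
Bbar k x with isInt x
Bbar k x | false = Bpoly k (frac x)
Bbar 1 x | true  = 0ℚ
Bbar k x | true  = B k

s : (i j p q : ℕ) → .{{_ : ℕ.NonZero q}} → ℚ
s i j p q = sumℚ q (λ k → Bbar i ((+ k) / q) ℚ.* Bbar j ((+ (p ℕ.* k)) / q))

α : ℕ → ℤ
α N = ↥ (B N)

β : ℕ → ℕ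
β N = ↧ₙ (B N)

rAux : ℕ → ℕ → ℕ
rAux N zero = 1
rAux N (suc i) with i ℕ.% 2
... | 1 = lcm (rAux N i)
              (↧ₙ (ℕ→ℚ (β N) ℚ.* ℕ→ℚ (N C suc i) ℚ.* B (suc i) ℚ.* B (N ∸ suc i)))
... | _ = rAux N i

r : ℕ → ℕ
r N = rAux N (N ∸ 1)

R : ℕ → ℕ → ℕ
R i j = ((i ℕ.+ j) C i) ℕ.* β (i ℕ.+ j) ℕ.* r (i ℕ.+ j)

{-# OPTIONS --safe #-}

-- Let c α x be the series in t with exponential coefficients B̄ₙ(α) xⁿ, and D q p u w = Σ_{k mod q} c (k/q) u · c (pk/q) w,
-- whose N-th coefficient is Σ_{i+j=N} C(N,i) s_ij(p,q) uⁱ wʲ.  Divided by uw, this is a weighted sum over the lattice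
-- points of the cone spanned by u and w, hence additive under subdivision of the cone: the identity
--   (x+y) c α x · c β y = y c (α-β) x · c β (x+y) + x c (β-α) y · c α (x+y) - [α, β ∈ ℤ] xy(x+y) t²/4
-- and the distribution relation for B̄ₙ give, for q v = u + p w,
--   v D q p u w = w D p (-q) u v + u c 0 v · c 0 w - uvw t²/4.
-- Iterating splits the cone into unimodular ones.  On a unimodular cone the N-th coefficient of β_N r_N D / (vw) is an
-- integral form plus the polar terms α_N r_N (v^(N-1)/w + w^(N-1)/v).  The polar terms at an interior ray v with
-- neighbours v₂ and w add up to a multiple of (v₂^(N-1) + w^(N-1))/v, which is integral since v₂ + w = b v and N - 1 is
-- odd.  Only the polar terms at the two boundary rays survive, and they are the terms subtracted in the theorem.
module Submission where

open import Defs
open import Data.Nat as ℕ using (ℕ; zero; suc; _∸_; _≤_; _<_; NonZero; z≤n; s≤s)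
open import Data.Nat.Combinatorics using (_C_; nCk+nC[k+1]≡[n+1]C[k+1]; k>n⇒nCk≡0; nCk≡nC[n∸k]; nCn≡1; nC1≡n)
open import Data.Nat.Coprimality using (Coprime; 1-coprimeTo) renaming (sym to coprime-sym)
open import Data.Nat.Divisibility as ℕD using (_∣_; divides)
open import Data.Nat.LCM using (m∣lcm[m,n]; n∣lcm[m,n])
import Data.Nat.DivMod as ℕDM
import Data.Nat.Properties as ℕP
open import Data.Integer as ℤ using (ℤ; +_)
open import Data.Integer.Divisibility as ℤD using ()
import Data.Integer.Divisibility.Signed as ℤDS
import Data.Integer.DivMod as ℤDM
import Data.Integer.Properties as ℤP
import Data.Integer.Tactic.RingSolver as ℤRing
open import Data.Rational as ℚ using (ℚ; mkℚ; _/_; _+_; _*_; _-_; -_; 0ℚ; 1ℚ; ½; ↥_; ↧_; ↧ₙ_; floor)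
import Data.Rational.Properties as ℚP
import Data.Rational.Unnormalised as ℚᵘ
import Data.Rational.Unnormalised.Properties as ℚᵘP
open import Data.Bool using (true; false)
open import Data.List using ([]; _∷_; _++_; [_]; length)
import Data.List.Properties as ListP
open import Data.Product using (Σ-syntax; ∃; _,_; _×_; proj₁; proj₂)
open import Data.Sum using (_⊎_; inj₁; inj₂; [_,_]′)
open import Algebra.Bundles using (CommutativeSemiring)
import Algebra.Solver.Ring.NaturalCoefficients.Default as NatSolver
open import Relation.Binary.Definitions using (tri<; tri≈; tri>)
open import Relation.Binary.PropositionalEquality using (_≡_; _≢_; refl; sym; trans; cong; cong₂; subst; subst₂; module ≡-Reasoning)
import Relation.Binary.Reasoning.Setoid as SetoidReasoning
open import Relation.Nullary using (yes; no; contradiction)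
open import Relation.Nullary.Decidable using (dec⇒maybe)
open import Tactic.RingSolver using (solve-∀)
open import Tactic.RingSolver.Core.AlmostCommutativeRing using (AlmostCommutativeRing; fromCommutativeRing)

-- Rational arithmetic and finite sums

-- Every constant of the theorem can be read off the cone. In the lattice generated by `u`, `w` and
-- `v`, the vector `v` is a neighbour of the ray `w`, and `v⋆` with `q v⋆ = p′ u + w` is a neighbour
-- of the ray `u`. The surviving polar terms are therefore `v^(N-1)/w` and `v⋆^(N-1)/u`, which is
-- how both `p` and its inverse enter. The remaining form of degree `N - 2` is integral in `v` and
-- `w`, whereas Dedekind sums are coefficients in `u` and `w`. Passing to `u` and `w` costs the
-- factor `q^(N-2)`, and the polar terms, being of degree `N - 1`, keep one `q` in the denominator.
-- No quotient is ever formed: statements are multiplied through by `u w`, and `t/(e^t - 1)` is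
-- known only through the equation it satisfies. The letters `u` and `w` stand for positive rational
-- numbers, not indeterminates, so that `v` is positive and can be cancelled. Coefficients are
-- recovered at the end from the values at `w = 1`, `u = 1, 2, 3, …`.

ringℚ : AlmostCommutativeRing _ _
ringℚ = fromCommutativeRing ℚP.+-*-commutativeRing (λ x → dec⇒maybe (0ℚ ℚP.≟ x))

ℤ→ℚ-mk : ∀ z → ℤ→ℚ z ≡ mkℚ z 0 (coprime-sym (1-coprimeTo _))
ℤ→ℚ-mk z = ℚP.↥p/↧p≡p (mkℚ z 0 _)

ℤ→ℚ-+ : ∀ a b → ℤ→ℚ (a ℤ.+ b) ≡ ℤ→ℚ a + ℤ→ℚ b
ℤ→ℚ-+ a b rewrite ℤ→ℚ-mk a | ℤ→ℚ-mk b =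
  cong₂ (λ x y → (x ℤ.+ y) / 1) (sym (ℤP.*-identityʳ a)) (sym (ℤP.*-identityʳ b))

ℤ→ℚ-* : ∀ a b → ℤ→ℚ (a ℤ.* b) ≡ ℤ→ℚ a * ℤ→ℚ b
ℤ→ℚ-* a b rewrite ℤ→ℚ-mk a | ℤ→ℚ-mk b = refl

ℤ→ℚ-neg : ∀ a → ℤ→ℚ (ℤ.- a) ≡ - ℤ→ℚ a
ℤ→ℚ-neg a = begin
  ℤ→ℚ (ℤ.- a)                         ≡⟨ shuffle (ℤ→ℚ (ℤ.- a)) (ℤ→ℚ a) ⟩
  (ℤ→ℚ (ℤ.- a) + ℤ→ℚ a) - ℤ→ℚ a       ≡⟨ cong (_- ℤ→ℚ a) (sym (ℤ→ℚ-+ (ℤ.- a) a)) ⟩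
  ℤ→ℚ (ℤ.- a ℤ.+ a) - ℤ→ℚ a           ≡⟨ cong (λ x → ℤ→ℚ x - ℤ→ℚ a) (ℤP.+-inverseˡ a) ⟩
  0ℚ - ℤ→ℚ a                          ≡⟨ ℚP.+-identityˡ _ ⟩
  - ℤ→ℚ a                             ∎
  where
  open ≡-Reasoning
  shuffle : ∀ x y → x ≡ (x + y) - y
  shuffle = solve-∀ ringℚ

ℤ→ℚ-- : ∀ a b → ℤ→ℚ (a ℤ.- b) ≡ ℤ→ℚ a - ℤ→ℚ b
ℤ→ℚ-- a b = trans (ℤ→ℚ-+ a (ℤ.- b)) (cong (ℚ._+_ (ℤ→ℚ a)) (ℤ→ℚ-neg b))

ℤ→ℚ-^ : ∀ a n → ℤ→ℚ (a ℤ.^ n) ≡ powℚ (ℤ→ℚ a) n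
ℤ→ℚ-^ a zero = refl
ℤ→ℚ-^ a (suc n) = trans (ℤ→ℚ-* a (a ℤ.^ n)) (cong (ℤ→ℚ a *_) (ℤ→ℚ-^ a n))

ℤ→ℚ-cancel-< : ∀ {a b} → ℤ→ℚ a ℚ.< ℤ→ℚ b → a ℤ.< b
ℤ→ℚ-cancel-< {a} {b} a<b rewrite ℤ→ℚ-mk a | ℤ→ℚ-mk b =
  ℤP.*-cancelʳ-<-nonNeg (+ 1) (ℚP.drop-*<* a<b)

ℤ→ℚ-mono-≤ : ∀ {a b} → a ℤ.≤ b → ℤ→ℚ a ℚ.≤ ℤ→ℚ b
ℤ→ℚ-mono-≤ {a} {b} a≤b rewrite ℤ→ℚ-mk a | ℤ→ℚ-mk b =
  ℚ.*≤* (ℤP.*-monoʳ-≤-nonNeg (+ 1) a≤b)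

ℤ→ℚ-mono-< : ∀ {a b} → a ℤ.< b → ℤ→ℚ a ℚ.< ℤ→ℚ b
ℤ→ℚ-mono-< {a} {b} a<b rewrite ℤ→ℚ-mk a | ℤ→ℚ-mk b =
  ℚ.*<* (ℤP.*-monoʳ-<-pos (+ 1) a<b)

ℕ→ℚ-+ : ∀ m n → ℕ→ℚ (m ℕ.+ n) ≡ ℕ→ℚ m + ℕ→ℚ n
ℕ→ℚ-+ m n = ℤ→ℚ-+ (+ m) (+ n)

ℕ→ℚ-* : ∀ m n → ℕ→ℚ (m ℕ.* n) ≡ ℕ→ℚ m * ℕ→ℚ n
ℕ→ℚ-* m n = trans (cong ℤ→ℚ (ℤP.pos-* m n)) (ℤ→ℚ-* (+ m) (+ n))

ℕ→ℚ-suc : ∀ n → ℕ→ℚ (suc n) ≡ 1ℚ + ℕ→ℚ n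
ℕ→ℚ-suc = ℕ→ℚ-+ 1

inv : (q : ℕ) .{{_ : NonZero q}} → ℚ
inv q = (+ 1) / q

/-*-cancel : ∀ a q .{{_ : NonZero q}} → (a / q) * ℕ→ℚ q ≡ ℤ→ℚ a
/-*-cancel a q@(suc q-1) = ℚP.toℚᵘ-injective (begin
  ℚ.toℚᵘ ((a / q) * ℕ→ℚ q)                ≈⟨ ℚP.toℚᵘ-homo-* (a / q) (ℕ→ℚ q) ⟩
  ℚ.toℚᵘ (a / q) ℚᵘ.* ℚ.toℚᵘ (ℕ→ℚ q)      ≈⟨ ℚᵘP.*-cong (ℚP.toℚᵘ-fromℚᵘ (ℚᵘ.mkℚᵘ a q-1)) (ℚP.toℚᵘ-fromℚᵘ (ℚᵘ.mkℚᵘ (+ q) 0)) ⟩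
  ℚᵘ.mkℚᵘ a q-1 ℚᵘ.* ℚᵘ.mkℚᵘ (+ q) 0      ≈⟨ ℚᵘ.*≡* (trans (ℤP.*-identityʳ _) (cong (λ k → a ℤ.* (+ k)) (sym (ℕP.*-identityʳ q)))) ⟩
  ℚᵘ.mkℚᵘ a 0                             ≈⟨ ℚᵘP.≃-sym (ℚP.toℚᵘ-fromℚᵘ (ℚᵘ.mkℚᵘ a 0)) ⟩
  ℚ.toℚᵘ (ℤ→ℚ a)                          ∎)
  where open ℚᵘP.≃-Reasoning

inv-* : ∀ q .{{_ : NonZero q}} → inv q * ℕ→ℚ q ≡ 1ℚ
inv-* q = /-*-cancel (+ 1) q

*-cancel-ℕ : ∀ q .{{_ : NonZero q}} {x y} → x * ℕ→ℚ q ≡ y * ℕ→ℚ q → x ≡ y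
*-cancel-ℕ q {x} {y} e = begin
  x                        ≡⟨ sym (ℚP.*-identityʳ x) ⟩
  x * 1ℚ                   ≡⟨ cong (x *_) (sym (inv-* q)) ⟩
  x * (inv q * ℕ→ℚ q)      ≡⟨ shuffle x (inv q) (ℕ→ℚ q) ⟩
  (x * ℕ→ℚ q) * inv q      ≡⟨ cong (_* inv q) e ⟩
  (y * ℕ→ℚ q) * inv q      ≡⟨ sym (shuffle y (inv q) (ℕ→ℚ q)) ⟩
  y * (inv q * ℕ→ℚ q)      ≡⟨ cong (y *_) (inv-* q) ⟩
  y * 1ℚ                   ≡⟨ ℚP.*-identityʳ y ⟩
  y                        ∎
  where
  open ≡-Reasoning
  shuffle : ∀ x y z → x * (y * z) ≡ (x * z) * y
  shuffle = solve-∀ ringℚ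

/-inv : ∀ a q .{{_ : NonZero q}} → a / q ≡ ℤ→ℚ a * inv q
/-inv a q = *-cancel-ℕ q (begin
  (a / q) * ℕ→ℚ q             ≡⟨ /-*-cancel a q ⟩
  ℤ→ℚ a                       ≡⟨ sym (ℚP.*-identityʳ _) ⟩
  ℤ→ℚ a * 1ℚ                  ≡⟨ cong (ℤ→ℚ a *_) (sym (inv-* q)) ⟩
  ℤ→ℚ a * (inv q * ℕ→ℚ q)     ≡⟨ sym (ℚP.*-assoc (ℤ→ℚ a) (inv q) (ℕ→ℚ q)) ⟩
  ℤ→ℚ a * inv q * ℕ→ℚ q       ∎)
  where open ≡-Reasoning

*-cancelˡ-pos : ∀ {v x y} → 0ℚ ℚ.< v → v * x ≡ v * y → x ≡ y
*-cancelˡ-pos {v} {x} {y} v>0 e = begin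
  x                 ≡⟨ unit x ⟩
  ℚ.1/ v * (v * x)  ≡⟨ cong (ℚ.1/ v *_) e ⟩
  ℚ.1/ v * (v * y)  ≡⟨ sym (unit y) ⟩
  y                 ∎
  where
  open ≡-Reasoning
  instance v≢0 = ℚ.>-nonZero v>0
  unit : ∀ z → z ≡ ℚ.1/ v * (v * z)
  unit z = sym (trans (sym (ℚP.*-assoc (ℚ.1/ v) v z)) (trans (cong (_* z) (ℚP.*-inverseˡ v)) (ℚP.*-identityˡ z)))

sum-cong : ∀ n {f g : ℕ → ℚ} → (∀ k → k < n → f k ≡ g k) → sumℚ n f ≡ sumℚ n g
sum-cong zero    f≗g = refl
sum-cong (suc n) f≗g = cong₂ _+_ (sum-cong n (λ k k<n → f≗g k (ℕP.m<n⇒m<1+n k<n))) (f≗g n (ℕP.n<1+n n))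

sum-cong′ : ∀ n {f g : ℕ → ℚ} → (∀ k → f k ≡ g k) → sumℚ n f ≡ sumℚ n g
sum-cong′ n f≗g = sum-cong n (λ k _ → f≗g k)

sum-+ : ∀ n (f g : ℕ → ℚ) → sumℚ n (λ k → f k + g k) ≡ sumℚ n f + sumℚ n g
sum-+ zero    f g = refl
sum-+ (suc n) f g = trans (cong (_+ (f n + g n)) (sum-+ n f g)) (shuffle (sumℚ n f) (sumℚ n g) (f n) (g n))
  where
  shuffle : ∀ a b c d → (a + b) + (c + d) ≡ (a + c) + (b + d)
  shuffle = solve-∀ ringℚ

sum-*ˡ : ∀ n c (f : ℕ → ℚ) → sumℚ n (λ k → c * f k) ≡ c * sumℚ n f
sum-*ˡ zero    c f = sym (ℚP.*-zeroʳ c)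
sum-*ˡ (suc n) c f = trans (cong (_+ c * f n) (sum-*ˡ n c f)) (sym (ℚP.*-distribˡ-+ c (sumℚ n f) (f n)))

sum-zero : ∀ n → sumℚ n (λ _ → 0ℚ) ≡ 0ℚ
sum-zero zero    = refl
sum-zero (suc n) = trans (ℚP.+-identityʳ _) (sum-zero n)

sum-head : ∀ n (f : ℕ → ℚ) → sumℚ (suc n) f ≡ f 0 + sumℚ n (λ k → f (suc k))
sum-head zero    f = ℚP.+-comm 0ℚ (f 0)
sum-head (suc n) f = trans (cong (_+ f (suc n)) (sum-head n f)) (ℚP.+-assoc (f 0) (sumℚ n (λ k → f (suc k))) (f (suc n)))

sum-swap : ∀ m n (f : ℕ → ℕ → ℚ) → sumℚ m (λ k → sumℚ n (f k)) ≡ sumℚ n (λ l → sumℚ m (λ k → f k l))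
sum-swap zero    n f = sym (sum-zero n)
sum-swap (suc m) n f = trans (cong (_+ sumℚ n (f m)) (sum-swap m n f)) (sym (sum-+ n (λ l → sumℚ m (λ k → f k l)) (f m)))

sum-shift : ∀ n (f : ℕ → ℚ) → f n ≡ f 0 → sumℚ n (λ k → f (suc k)) ≡ sumℚ n f
sum-shift n f fn≡f0 = begin
  sumℚ n (λ k → f (suc k))                    ≡⟨ shuffle _ (f 0) ⟩
  (f 0 + sumℚ n (λ k → f (suc k))) - f 0      ≡⟨ cong (_- f 0) (sym (sum-head n f)) ⟩
  (sumℚ n f + f n) - f 0                      ≡⟨ cong (λ y → (sumℚ n f + y) - f 0) fn≡f0 ⟩
  (sumℚ n f + f 0) - f 0                      ≡⟨ shuffle′ _ (f 0) ⟩
  sumℚ n f                                    ∎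
  where
  open ≡-Reasoning
  shuffle : ∀ x y → x ≡ (y + x) - y
  shuffle = solve-∀ ringℚ
  shuffle′ : ∀ x y → (x + y) - y ≡ x
  shuffle′ = solve-∀ ringℚ

sum-reverse : ∀ n (f : ℕ → ℚ) → sumℚ n f ≡ sumℚ n (λ k → f (n ∸ suc k))
sum-reverse zero    f = refl
sum-reverse (suc n) f = begin
  sumℚ n f + f n                               ≡⟨ cong (_+ f n) (sum-reverse n f) ⟩
  sumℚ n (λ k → f (n ∸ suc k)) + f n           ≡⟨ ℚP.+-comm _ (f n) ⟩
  f n + sumℚ n (λ k → f (n ∸ suc k))           ≡⟨ sym (sum-head n (λ k → f (n ∸ k))) ⟩
  sumℚ (suc n) (λ k → f (suc n ∸ suc k))       ∎
  where open ≡-Reasoning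

sum-reflect : ∀ n (f : ℕ → ℚ) → f n ≡ f 0 → sumℚ n f ≡ sumℚ n (λ k → f (n ∸ k))
sum-reflect n f fn≡f0 = begin
  sumℚ n f                         ≡⟨ sum-reverse n f ⟩
  sumℚ n (λ k → f (n ∸ suc k))     ≡⟨ sum-shift n (λ k → f (n ∸ k)) (trans (cong f (ℕP.n∸n≡0 n)) (sym fn≡f0)) ⟩
  sumℚ n (λ k → f (n ∸ k))         ∎
  where open ≡-Reasoning

sum-only-head : ∀ n .{{_ : NonZero n}} (f : ℕ → ℚ) → (∀ k → suc k < n → f (suc k) ≡ 0ℚ) → sumℚ n f ≡ f 0
sum-only-head (suc n) f f≡0 = trans (sum-head n f)
  (trans (cong (ℚ._+_ (f 0)) (trans (sum-cong n (λ k k<n → f≡0 k (s≤s k<n))) (sum-zero n))) (ℚP.+-identityʳ (f 0)))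

-- Exponential generating series

Seq : Set
Seq = ℕ → ℚ

infix 4 _≈_
-- A record rather than a bare pointwise equality, so that the two series can be recovered from the
-- type by unification.
record _≈_ (a b : Seq) : Set where
  constructor ⟨_⟩
  field
    coeff : ∀ n → a n ≡ b n
open _≈_

≈-refl : ∀ {a} → a ≈ a
≈-refl = ⟨ (λ n → refl) ⟩

≈-sym : ∀ {a b} → a ≈ b → b ≈ a
≈-sym e = ⟨ (λ n → sym (coeff e n)) ⟩

≈-trans : ∀ {a b c} → a ≈ b → b ≈ c → a ≈ c
≈-trans e f = ⟨ (λ n → trans (coeff e n) (coeff f n)) ⟩

tail : Seq → Seq
tail a n = a (suc n)

infixl 6 _⊕_
infixl 7 _⋆_ _·_

_⊕_ : Seq → Seq → Seq
(a ⊕ b) n = a n + b n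

_·_ : ℚ → Seq → Seq
(c · a) n = c * a n

-- The product of exponential generating functions, defined through the Leibniz rule.
_⋆_ : Seq → Seq → Seq
(a ⋆ b) zero    = a 0 * b 0
(a ⋆ b) (suc n) = (tail a ⋆ b) n + (a ⋆ tail b) n

𝟘 : Seq
𝟘 n = 0ℚ

κ : ℚ → Seq
κ c zero    = c
κ c (suc n) = 0ℚ

𝟙 : Seq
𝟙 = κ 1ℚ

𝕥 : Seq
𝕥 zero    = 0ℚ
𝕥 (suc n) = 𝟙 n

exp : ℚ → Seq
exp = powℚ

-- The substitution `t ↦ x t`, a ring homomorphism. It carries identities for `t/(e^t - 1)` to
-- identities for `x t/(e^(x t) - 1)`.
σ : ℚ → Seq → Seq
σ x a n = powℚ x n * a n

⊕-cong : ∀ {a b c d} → a ≈ b → c ≈ d → a ⊕ c ≈ b ⊕ d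
⊕-cong e f = ⟨ (λ n → cong₂ _+_ (coeff e n) (coeff f n)) ⟩

⊕-congˡ : ∀ a {b c} → b ≈ c → a ⊕ b ≈ a ⊕ c
⊕-congˡ a e = ⟨ (λ n → cong (ℚ._+_ (a n)) (coeff e n)) ⟩

tail-cong : ∀ {a b} → a ≈ b → tail a ≈ tail b
tail-cong e = ⟨ (λ n → coeff e (suc n)) ⟩

private
  ⋆-cong′ : ∀ {a b c d} → a ≈ b → c ≈ d → ∀ n → (a ⋆ c) n ≡ (b ⋆ d) n
  ⋆-cong′ e f zero    = cong₂ _*_ (coeff e 0) (coeff f 0)
  ⋆-cong′ e f (suc n) = cong₂ _+_ (⋆-cong′ (tail-cong e) f n) (⋆-cong′ e (tail-cong f) n)

⋆-cong : ∀ {a b c d} → a ≈ b → c ≈ d → a ⋆ c ≈ b ⋆ d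
⋆-cong e f = ⟨ ⋆-cong′ e f ⟩

private
  ⋆-comm′ : ∀ a b n → (a ⋆ b) n ≡ (b ⋆ a) n
  ⋆-comm′ a b zero    = ℚP.*-comm (a 0) (b 0)
  ⋆-comm′ a b (suc n) = trans (cong₂ _+_ (⋆-comm′ (tail a) b n) (⋆-comm′ a (tail b) n)) (ℚP.+-comm ((b ⋆ tail a) n) ((tail b ⋆ a) n))

  ⋆-distribʳ′ : ∀ a b c n → ((b ⊕ c) ⋆ a) n ≡ (b ⋆ a) n + (c ⋆ a) n
  ⋆-distribʳ′ a b c zero    = ℚP.*-distribʳ-+ (a 0) (b 0) (c 0)
  ⋆-distribʳ′ a b c (suc n) = trans
    (cong₂ _+_ (⋆-distribʳ′ a (tail b) (tail c) n) (⋆-distribʳ′ (tail a) b c n))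
    (shuffle ((tail b ⋆ a) n) ((tail c ⋆ a) n) ((b ⋆ tail a) n) ((c ⋆ tail a) n))
    where
    shuffle : ∀ x y z w → (x + y) + (z + w) ≡ (x + z) + (y + w)
    shuffle = solve-∀ ringℚ

⋆-comm : ∀ a b → a ⋆ b ≈ b ⋆ a
⋆-comm a b = ⟨ ⋆-comm′ a b ⟩

⋆-distribʳ : ∀ a b c → (b ⊕ c) ⋆ a ≈ (b ⋆ a) ⊕ (c ⋆ a)
⋆-distribʳ a b c = ⟨ ⋆-distribʳ′ a b c ⟩

⋆-distribˡ : ∀ a b c → a ⋆ (b ⊕ c) ≈ (a ⋆ b) ⊕ (a ⋆ c)
⋆-distribˡ a b c = ≈-trans (⋆-comm a (b ⊕ c)) (≈-trans (⋆-distribʳ a b c) (⊕-cong (⋆-comm b a) (⋆-comm c a)))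

private
  ⋆-assoc′ : ∀ a b c n → ((a ⋆ b) ⋆ c) n ≡ (a ⋆ (b ⋆ c)) n
  ⋆-assoc′ a b c zero    = ℚP.*-assoc (a 0) (b 0) (c 0)
  ⋆-assoc′ a b c (suc n) = begin
    ((tail a ⋆ b ⊕ a ⋆ tail b) ⋆ c) n + ((a ⋆ b) ⋆ tail c) n
      ≡⟨ cong (_+ ((a ⋆ b) ⋆ tail c) n) (coeff (⋆-distribʳ c (tail a ⋆ b) (a ⋆ tail b)) n) ⟩
    (((tail a ⋆ b) ⋆ c) n + ((a ⋆ tail b) ⋆ c) n) + ((a ⋆ b) ⋆ tail c) n
      ≡⟨ cong₂ _+_ (cong₂ _+_ (⋆-assoc′ (tail a) b c n) (⋆-assoc′ a (tail b) c n)) (⋆-assoc′ a b (tail c) n) ⟩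
    ((tail a ⋆ (b ⋆ c)) n + (a ⋆ (tail b ⋆ c)) n) + (a ⋆ (b ⋆ tail c)) n
      ≡⟨ ℚP.+-assoc ((tail a ⋆ (b ⋆ c)) n) _ _ ⟩
    (tail a ⋆ (b ⋆ c)) n + ((a ⋆ (tail b ⋆ c)) n + (a ⋆ (b ⋆ tail c)) n)
      ≡⟨ cong (ℚ._+_ ((tail a ⋆ (b ⋆ c)) n)) (sym (coeff (⋆-distribˡ a (tail b ⋆ c) (b ⋆ tail c)) n)) ⟩
    (tail a ⋆ (b ⋆ c)) n + (a ⋆ (tail b ⋆ c ⊕ b ⋆ tail c)) n ∎
    where open ≡-Reasoning

  ·-⋆′ : ∀ c a b n → ((c · a) ⋆ b) n ≡ c * (a ⋆ b) n
  ·-⋆′ c a b zero    = ℚP.*-assoc c (a 0) (b 0)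
  ·-⋆′ c a b (suc n) = trans (cong₂ _+_ (·-⋆′ c (tail a) b n) (·-⋆′ c a (tail b) n)) (sym (ℚP.*-distribˡ-+ c _ _))

  zero-⋆′ : ∀ b n → (𝟘 ⋆ b) n ≡ 0ℚ
  zero-⋆′ b zero    = ℚP.*-zeroˡ (b 0)
  zero-⋆′ b (suc n) = cong₂ _+_ (zero-⋆′ b n) (zero-⋆′ (tail b) n)

  κ-⋆′ : ∀ c b n → (κ c ⋆ b) n ≡ c * b n
  κ-⋆′ c b zero    = refl
  κ-⋆′ c b (suc n) = trans (cong₂ _+_ (zero-⋆′ b n) (κ-⋆′ c (tail b) n)) (ℚP.+-identityˡ _)

⋆-assoc : ∀ a b c → (a ⋆ b) ⋆ c ≈ a ⋆ (b ⋆ c)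
⋆-assoc a b c = ⟨ ⋆-assoc′ a b c ⟩

·-⋆ : ∀ c a b → (c · a) ⋆ b ≈ c · (a ⋆ b)
·-⋆ c a b = ⟨ ·-⋆′ c a b ⟩

⋆-· : ∀ c a b → a ⋆ (c · b) ≈ c · (a ⋆ b)
⋆-· c a b = ≈-trans (⋆-comm a (c · b)) (≈-trans (·-⋆ c b a) ⟨ (λ n → cong (c *_) (coeff (⋆-comm b a) n)) ⟩)

κ-⋆ : ∀ c b → κ c ⋆ b ≈ c · b
κ-⋆ c b = ⟨ κ-⋆′ c b ⟩

𝟙-⋆ : ∀ b → 𝟙 ⋆ b ≈ b
𝟙-⋆ b = ⟨ (λ n → trans (κ-⋆′ 1ℚ b n) (ℚP.*-identityˡ (b n))) ⟩

-- The solver sees a semiring only. Identities of series are therefore arranged without subtraction,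
-- and a common summand or a factor `𝕥` is cancelled afterwards.
Seq-commutativeSemiring : CommutativeSemiring _ _
Seq-commutativeSemiring = record
  { Carrier = Seq ; _≈_ = _≈_ ; _+_ = _⊕_ ; _*_ = _⋆_ ; 0# = 𝟘 ; 1# = 𝟙
  ; isCommutativeSemiring = record
    { isSemiring = record
      { isSemiringWithoutAnnihilatingZero = record
        { +-isCommutativeMonoid = record
          { isMonoid = record
            { isSemigroup = record
              { isMagma = record
                { isEquivalence = record { refl = ≈-refl ; sym = ≈-sym ; trans = ≈-trans }
                ; ∙-cong = ⊕-cong }
              ; assoc = λ a b c → ⟨ (λ n → ℚP.+-assoc (a n) (b n) (c n)) ⟩ }
            ; identity = (λ a → ⟨ (λ n → ℚP.+-identityˡ (a n)) ⟩) , (λ a → ⟨ (λ n → ℚP.+-identityʳ (a n)) ⟩) }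
          ; comm = λ a b → ⟨ (λ n → ℚP.+-comm (a n) (b n)) ⟩ }
        ; *-cong = ⋆-cong
        ; *-assoc = ⋆-assoc
        ; *-identity = 𝟙-⋆ , (λ b → ≈-trans (⋆-comm b 𝟙) (𝟙-⋆ b))
        ; distrib = ⋆-distribˡ , ⋆-distribʳ }
      ; zero = (λ b → ⟨ zero-⋆′ b ⟩) , (λ b → ≈-trans (⋆-comm b 𝟘) ⟨ zero-⋆′ b ⟩) }
    ; *-comm = ⋆-comm } }

module SeqSolver = NatSolver Seq-commutativeSemiring

⊕-cancelʳ : ∀ {a b} c → a ⊕ c ≈ b ⊕ c → a ≈ b
⊕-cancelʳ {a} {b} c e = ⟨ (λ n → trans (shuffle (a n) (c n)) (trans (cong (_- c n) (coeff e n)) (sym (shuffle (b n) (c n))))) ⟩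
  where
  shuffle : ∀ x y → x ≡ (x + y) - y
  shuffle = solve-∀ ringℚ

private
  𝕥-⋆′ : ∀ a n → (𝕥 ⋆ a) (suc n) ≡ ℕ→ℚ (suc n) * a n
  𝕥-⋆′ a zero    = trans (cong₂ _+_ (ℚP.*-identityˡ (a 0)) (ℚP.*-zeroˡ (a 1))) (trans (ℚP.+-identityʳ (a 0)) (sym (ℚP.*-identityˡ (a 0))))
  𝕥-⋆′ a (suc n) = begin
    (𝟙 ⋆ a) (suc n) + (𝕥 ⋆ tail a) (suc n)    ≡⟨ cong₂ _+_ (coeff (𝟙-⋆ a) (suc n)) (𝕥-⋆′ (tail a) n) ⟩
    a (suc n) + ℕ→ℚ (suc n) * a (suc n)       ≡⟨ shuffle (a (suc n)) (ℕ→ℚ (suc n)) ⟩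
    (1ℚ + ℕ→ℚ (suc n)) * a (suc n)            ≡⟨ cong (_* a (suc n)) (sym (ℕ→ℚ-suc (suc n))) ⟩
    ℕ→ℚ (suc (suc n)) * a (suc n)             ∎
    where
    open ≡-Reasoning
    shuffle : ∀ x y → x + y * x ≡ (1ℚ + y) * x
    shuffle = solve-∀ ringℚ

-- Multiplication by `t` shifts the exponential coefficients and multiplies them by `n + 1`, which
-- is invertible in the rationals.
𝕥-cancel : ∀ {a b} → 𝕥 ⋆ a ≈ 𝕥 ⋆ b → a ≈ b
𝕥-cancel {a} {b} e = ⟨ (λ n → *-cancel-ℕ (suc n) (trans (ℚP.*-comm (a n) _)
  (trans (sym (𝕥-⋆′ a n)) (trans (coeff e (suc n)) (trans (𝕥-⋆′ b n) (ℚP.*-comm _ (b n)))))) ) ⟩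

𝕥²-higher : ∀ n → (𝕥 ⋆ 𝕥) (suc (suc (suc n))) ≡ 0ℚ
𝕥²-higher n = trans (𝕥-⋆′ 𝕥 (suc (suc n))) (ℚP.*-zeroʳ (ℕ→ℚ (suc (suc (suc n)))))

private
  σ-⋆′ : ∀ x a b n → (σ x a ⋆ σ x b) n ≡ powℚ x n * (a ⋆ b) n
  σ-⋆′ x a b zero    = shuffle (a 0) (b 0)
    where
    shuffle : ∀ x y → (1ℚ * x) * (1ℚ * y) ≡ 1ℚ * (x * y)
    shuffle = solve-∀ ringℚ
  σ-⋆′ x a b (suc n) = begin
    (tail (σ x a) ⋆ σ x b) n + (σ x a ⋆ tail (σ x b)) n
      ≡⟨ cong₂ _+_ (coeff (⋆-cong (tail-σ a) ≈-refl) n) (coeff (⋆-cong ≈-refl (tail-σ b)) n) ⟩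
    ((x · σ x (tail a)) ⋆ σ x b) n + (σ x a ⋆ (x · σ x (tail b))) n
      ≡⟨ cong₂ _+_ (coeff (·-⋆ x (σ x (tail a)) (σ x b)) n) (coeff (⋆-· x (σ x a) (σ x (tail b))) n) ⟩
    x * (σ x (tail a) ⋆ σ x b) n + x * (σ x a ⋆ σ x (tail b)) n
      ≡⟨ cong₂ (λ y z → x * y + x * z) (σ-⋆′ x (tail a) b n) (σ-⋆′ x a (tail b) n) ⟩
    x * (powℚ x n * (tail a ⋆ b) n) + x * (powℚ x n * (a ⋆ tail b) n)
      ≡⟨ shuffle x (powℚ x n) ((tail a ⋆ b) n) ((a ⋆ tail b) n) ⟩
    (x * powℚ x n) * ((tail a ⋆ b) n + (a ⋆ tail b) n) ∎
    where
    open ≡-Reasoning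
    tail-σ : ∀ c → tail (σ x c) ≈ x · σ x (tail c)
    tail-σ c = ⟨ (λ n → ℚP.*-assoc x (powℚ x n) (c (suc n))) ⟩
    shuffle : ∀ x p y z → x * (p * y) + x * (p * z) ≡ (x * p) * (y + z)
    shuffle = solve-∀ ringℚ

  exp-+′ : ∀ x y n → (exp x ⋆ exp y) n ≡ powℚ (x + y) n
  exp-+′ x y zero    = refl
  exp-+′ x y (suc n) = begin
    ((x · exp x) ⋆ exp y) n + (exp x ⋆ (y · exp y)) n   ≡⟨ cong₂ _+_ (coeff (·-⋆ x (exp x) (exp y)) n) (coeff (⋆-· y (exp x) (exp y)) n) ⟩
    x * (exp x ⋆ exp y) n + y * (exp x ⋆ exp y) n       ≡⟨ sym (ℚP.*-distribʳ-+ ((exp x ⋆ exp y) n) x y) ⟩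
    (x + y) * (exp x ⋆ exp y) n                         ≡⟨ cong ((x + y) *_) (exp-+′ x y n) ⟩
    (x + y) * powℚ (x + y) n                            ∎
    where open ≡-Reasoning

σ-⋆ : ∀ x a b → σ x (a ⋆ b) ≈ σ x a ⋆ σ x b
σ-⋆ x a b = ⟨ (λ n → sym (σ-⋆′ x a b n)) ⟩

σ-cong : ∀ x {a b} → a ≈ b → σ x a ≈ σ x b
σ-cong x e = ⟨ (λ n → cong (powℚ x n *_) (coeff e n)) ⟩

σ-⊕ : ∀ x a b → σ x (a ⊕ b) ≈ σ x a ⊕ σ x b
σ-⊕ x a b = ⟨ (λ n → ℚP.*-distribˡ-+ (powℚ x n) (a n) (b n)) ⟩

exp-+ : ∀ x y → exp x ⋆ exp y ≈ exp (x + y)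
exp-+ x y = ⟨ exp-+′ x y ⟩

powℚ-* : ∀ x y n → powℚ (x * y) n ≡ powℚ x n * powℚ y n
powℚ-* x y zero    = refl
powℚ-* x y (suc n) = trans (cong ((x * y) *_) (powℚ-* x y n)) (shuffle x y (powℚ x n) (powℚ y n))
  where
  shuffle : ∀ a b c d → (a * b) * (c * d) ≡ (a * c) * (b * d)
  shuffle = solve-∀ ringℚ

powℚ-0 : ∀ n → powℚ 0ℚ n ≡ 𝟙 n
powℚ-0 zero    = refl
powℚ-0 (suc n) = ℚP.*-zeroˡ (powℚ 0ℚ n)

powℚ-1 : ∀ n → powℚ 1ℚ n ≡ 1ℚ
powℚ-1 zero    = refl
powℚ-1 (suc n) = trans (ℚP.*-identityˡ (powℚ 1ℚ n)) (powℚ-1 n)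

σ-exp : ∀ x y → σ x (exp y) ≈ exp (x * y)
σ-exp x y = ⟨ (λ n → sym (powℚ-* x y n)) ⟩

σ-𝕥 : ∀ x → σ x 𝕥 ≈ κ x ⋆ 𝕥
σ-𝕥 x = ⟨ (λ n → trans (lem n) (sym (coeff (κ-⋆ x 𝕥) n))) ⟩
  where
  lem : ∀ n → powℚ x n * 𝕥 n ≡ x * 𝕥 n
  lem zero          = trans (ℚP.*-zeroʳ 1ℚ) (sym (ℚP.*-zeroʳ x))
  lem (suc zero)    = cong (_* 1ℚ) (ℚP.*-identityʳ x)
  lem (suc (suc n)) = trans (ℚP.*-zeroʳ (powℚ x (suc (suc n)))) (sym (ℚP.*-zeroʳ x))

κ-+ : ∀ x y → κ (x + y) ≈ κ x ⊕ κ y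
κ-+ x y = ⟨ (λ { zero → refl ; (suc n) → refl }) ⟩

κ-* : ∀ x y → κ (x * y) ≈ κ x ⋆ κ y
κ-* x y = ⟨ (λ n → trans (lem n) (sym (coeff (κ-⋆ x (κ y)) n))) ⟩
  where
  lem : ∀ n → κ (x * y) n ≡ x * κ y n
  lem zero    = refl
  lem (suc n) = sym (ℚP.*-zeroʳ x)

-- Under the Leibniz rule the induction step becomes Pascal's rule.
binomial-⋆ : ∀ a b n → (a ⋆ b) n ≡ sumℚ (suc n) (λ k → ℕ→ℚ (n C k) * (a k * b (n ∸ k)))
binomial-⋆ a b zero    = sym (trans (ℚP.+-identityˡ _) (ℚP.*-identityˡ (a 0 * b 0)))
binomial-⋆ a b (suc n) = begin
  (tail a ⋆ b) n + (a ⋆ tail b) n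
    ≡⟨ cong₂ _+_ (binomial-⋆ (tail a) b n) (binomial-⋆ a (tail b) n) ⟩
  sumℚ (suc n) X + sumℚ (suc n) (λ k → ℕ→ℚ (n C k) * (a k * b (suc (n ∸ k))))
    ≡⟨ cong (ℚ._+_ (sumℚ (suc n) X)) (sum-cong (suc n) {g = Y} (λ k k≤n → cong (λ m → ℕ→ℚ (n C k) * (a k * b m)) (sym (ℕP.+-∸-assoc 1 (ℕP.≤-pred k≤n))))) ⟩
  sumℚ (suc n) X + sumℚ (suc n) Y
    -- `Y` gets one more term, zero because its binomial coefficient is, so that splitting off `Y 0`
    -- leaves a sum as long as that of `X`.
    ≡⟨ cong (ℚ._+_ (sumℚ (suc n) X)) (sym (trans (cong (ℚ._+_ (sumℚ (suc n) Y)) Y-top) (ℚP.+-identityʳ (sumℚ (suc n) Y)))) ⟩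
  sumℚ (suc n) X + sumℚ (suc (suc n)) Y
    ≡⟨ cong (ℚ._+_ (sumℚ (suc n) X)) (sum-head (suc n) Y) ⟩
  sumℚ (suc n) X + (Y 0 + sumℚ (suc n) (tail Y))
    ≡⟨ shuffle (sumℚ (suc n) X) (Y 0) (sumℚ (suc n) (tail Y)) ⟩
  Y 0 + (sumℚ (suc n) X + sumℚ (suc n) (tail Y))
    ≡⟨ cong (ℚ._+_ (Y 0)) (sym (sum-+ (suc n) X (tail Y))) ⟩
  Y 0 + sumℚ (suc n) (λ k → X k + Y (suc k))
    ≡⟨ cong (ℚ._+_ (Y 0)) (sum-cong′ (suc n) pascal) ⟩
  Y 0 + sumℚ (suc n) (tail Z)
    ≡⟨ sym (sum-head (suc n) Z) ⟩
  sumℚ (suc (suc n)) Z ∎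
  where
  open ≡-Reasoning
  X Y Z : Seq
  X k = ℕ→ℚ (n C k) * (a (suc k) * b (n ∸ k))
  Y k = ℕ→ℚ (n C k) * (a k * b (suc n ∸ k))
  Z k = ℕ→ℚ (suc n C k) * (a k * b (suc n ∸ k))
  Y-top : Y (suc n) ≡ 0ℚ
  Y-top = trans (cong (λ m → ℕ→ℚ m * (a (suc n) * b (n ∸ n))) (k>n⇒nCk≡0 (ℕP.n<1+n n))) (ℚP.*-zeroˡ (a (suc n) * b (n ∸ n)))
  shuffle : ∀ x y z → x + (y + z) ≡ y + (x + z)
  shuffle = solve-∀ ringℚ
  pascal : ∀ k → X k + Y (suc k) ≡ Z (suc k)
  pascal k = trans (sym (ℚP.*-distribʳ-+ (a (suc k) * b (n ∸ k)) (ℕ→ℚ (n C k)) (ℕ→ℚ (n C suc k))))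
    (cong (_* (a (suc k) * b (n ∸ k))) (trans (sym (ℕ→ℚ-+ (n C k) (n C suc k))) (cong ℕ→ℚ (nCk+nC[k+1]≡[n+1]C[k+1] n k))))

sum-⋆ : ∀ m (f : ℕ → Seq) b n → sumℚ m (λ k → (f k ⋆ b) n) ≡ ((λ j → sumℚ m (λ k → f k j)) ⋆ b) n
sum-⋆ zero    f b n = sym (zero-⋆′ b n)
sum-⋆ (suc m) f b n = trans (cong (_+ (f m ⋆ b) n) (sum-⋆ m f b n))
  (sym (⋆-distribʳ′ b (λ j → sumℚ m (λ k → f k j)) (f m) n))

-- The Bernoulli series

module ≈-Reasoning = SetoidReasoning (CommutativeSemiring.setoid Seq-commutativeSemiring)

at-++ˡ : ∀ xs ys k → k < length xs → at (xs ++ ys) k ≡ at xs k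
at-++ˡ (x ∷ xs) ys zero    k<n       = refl
at-++ˡ (x ∷ xs) ys (suc k) (s≤s k<n) = at-++ˡ xs ys k k<n

at-++-length : ∀ xs y k → k ≡ length xs → at (xs ++ [ y ]) k ≡ y
at-++-length []       y _ refl = refl
at-++-length (x ∷ xs) y _ refl = at-++-length xs y _ refl

length-bernList : ∀ n → length (bernList n) ≡ suc n
length-bernList zero    = refl
length-bernList (suc n) = trans (ListP.length-++ (bernList n)) (trans (cong (ℕ._+ 1) (length-bernList n)) (ℕP.+-comm (suc n) 1))

at-bernList : ∀ n k → k ≤ n → at (bernList n) k ≡ B k
at-bernList zero    zero k≤n = refl
at-bernList (suc n) k    k≤n with ℕP.m≤n⇒m<n∨m≡n k≤n
... | inj₁ k<1+n = trans (at-++ˡ (bernList n) _ k (subst (k <_) (sym (length-bernList n)) k<1+n)) (at-bernList n k (ℕP.≤-pred k<1+n))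
... | inj₂ refl  = refl

nextBern-length : ∀ l m → length l ≡ m → nextBern l ≡ - (inv (suc m) * sumℚ m (λ k → ℕ→ℚ (suc m C k) * at l k))
nextBern-length l _ refl = refl

B-suc : ∀ n → B (suc n) ≡ - (inv (suc (suc n)) * sumℚ (suc n) (λ k → ℕ→ℚ (suc (suc n) C k) * B k))
B-suc n = begin
  at (bernList n ++ [ nextBern (bernList n) ]) (suc n)
    ≡⟨ at-++-length (bernList n) _ (suc n) (sym (length-bernList n)) ⟩
  nextBern (bernList n)
    ≡⟨ nextBern-length (bernList n) (suc n) (length-bernList n) ⟩
  - (inv (suc (suc n)) * sumℚ (suc n) (λ k → ℕ→ℚ (suc (suc n) C k) * at (bernList n) k))
    ≡⟨ cong (λ y → - (inv (suc (suc n)) * y)) (sum-cong (suc n) (λ k k<1+n → cong (ℕ→ℚ (suc (suc n) C k) *_) (at-bernList n k (ℕP.≤-pred k<1+n)))) ⟩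
  - (inv (suc (suc n)) * sumℚ (suc n) (λ k → ℕ→ℚ (suc (suc n) C k) * B k)) ∎
  where open ≡-Reasoning

B-recurrence : ∀ n → sumℚ (suc (suc n)) (λ k → ℕ→ℚ (suc (suc n) C k) * B k) ≡ 0ℚ
B-recurrence n = begin
  S + ℕ→ℚ (suc (suc n) C suc n) * B (suc n)   ≡⟨ cong₂ (λ y z → S + ℕ→ℚ y * z) top (B-suc n) ⟩
  S + ℕ→ℚ (suc (suc n)) * - (i * S)           ≡⟨ shuffle S (ℕ→ℚ (suc (suc n))) i ⟩
  S - (i * ℕ→ℚ (suc (suc n))) * S             ≡⟨ cong (λ y → S - y * S) (inv-* (suc (suc n))) ⟩
  S - 1ℚ * S                                  ≡⟨ shuffle′ S ⟩
  0ℚ                                          ∎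
  where
  open ≡-Reasoning
  S i : ℚ
  S = sumℚ (suc n) (λ k → ℕ→ℚ (suc (suc n) C k) * B k)
  i = inv (suc (suc n))
  top : suc (suc n) C suc n ≡ suc (suc n)
  top = trans (nCk≡nC[n∸k] (ℕP.n≤1+n (suc n))) (trans (cong (suc (suc n) C_) (ℕP.m+n∸n≡m 1 n)) (nC1≡n (suc (suc n))))
  shuffle : ∀ s m i → s + m * - (i * s) ≡ s - (i * m) * s
  shuffle = solve-∀ ringℚ
  shuffle′ : ∀ s → s - 1ℚ * s ≡ 0ℚ
  shuffle′ = solve-∀ ringℚ

-- This is `B = t/(e^t - 1)` with the denominator cleared. Degrees 0 and 1 are computed; from degree
-- 2 on it is the recurrence.
B⋆exp1 : B ⋆ exp 1ℚ ≈ B ⊕ 𝕥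
B⋆exp1 = ⟨ lem ⟩
  where
  open ≡-Reasoning
  expand : ∀ n → (B ⋆ exp 1ℚ) n ≡ sumℚ n (λ k → ℕ→ℚ (n C k) * B k) + B n
  expand n = begin
    (B ⋆ exp 1ℚ) n
      ≡⟨ binomial-⋆ B (exp 1ℚ) n ⟩
    sumℚ (suc n) (λ k → ℕ→ℚ (n C k) * (B k * powℚ 1ℚ (n ∸ k)))
      ≡⟨ sum-cong′ (suc n) (λ k → cong (ℕ→ℚ (n C k) *_) (trans (cong (B k *_) (powℚ-1 (n ∸ k))) (ℚP.*-identityʳ (B k)))) ⟩
    sumℚ n (λ k → ℕ→ℚ (n C k) * B k) + ℕ→ℚ (n C n) * B n
      ≡⟨ cong (ℚ._+_ (sumℚ n (λ k → ℕ→ℚ (n C k) * B k))) (trans (cong (λ m → ℕ→ℚ m * B n) (nCn≡1 n)) (ℚP.*-identityˡ (B n))) ⟩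
    sumℚ n (λ k → ℕ→ℚ (n C k) * B k) + B n ∎
  lem : ∀ n → (B ⋆ exp 1ℚ) n ≡ B n + 𝕥 n
  lem zero          = refl
  lem (suc zero)    = refl
  lem (suc (suc n)) = trans (expand (suc (suc n))) (trans (cong (_+ B (suc (suc n))) (B-recurrence n)) (ℚP.+-comm 0ℚ (B (suc (suc n)))))

𝕓 : ℚ → Seq
𝕓 x = σ x B

≡⇒≈ : ∀ {a b} → a ≡ b → a ≈ b
≡⇒≈ refl = ≈-refl

𝕓⋆exp : ∀ x → 𝕓 x ⋆ exp x ≈ 𝕓 x ⊕ κ x ⋆ 𝕥
𝕓⋆exp x = begin
  𝕓 x ⋆ exp x            ≈⟨ ⋆-cong ≈-refl (≡⇒≈ (cong exp (sym (ℚP.*-identityʳ x)))) ⟩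
  𝕓 x ⋆ exp (x * 1ℚ)     ≈⟨ ⋆-cong ≈-refl (≈-sym (σ-exp x 1ℚ)) ⟩
  𝕓 x ⋆ σ x (exp 1ℚ)     ≈⟨ ≈-sym (σ-⋆ x B (exp 1ℚ)) ⟩
  σ x (B ⋆ exp 1ℚ)       ≈⟨ σ-cong x B⋆exp1 ⟩
  σ x (B ⊕ 𝕥)            ≈⟨ σ-⊕ x B 𝕥 ⟩
  𝕓 x ⊕ σ x 𝕥            ≈⟨ ⊕-congˡ (𝕓 x) (σ-𝕥 x) ⟩
  𝕓 x ⊕ κ x ⋆ 𝕥          ∎
  where open ≈-Reasoning

open SeqSolver using (solve; _:=_; _:+_; _:*_; con)

-- Over the common factor 𝕓 x ⋆ 𝕓 y ⋆ 𝕓 (x + y) this is e^(x+y) - 1 = (e^y - 1) + e^y (e^x - 1).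
𝕓-three-term : ∀ x y → κ (x + y) ⋆ (𝕓 x ⋆ 𝕓 y) ≈
  κ y ⋆ (𝕓 x ⋆ 𝕓 (x + y)) ⊕ κ x ⋆ ((𝕓 y ⊕ κ y ⋆ 𝕥) ⋆ 𝕓 (x + y))
𝕓-three-term x y = 𝕥-cancel (⊕-cancelʳ ((𝕓 x ⋆ 𝕓 y) ⋆ 𝕓 z) (begin
  𝕥 ⋆ (κ z ⋆ (𝕓 x ⋆ 𝕓 y)) ⊕ (𝕓 x ⋆ 𝕓 y) ⋆ 𝕓 z
    ≈⟨ solve 5 (λ t k a b c → t :* (k :* (a :* b)) :+ (a :* b) :* c := (a :* b) :* (c :+ k :* t)) ≈-refl 𝕥 (κ z) (𝕓 x) (𝕓 y) (𝕓 z) ⟩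
  (𝕓 x ⋆ 𝕓 y) ⋆ (𝕓 z ⊕ κ z ⋆ 𝕥)
    ≈⟨ ⋆-cong ≈-refl (≈-trans (≈-sym (𝕓⋆exp z)) (⋆-cong ≈-refl (≈-sym (exp-+ x y)))) ⟩
  (𝕓 x ⋆ 𝕓 y) ⋆ (𝕓 z ⋆ (exp x ⋆ exp y))
    ≈⟨ solve 5 (λ a b c d e → (a :* b) :* (c :* (d :* e)) := ((a :* d) :* (b :* e)) :* c) ≈-refl (𝕓 x) (𝕓 y) (𝕓 z) (exp x) (exp y) ⟩
  ((𝕓 x ⋆ exp x) ⋆ (𝕓 y ⋆ exp y)) ⋆ 𝕓 z
    ≈⟨ ⋆-cong (⋆-cong (𝕓⋆exp x) (𝕓⋆exp y)) ≈-refl ⟩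
  ((𝕓 x ⊕ κ x ⋆ 𝕥) ⋆ (𝕓 y ⊕ κ y ⋆ 𝕥)) ⋆ 𝕓 z
    ≈⟨ solve 6 (λ t x y a b c → ((a :+ x :* t) :* (b :+ y :* t)) :* c :=
         t :* (y :* (a :* c) :+ x :* ((b :+ y :* t) :* c)) :+ (a :* b) :* c) ≈-refl 𝕥 (κ x) (κ y) (𝕓 x) (𝕓 y) (𝕓 z) ⟩
  𝕥 ⋆ (κ y ⋆ (𝕓 x ⋆ 𝕓 z) ⊕ κ x ⋆ ((𝕓 y ⊕ κ y ⋆ 𝕥) ⋆ 𝕓 z)) ⊕ (𝕓 x ⋆ 𝕓 y) ⋆ 𝕓 z ∎))
  where
  open ≈-Reasoning
  z = x + y

-- The identity `-t/(e^(-t) - 1) = t + t/(e^t - 1)`. Without division it comes from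
-- `n e^(-t) + t = n`, multiplied by `B e^t`.
𝕓-neg : 𝕓 (- 1ℚ) ≈ B ⊕ 𝕥
𝕓-neg = 𝕥-cancel (⊕-cancelʳ (B ⋆ n) (begin
  𝕥 ⋆ n ⊕ B ⋆ n            ≈⟨ solve 3 (λ t n b → t :* n :+ b :* n := n :* (b :+ t)) ≈-refl 𝕥 n B ⟩
  n ⋆ (B ⊕ 𝕥)              ≈⟨ ⋆-cong ≈-refl (≈-sym B⋆exp1) ⟩
  n ⋆ (B ⋆ e)              ≈⟨ ⋆-cong n-def ≈-refl ⟩
  (n ⋆ exp (- 1ℚ) ⊕ 𝕥) ⋆ (B ⋆ e)
    ≈⟨ solve 5 (λ n f t b e → (n :* f :+ t) :* (b :* e) := (n :* b) :* (f :* e) :+ t :* (b :* e)) ≈-refl n (exp (- 1ℚ)) 𝕥 B e ⟩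
  (n ⋆ B) ⋆ (exp (- 1ℚ) ⋆ e) ⊕ 𝕥 ⋆ (B ⋆ e)
    ≈⟨ ⊕-cong (⋆-cong ≈-refl (≈-trans (exp-+ (- 1ℚ) 1ℚ) ⟨ powℚ-0 ⟩)) (⋆-cong ≈-refl B⋆exp1) ⟩
  (n ⋆ B) ⋆ 𝟙 ⊕ 𝕥 ⋆ (B ⊕ 𝕥)
    ≈⟨ solve 3 (λ n b t → (n :* b) :* con 1 :+ t :* (b :+ t) := t :* (b :+ t) :+ b :* n) ≈-refl n B 𝕥 ⟩
  𝕥 ⋆ (B ⊕ 𝕥) ⊕ B ⋆ n      ∎))
  where
  open ≈-Reasoning
  n e : Seq
  n = 𝕓 (- 1ℚ)
  e = exp 1ℚ
  n-def : n ≈ n ⋆ exp (- 1ℚ) ⊕ 𝕥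
  n-def = ≈-sym (≈-trans (⊕-cong (𝕓⋆exp (- 1ℚ)) ≈-refl)
    ⟨ (λ k → trans (cong (λ y → n k + y + 𝕥 k) (coeff (κ-⋆ (- 1ℚ) 𝕥) k)) (shuffle (n k) (𝕥 k))) ⟩)
    where
    shuffle : ∀ a t → a + (- 1ℚ) * t + t ≡ a
    shuffle = solve-∀ ringℚ

powℚ-neg1-odd : ∀ m → powℚ (- 1ℚ) (suc (m ℕ.+ m)) ≡ - 1ℚ
powℚ-neg1-odd zero    = refl
powℚ-neg1-odd (suc m) = begin
  powℚ (- 1ℚ) (suc (suc m ℕ.+ suc m))               ≡⟨ cong (λ k → powℚ (- 1ℚ) (suc (suc k))) (ℕP.+-suc m m) ⟩
  (- 1ℚ) * ((- 1ℚ) * powℚ (- 1ℚ) (suc (m ℕ.+ m)))   ≡⟨ cong (λ y → (- 1ℚ) * ((- 1ℚ) * y)) (powℚ-neg1-odd m) ⟩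
  - 1ℚ                                              ∎
  where open ≡-Reasoning

-- Comparing coefficients in `𝕓-neg` gives `-b = b`. The index starts at 3 because `𝕥` contributes
-- in degree 1.
B-odd : ∀ m → B (suc (suc m ℕ.+ suc m)) ≡ 0ℚ
B-odd m = begin
  b                        ≡⟨ halve b ⟩
  ½ * ((b + 0ℚ) - (- 1ℚ) * b)
    ≡⟨ cong (λ y → ½ * (y - (- 1ℚ) * b)) (sym (trans (cong (_* b) (sym (powℚ-neg1-odd (suc m)))) (coeff 𝕓-neg (suc (suc m ℕ.+ suc m))))) ⟩
  ½ * ((- 1ℚ) * b - (- 1ℚ) * b)   ≡⟨ vanish ((- 1ℚ) * b) ⟩
  0ℚ                              ∎
  where
  open ≡-Reasoning
  b = B (suc (suc m ℕ.+ suc m))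
  halve : ∀ b → b ≡ ½ * ((b + 0ℚ) - (- 1ℚ) * b)
  halve = solve-∀ ringℚ
  vanish : ∀ b → ½ * (b - b) ≡ 0ℚ
  vanish = solve-∀ ringℚ

-- Multiplying by e^1 - 1 telescopes the sum.
B-multiplication : ∀ m → 𝕓 (ℕ→ℚ m) ⋆ (λ j → sumℚ m (λ l → powℚ (ℕ→ℚ l) j)) ≈ κ (ℕ→ℚ m) ⋆ B
B-multiplication m = 𝕥-cancel (⊕-cancelʳ ((B ⋆ b′) ⋆ E m) (⊕-cancelʳ (B ⋆ b′) (begin
  (𝕥 ⋆ (b′ ⋆ E m) ⊕ (B ⋆ b′) ⋆ E m) ⊕ B ⋆ b′
    ≈⟨ solve 4 (λ t c E b → (t :* (c :* E) :+ (b :* c) :* E) :+ b :* c := c :* ((b :+ t) :* E :+ b)) ≈-refl 𝕥 b′ (E m) B ⟩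
  b′ ⋆ ((B ⊕ 𝕥) ⋆ E m ⊕ B)
    ≈⟨ ⋆-cong ≈-refl (⊕-cong (⋆-cong (≈-sym B⋆exp1) ≈-refl) ≈-refl) ⟩
  b′ ⋆ ((B ⋆ exp 1ℚ) ⋆ E m ⊕ B)
    ≈⟨ solve 4 (λ c b e E → c :* ((b :* e) :* E :+ b) := (c :* b) :* (E :* e :+ con 1)) ≈-refl b′ B (exp 1ℚ) (E m) ⟩
  (b′ ⋆ B) ⋆ (E m ⋆ exp 1ℚ ⊕ 𝟙)
    ≈⟨ ⋆-cong ≈-refl (telescope m) ⟩
  (b′ ⋆ B) ⋆ (E m ⊕ exp (ℕ→ℚ m))
    ≈⟨ solve 4 (λ c b E e → (c :* b) :* (E :+ e) := (b :* c) :* E :+ b :* (c :* e)) ≈-refl b′ B (E m) (exp (ℕ→ℚ m)) ⟩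
  (B ⋆ b′) ⋆ E m ⊕ B ⋆ (b′ ⋆ exp (ℕ→ℚ m))
    ≈⟨ ⊕-congˡ ((B ⋆ b′) ⋆ E m) (⋆-cong ≈-refl (𝕓⋆exp (ℕ→ℚ m))) ⟩
  (B ⋆ b′) ⋆ E m ⊕ B ⋆ (b′ ⊕ κ (ℕ→ℚ m) ⋆ 𝕥)
    ≈⟨ solve 5 (λ b c E k t → (b :* c) :* E :+ b :* (c :+ k :* t) := (t :* (k :* b) :+ (b :* c) :* E) :+ b :* c) ≈-refl B b′ (E m) (κ (ℕ→ℚ m)) 𝕥 ⟩
  (𝕥 ⋆ (κ (ℕ→ℚ m) ⋆ B) ⊕ (B ⋆ b′) ⋆ E m) ⊕ B ⋆ b′ ∎)))
  where
  open ≈-Reasoning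
  b′ = 𝕓 (ℕ→ℚ m)
  E : ℕ → Seq
  E m j = sumℚ m (λ l → powℚ (ℕ→ℚ l) j)
  telescope : ∀ m → E m ⋆ exp 1ℚ ⊕ 𝟙 ≈ E m ⊕ exp (ℕ→ℚ m)
  telescope zero    = ⊕-cong (CommutativeSemiring.zeroˡ Seq-commutativeSemiring (exp 1ℚ)) ⟨ (λ n → sym (powℚ-0 n)) ⟩
  telescope (suc m) = begin
    (E m ⊕ exp (ℕ→ℚ m)) ⋆ exp 1ℚ ⊕ 𝟙
      ≈⟨ solve 3 (λ E a e → (E :+ a) :* e :+ con 1 := (E :* e :+ con 1) :+ e :* a) ≈-refl (E m) (exp (ℕ→ℚ m)) (exp 1ℚ) ⟩
    (E m ⋆ exp 1ℚ ⊕ 𝟙) ⊕ exp 1ℚ ⋆ exp (ℕ→ℚ m)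
      ≈⟨ ⊕-cong (telescope m) (≈-trans (exp-+ 1ℚ (ℕ→ℚ m)) (≡⇒≈ (cong exp (sym (ℕ→ℚ-suc m))))) ⟩
    E (suc m) ⊕ exp (ℕ→ℚ (suc m)) ∎

-- Periodic Bernoulli functions

InUnit : ℚ → Set
InUnit y = 0ℚ ℚ.≤ y × y ℚ.< 1ℚ

frac+floor : ∀ x → x ≡ frac x + ℤ→ℚ (floor x)
frac+floor x = shuffle x (ℤ→ℚ (floor x))
  where
  shuffle : ∀ x y → x ≡ (x - y) + y
  shuffle = solve-∀ ringℚ

-- `floor` divides the numerator by the denominator, so the fractional part is remainder over
-- denominator; the bounds on the remainder then place it in `[0, 1)`.
frac-*-denominator : ∀ x → frac x * ℕ→ℚ (↧ₙ x) ≡ ℕ→ℚ (↥ x ℤ.% ↧ x)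
frac-*-denominator x@(mkℚ n d-1 _) = begin
  (x - ℤ→ℚ f) * ℕ→ℚ d             ≡⟨ shuffle x (ℤ→ℚ f) (ℕ→ℚ d) ⟩
  x * ℕ→ℚ d - ℤ→ℚ f * ℕ→ℚ d       ≡⟨ cong₂ _-_ x*d (sym (ℤ→ℚ-* f (+ d))) ⟩
  ℤ→ℚ n - ℤ→ℚ (f ℤ.* (+ d))       ≡⟨ cong (λ k → ℤ→ℚ k - ℤ→ℚ (f ℤ.* (+ d))) (ℤDM.a≡a%n+[a/n]*n n (+ d)) ⟩
  ℤ→ℚ ((+ ρ) ℤ.+ f ℤ.* (+ d)) - ℤ→ℚ (f ℤ.* (+ d))
    ≡⟨ cong (_- ℤ→ℚ (f ℤ.* (+ d))) (ℤ→ℚ-+ (+ ρ) (f ℤ.* (+ d))) ⟩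
  (ℕ→ℚ ρ + ℤ→ℚ (f ℤ.* (+ d))) - ℤ→ℚ (f ℤ.* (+ d))
    ≡⟨ shuffle′ (ℕ→ℚ ρ) (ℤ→ℚ (f ℤ.* (+ d))) ⟩
  ℕ→ℚ ρ                           ∎
  where
  open ≡-Reasoning
  d = suc d-1
  f = floor x
  ρ = n ℤ.% (+ d)
  x*d : x * ℕ→ℚ d ≡ ℤ→ℚ n
  x*d = trans (cong (_* ℕ→ℚ d) (sym (ℚP.↥p/↧p≡p x))) (/-*-cancel n d)
  shuffle : ∀ x f d → (x - f) * d ≡ x * d - f * d
  shuffle = solve-∀ ringℚ
  shuffle′ : ∀ a b → (a + b) - b ≡ a
  shuffle′ = solve-∀ ringℚ

ℕ→ℚ-nonNeg : ∀ n → 0ℚ ℚ.≤ ℕ→ℚ n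
ℕ→ℚ-nonNeg n = ℤ→ℚ-mono-≤ {+ 0} {+ n} (ℤ.+≤+ z≤n)

ℕ→ℚ-pos : ∀ n .{{_ : NonZero n}} → ℚ.Positive (ℕ→ℚ n)
ℕ→ℚ-pos n = ℚP.normalize-pos n 1

frac-InUnit : ∀ x → InUnit (frac x)
frac-InUnit x@record{} =
  ℚP.*-cancelʳ-≤-pos D {{ℕ→ℚ-pos (↧ₙ x)}} (subst₂ ℚ._≤_ (sym (ℚP.*-zeroˡ D)) (sym (frac-*-denominator x)) (ℕ→ℚ-nonNeg (↥ x ℤ.% ↧ x))) ,
  ℚP.*-cancelʳ-<-nonNeg D {{ℚP.pos⇒nonNeg D {{ℕ→ℚ-pos (↧ₙ x)}}}}
    (subst₂ ℚ._<_ (sym (frac-*-denominator x)) (sym (ℚP.*-identityˡ D)) (ℤ→ℚ-mono-< (ℤ.+<+ (ℤDM.n%d<d (↥ x) (↧ x)))))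
  where D = ℕ→ℚ (↧ₙ x)

integer-between : ∀ k → ℤ.-1ℤ ℤ.< k → k ℤ.< ℤ.1ℤ → k ≡ ℤ.0ℤ
integer-between (+ zero)       _ _ = refl
integer-between (+ suc n)      _ (ℤ.+<+ (s≤s ()))
integer-between (ℤ.-[1+ n ]) (ℤ.-<- ()) _

-- Two points of `[0, 1)` differ by less than 1, and here their difference is the integer `z - z′`,
-- hence 0.
decomposition-unique : ∀ {y y′} z z′ → InUnit y → InUnit y′ → y + ℤ→ℚ z ≡ y′ + ℤ→ℚ z′ → y ≡ y′
decomposition-unique {y} {y′} z z′ (0≤y , y<1) (0≤y′ , y′<1) e =
  trans (shuffle₁ y (ℤ→ℚ z)) (trans (cong (_- ℤ→ℚ z) e)
    (trans (cong (λ k → (y′ + ℤ→ℚ z′) - ℤ→ℚ k) (ℤP.i-j≡0⇒i≡j z z′ z-z′≡0)) (sym (shuffle₁ y′ (ℤ→ℚ z′)))))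
  where
  shuffle₁ : ∀ a b → a ≡ (a + b) - b
  shuffle₁ = solve-∀ ringℚ
  shuffle₂ : ∀ a b c → b - c ≡ (a + b) - (a + c)
  shuffle₂ = solve-∀ ringℚ
  shuffle₃ : ∀ a b c → (b + c) - (a + c) ≡ b - a
  shuffle₃ = solve-∀ ringℚ
  difference : ℤ→ℚ (z ℤ.- z′) ≡ y′ - y
  difference = trans (ℤ→ℚ-- z z′) (trans (shuffle₂ y (ℤ→ℚ z) (ℤ→ℚ z′)) (trans (cong (_- (y + ℤ→ℚ z′)) e) (shuffle₃ y y′ (ℤ→ℚ z′))))
  z-z′≡0 : z ℤ.- z′ ≡ ℤ.0ℤ
  z-z′≡0 = integer-between (z ℤ.- z′)
    (ℤ→ℚ-cancel-< (subst (ℤ→ℚ ℤ.-1ℤ ℚ.<_) (sym difference) (subst (ℚ._< y′ - y) (ℚP.+-identityˡ _) (ℚP.+-mono-≤-< 0≤y′ (ℚP.neg-antimono-< y<1)))))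
    (ℤ→ℚ-cancel-< (subst (ℚ._< ℤ→ℚ ℤ.1ℤ) (sym difference) (subst (y′ - y ℚ.<_) (ℚP.+-identityʳ _) (ℚP.+-mono-<-≤ y′<1 (ℚP.neg-antimono-≤ 0≤y)))))

frac-unique : ∀ {y} z → InUnit y → frac (y + ℤ→ℚ z) ≡ y
frac-unique {y} z y∈ = decomposition-unique (floor x) z (frac-InUnit x) y∈ (sym (frac+floor x))
  where x = y + ℤ→ℚ z

isInt⇒≡ : ∀ x → isInt x ≡ true → x ≡ ℤ→ℚ (↥ x)
isInt⇒≡ x@(mkℚ n zero c) eq = sym (ℚP.↥p/↧p≡p x)

isInt-ℤ→ℚ : ∀ z → isInt (ℤ→ℚ z) ≡ true
isInt-ℤ→ℚ z rewrite ℤ→ℚ-mk z = refl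

-- The convention B̄₁ = 0 at integers amounts to adding ½ to B₁ there.
h : ℚ → ℚ
h y with y ℚP.≟ 0ℚ
... | yes _ = ½
... | no  _ = 0ℚ

h-nonzero : ∀ {y} → y ≢ 0ℚ → h y ≡ 0ℚ
h-nonzero {y} y≢0 with y ℚP.≟ 0ℚ
... | yes y≡0 = contradiction y≡0 y≢0
... | no  _   = refl

Bpoly-⋆ : ∀ n y → Bpoly n y ≡ (B ⋆ exp y) n
Bpoly-⋆ n y = sym (trans (binomial-⋆ B (exp y) n) (sum-cong′ (suc n) (λ k → sym (ℚP.*-assoc (ℕ→ℚ (n C k)) (B k) (powℚ y (n ∸ k))))))

Bbar-integer : ∀ n x → isInt x ≡ true → Bbar n x ≡ B n + ½ * 𝕥 n
Bbar-integer n x eq with isInt x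
Bbar-integer zero x refl | true = refl
Bbar-integer (suc zero) x refl | true = refl
Bbar-integer (suc (suc n)) x refl | true = sym (trans (cong (ℚ._+_ (B (suc (suc n)))) (ℚP.*-zeroʳ ½)) (ℚP.+-identityʳ _))

Bbar-noninteger : ∀ n x → isInt x ≡ false → Bbar n x ≡ Bpoly n (frac x)
Bbar-noninteger n x eq with isInt x
Bbar-noninteger n x refl | false = refl

-- The integer and non-integer branches of `Bbar` merge into one formula: they differ from the
-- Bernoulli polynomial series only by a multiple of `t`, which `h` records.
Bbar-InUnit : ∀ n {y} z → InUnit y → Bbar n (y + ℤ→ℚ z) ≡ (B ⋆ exp y) n + h y * 𝕥 n
Bbar-InUnit n {y} z y∈ = cases (isInt x) refl
  where
  open ≡-Reasoning
  x = y + ℤ→ℚ z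
  0∈ : InUnit 0ℚ
  0∈ = ℚP.≤-refl , ℚP.positive⁻¹ 1ℚ
  y≡0 : isInt x ≡ true → y ≡ 0ℚ
  y≡0 eq = decomposition-unique z (↥ x) y∈ 0∈ (trans (isInt⇒≡ x eq) (sym (ℚP.+-identityˡ (ℤ→ℚ (↥ x)))))
  y≢0 : isInt x ≡ false → y ≢ 0ℚ
  y≢0 eq y≡0 = contradiction (trans (sym (isInt-ℤ→ℚ z)) (trans (cong isInt (sym (trans (cong (_+ ℤ→ℚ z) y≡0) (ℚP.+-identityˡ (ℤ→ℚ z))))) eq)) λ ()
  cases : ∀ b → isInt x ≡ b → Bbar n x ≡ (B ⋆ exp y) n + h y * 𝕥 n
  cases true eq = begin
    Bbar n x                         ≡⟨ Bbar-integer n x eq ⟩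
    B n + ½ * 𝕥 n                    ≡⟨ cong (_+ ½ * 𝕥 n) (sym (trans (coeff (⋆-cong (≈-refl {B}) ⟨ powℚ-0 ⟩) n) (trans (coeff (⋆-comm B 𝟙) n) (coeff (𝟙-⋆ B) n)))) ⟩
    (B ⋆ exp 0ℚ) n + h 0ℚ * 𝕥 n      ≡⟨ cong (λ y → (B ⋆ exp y) n + h y * 𝕥 n) (sym (y≡0 eq)) ⟩
    (B ⋆ exp y) n + h y * 𝕥 n        ∎
  cases false eq = begin
    Bbar n x                         ≡⟨ Bbar-noninteger n x eq ⟩
    Bpoly n (frac x)                 ≡⟨ cong (Bpoly n) (frac-unique z y∈) ⟩
    Bpoly n y                        ≡⟨ Bpoly-⋆ n y ⟩
    (B ⋆ exp y) n                    ≡⟨ sym (ℚP.+-identityʳ _) ⟩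
    (B ⋆ exp y) n + 0ℚ               ≡⟨ cong (ℚ._+_ ((B ⋆ exp y) n)) (sym (trans (cong (_* 𝕥 n) (h-nonzero (y≢0 eq))) (ℚP.*-zeroˡ (𝕥 n)))) ⟩
    (B ⋆ exp y) n + h y * 𝕥 n        ∎

c : ℚ → ℚ → Seq
c α x = σ x (λ n → Bbar n α)

c-InUnit : ∀ {α} y z x → InUnit y → α ≡ y + ℤ→ℚ z → c α x ≈ 𝕓 x ⋆ exp (x * y) ⊕ κ (h y) ⋆ (κ x ⋆ 𝕥)
c-InUnit y z x y∈ refl = begin
  c (y + ℤ→ℚ z) x                              ≈⟨ σ-cong x ⟨ (λ n → Bbar-InUnit n z y∈) ⟩ ⟩
  σ x (B ⋆ exp y ⊕ h y · 𝕥)                    ≈⟨ σ-⊕ x (B ⋆ exp y) (h y · 𝕥) ⟩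
  σ x (B ⋆ exp y) ⊕ σ x (h y · 𝕥)              ≈⟨ ⊕-cong (≈-trans (σ-⋆ x B (exp y)) (⋆-cong ≈-refl (σ-exp x y))) scalar ⟩
  𝕓 x ⋆ exp (x * y) ⊕ κ (h y) ⋆ (κ x ⋆ 𝕥)      ∎
  where
  open ≈-Reasoning
  shuffle : ∀ p h t → p * (h * t) ≡ h * (p * t)
  shuffle = solve-∀ ringℚ
  scalar : σ x (h y · 𝕥) ≈ κ (h y) ⋆ (κ x ⋆ 𝕥)
  scalar = ≈-trans ⟨ (λ n → shuffle (powℚ x n) (h y) (𝕥 n)) ⟩
    (≈-trans (≈-sym (κ-⋆ (h y) (σ x 𝕥))) (⋆-cong ≈-refl (σ-𝕥 x)))

c-periodic : ∀ {α β} z x → α ≡ β + ℤ→ℚ z → c α x ≈ c β x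
c-periodic {α} {β} z x α≡β+z = ≈-trans (c-InUnit (frac β) (floor β ℤ.+ z) x (frac-InUnit β) decomposed)
  (≈-sym (c-InUnit (frac β) (floor β) x (frac-InUnit β) (frac+floor β)))
  where
  open ≡-Reasoning
  decomposed : α ≡ frac β + ℤ→ℚ (floor β ℤ.+ z)
  decomposed = begin
    α                                        ≡⟨ α≡β+z ⟩
    β + ℤ→ℚ z                                ≡⟨ cong (_+ ℤ→ℚ z) (frac+floor β) ⟩
    (frac β + ℤ→ℚ (floor β)) + ℤ→ℚ z         ≡⟨ ℚP.+-assoc (frac β) _ _ ⟩
    frac β + (ℤ→ℚ (floor β) + ℤ→ℚ z)         ≡⟨ cong (ℚ._+_ (frac β)) (sym (ℤ→ℚ-+ (floor β) z)) ⟩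
    frac β + ℤ→ℚ (floor β ℤ.+ z)             ∎

κ0-⋆ : ∀ {k} a → k ≡ 0ℚ → κ k ⋆ a ≈ 𝟘
κ0-⋆ a refl = ≈-trans (κ-⋆ 0ℚ a) ⟨ (λ n → ℚP.*-zeroˡ (a n)) ⟩

⊕-identityʳ : ∀ a {b} → b ≈ 𝟘 → a ⊕ b ≈ a
⊕-identityʳ a e = ⟨ (λ n → trans (cong (ℚ._+_ (a n)) (coeff e n)) (ℚP.+-identityʳ (a n))) ⟩

exp-0 : ∀ {x} → x ≡ 0ℚ → exp x ≈ 𝟙
exp-0 refl = ⟨ powℚ-0 ⟩

c-InUnit-nonzero : ∀ {α} y z x → InUnit y → y ≢ 0ℚ → α ≡ y + ℤ→ℚ z → c α x ≈ 𝕓 x ⋆ exp (x * y)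
c-InUnit-nonzero y z x y∈ y≢0 e = ≈-trans (c-InUnit y z x y∈ e) (⊕-identityʳ (𝕓 x ⋆ exp (x * y)) (κ0-⋆ (κ x ⋆ 𝕥) (h-nonzero y≢0)))

h-cases : ∀ y → (y ≢ 0ℚ × h y ≡ 0ℚ) ⊎ (y ≡ 0ℚ × h y ≡ ½)
h-cases y with y ℚP.≟ 0ℚ
... | yes y≡0 = inj₂ (y≡0 , refl)
... | no  y≢0 = inj₁ (y≢0 , refl)

-- Either `h y` vanishes, or `y = 0` and the exponential is 1.
κh-exp : ∀ y x → κ (h y) ⋆ exp (x * y) ≈ κ (h y)
κh-exp y x with h-cases y
... | inj₁ (_ , h≡0)   = ≈-trans (κ0-⋆ (exp (x * y)) h≡0) (≈-trans (≈-sym ⟨ (λ { zero → refl ; (suc n) → refl }) ⟩) (≡⇒≈ (cong κ (sym h≡0))))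
... | inj₂ (y≡0 , _) = ≈-trans (⋆-cong ≈-refl (exp-0 (trans (cong (x *_) y≡0) (ℚP.*-zeroʳ x)))) (≈-trans (⋆-comm (κ (h y)) 𝟙) (𝟙-⋆ (κ (h y))))

-- The two values of `h`, 0 and `½`, are the roots of `2 h² = h`.
κh-square : ∀ y → κ (h y) ⋆ κ (h y) ⊕ κ (h y) ⋆ κ (h y) ≈ κ (h y)
κh-square y = ≈-trans (⊕-cong (≈-sym (κ-* (h y) (h y))) (≈-sym (κ-* (h y) (h y))))
  (≈-trans (≈-sym (κ-+ (h y * h y) (h y * h y))) (≡⇒≈ (cong κ lem)))
  where
  lem : h y * h y + h y * h y ≡ h y
  lem with h-cases y
  ... | inj₁ (_ , h≡0) = trans (cong (λ e → e * e + e * e) h≡0) (sym h≡0)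
  ... | inj₂ (_ , h≡½) = trans (cong (λ e → e * e + e * e) h≡½) (sym h≡½)

-- The three-term relation for periodic Bernoulli functions

private
  p<q⇒0<q-p : ∀ {a b} → b ℚ.< a → 0ℚ ℚ.< a - b
  p<q⇒0<q-p {a} {b} b<a = subst (ℚ._< a - b) (ℚP.+-inverseʳ b) (ℚP.+-monoˡ-< (- b) b<a)

-- The correction stands on the left to avoid subtraction. `ε` will be `h (frac α) * h (frac β)`,
-- which is a quarter if both arguments are integers and 0 otherwise.
ThreeTerm : (α β x y : ℚ) → ℚ → Set
ThreeTerm α β x y ε =
  κ (x + y) ⋆ (c α x ⋆ c β y) ⊕ κ ε ⋆ (κ x ⋆ (κ y ⋆ (κ (x + y) ⋆ (𝕥 ⋆ 𝕥)))) ≈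
  κ y ⋆ (c (α - β) x ⋆ c β (x + y)) ⊕ κ x ⋆ (c (β - α) y ⋆ c α (x + y))

-- If `b < a`, then `a`, `a - b` and `1 - (a - b)` lie strictly between 0 and 1 and represent `α`,
-- `α - β` and `β - α`. Only `β` can be an integer, and the relation is `𝕓-three-term` multiplied by
-- `e^(x a + y b)`.
three-term-> : ∀ {α β} a b i j x y → InUnit a → InUnit b → b ℚ.< a →
  α ≡ a + ℤ→ℚ i → β ≡ b + ℤ→ℚ j → ThreeTerm α β x y (h a * h b)
three-term-> {α} {β} a b i j x y (0≤a , a<1) b∈@(0≤b , b<1) b<a refl refl = begin
  κ z ⋆ (c α x ⋆ c β y) ⊕ κ (h a * h b) ⋆ T
    ≈⟨ ⊕-identityʳ (κ z ⋆ (c α x ⋆ c β y)) (κ0-⋆ T (trans (cong (_* h b) (h-nonzero a≢0)) (ℚP.*-zeroˡ (h b)))) ⟩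
  κ z ⋆ (c α x ⋆ c β y)
    ≈⟨ ⋆-cong ≈-refl (⋆-cong (c-InUnit-nonzero a i x (0≤a , a<1) a≢0 refl) (c-InUnit b j y b∈ refl)) ⟩
  κ z ⋆ ((𝕓 x ⋆ X) ⋆ (𝕓 y ⋆ Y ⊕ κ (h b) ⋆ (κ y ⋆ 𝕥)))
    ≈⟨ solve 8 (λ z a X b Y h y t → z :* ((a :* X) :* (b :* Y :+ h :* (y :* t))) :=
         (X :* Y) :* (z :* (a :* b)) :+ (h :* X) :* (z :* (y :* (t :* a)))) ≈-refl (κ z) (𝕓 x) X (𝕓 y) Y (κ (h b)) (κ y) 𝕥 ⟩
  (X ⋆ Y) ⋆ (κ z ⋆ (𝕓 x ⋆ 𝕓 y)) ⊕ (κ (h b) ⋆ X) ⋆ (κ z ⋆ (κ y ⋆ (𝕥 ⋆ 𝕓 x)))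
    ≈⟨ ⊕-cong (⋆-cong ≈-refl (𝕓-three-term x y)) (⋆-cong hX≈hP ≈-refl) ⟩
  (X ⋆ Y) ⋆ (κ y ⋆ (𝕓 x ⋆ 𝕓 z) ⊕ κ x ⋆ ((𝕓 y ⊕ κ y ⋆ 𝕥) ⋆ 𝕓 z)) ⊕ (κ (h b) ⋆ P) ⋆ (κ z ⋆ (κ y ⋆ (𝕥 ⋆ 𝕓 x)))
    -- The factor `e^y` hidden in `𝕓 y ⊕ κ y ⋆ 𝕥` supplies the 1 in `1 - (a - b)`.
    ≈⟨ ⊕-cong (⋆-cong (≈-refl {X ⋆ Y}) (⊕-congˡ (κ y ⋆ (𝕓 x ⋆ 𝕓 z)) (⋆-cong ≈-refl (⋆-cong (≈-sym (𝕓⋆exp y)) ≈-refl)))) ≈-refl ⟩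
  (X ⋆ Y) ⋆ (κ y ⋆ (𝕓 x ⋆ 𝕓 z) ⊕ κ x ⋆ ((𝕓 y ⋆ exp y) ⋆ 𝕓 z)) ⊕ (κ (h b) ⋆ P) ⋆ (κ z ⋆ (κ y ⋆ (𝕥 ⋆ 𝕓 x)))
    ≈⟨ ⊕-cong (solve 7 (λ W y a d x b e → W :* (y :* (a :* d) :+ x :* ((b :* e) :* d)) := (y :* (a :* d)) :* W :+ (x :* (b :* d)) :* (W :* e))
         ≈-refl (X ⋆ Y) (κ y) (𝕓 x) (𝕓 z) (κ x) (𝕓 y) (exp y)) ≈-refl ⟩
  ((κ y ⋆ (𝕓 x ⋆ 𝕓 z)) ⋆ (X ⋆ Y) ⊕ (κ x ⋆ (𝕓 y ⋆ 𝕓 z)) ⋆ ((X ⋆ Y) ⋆ exp y)) ⊕ (κ (h b) ⋆ P) ⋆ (κ z ⋆ (κ y ⋆ (𝕥 ⋆ 𝕓 x)))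
    ≈⟨ ⊕-cong (⊕-cong (⋆-cong ≈-refl XY≈PZ) (⋆-cong ≈-refl XYe≈QZ)) ≈-refl ⟩
  ((κ y ⋆ (𝕓 x ⋆ 𝕓 z)) ⋆ (P ⋆ Zb) ⊕ (κ x ⋆ (𝕓 y ⋆ 𝕓 z)) ⋆ (Q ⋆ Za)) ⊕ (κ (h b) ⋆ P) ⋆ (κ z ⋆ (κ y ⋆ (𝕥 ⋆ 𝕓 x)))
    ≈⟨ solve 12 (λ y a d P Zb x b Q Za h z t →
         ((y :* (a :* d)) :* (P :* Zb) :+ (x :* (b :* d)) :* (Q :* Za)) :+ (h :* P) :* (z :* (y :* (t :* a))) :=
         y :* ((a :* P) :* (d :* Zb :+ h :* (z :* t))) :+ x :* ((b :* Q) :* (d :* Za)))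
         ≈-refl (κ y) (𝕓 x) (𝕓 z) P Zb (κ x) (𝕓 y) Q Za (κ (h b)) (κ z) 𝕥 ⟩
  κ y ⋆ ((𝕓 x ⋆ P) ⋆ (𝕓 z ⋆ Zb ⊕ κ (h b) ⋆ (κ z ⋆ 𝕥))) ⊕ κ x ⋆ ((𝕓 y ⋆ Q) ⋆ (𝕓 z ⋆ Za))
    ≈⟨ ⊕-cong
         (⋆-cong ≈-refl (⋆-cong (≈-sym (c-InUnit-nonzero (a - b) (i ℤ.- j) x a-b∈ a-b≢0 α-β)) (≈-sym (c-InUnit b j z b∈ refl))))
         (⋆-cong ≈-refl (⋆-cong (≈-sym (c-InUnit-nonzero (1ℚ - (a - b)) (j ℤ.- i ℤ.- ℤ.1ℤ) y 1-∈ 1-≢0 β-α)) (≈-sym (c-InUnit-nonzero a i z (0≤a , a<1) a≢0 refl)))) ⟩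
  κ y ⋆ (c (α - β) x ⋆ c β z) ⊕ κ x ⋆ (c (β - α) y ⋆ c α z) ∎
  where
  open ≈-Reasoning
  z = x + y
  T = κ x ⋆ (κ y ⋆ (κ z ⋆ (𝕥 ⋆ 𝕥)))
  X = exp (x * a)
  Y = exp (y * b)
  P = exp (x * (a - b))
  Q = exp (y * (1ℚ - (a - b)))
  Za = exp (z * a)
  Zb = exp (z * b)
  0<a : 0ℚ ℚ.< a
  0<a = ℚP.≤-<-trans 0≤b b<a
  a≢0 : a ≢ 0ℚ
  a≢0 a≡0 = ℚP.<⇒≢ 0<a (sym a≡0)
  0<a-b : 0ℚ ℚ.< a - b
  0<a-b = p<q⇒0<q-p b<a
  a-b≢0 : a - b ≢ 0ℚ
  a-b≢0 e = ℚP.<⇒≢ 0<a-b (sym e)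
  a-b<1 : a - b ℚ.< 1ℚ
  a-b<1 = subst (a - b ℚ.<_) (ℚP.+-identityʳ 1ℚ) (ℚP.+-mono-<-≤ a<1 (ℚP.neg-antimono-≤ 0≤b))
  a-b∈ : InUnit (a - b)
  a-b∈ = ℚP.<⇒≤ 0<a-b , a-b<1
  0<1- : 0ℚ ℚ.< 1ℚ - (a - b)
  0<1- = p<q⇒0<q-p a-b<1
  1-∈ : InUnit (1ℚ - (a - b))
  1-∈ = ℚP.<⇒≤ 0<1- , subst (1ℚ - (a - b) ℚ.<_) (ℚP.+-identityʳ 1ℚ) (ℚP.+-monoʳ-< 1ℚ (ℚP.neg-antimono-< 0<a-b))
  1-≢0 : 1ℚ - (a - b) ≢ 0ℚ
  1-≢0 e = ℚP.<⇒≢ 0<1- (sym e)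
  α-β : α - β ≡ (a - b) + ℤ→ℚ (i ℤ.- j)
  α-β = trans (lem a b (ℤ→ℚ i) (ℤ→ℚ j)) (cong (ℚ._+_ (a - b)) (sym (ℤ→ℚ-- i j)))
    where
    lem : ∀ a b i j → (a + i) - (b + j) ≡ (a - b) + (i - j)
    lem = solve-∀ ringℚ
  β-α : β - α ≡ (1ℚ - (a - b)) + ℤ→ℚ (j ℤ.- i ℤ.- ℤ.1ℤ)
  β-α = trans (lem a b (ℤ→ℚ i) (ℤ→ℚ j)) (cong (ℚ._+_ (1ℚ - (a - b))) (sym (trans (ℤ→ℚ-- (j ℤ.- i) ℤ.1ℤ) (cong (_- 1ℚ) (ℤ→ℚ-- j i)))))
    where
    lem : ∀ a b i j → (b + j) - (a + i) ≡ (1ℚ - (a - b)) + ((j - i) - 1ℚ)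
    lem = solve-∀ ringℚ
  exp-eq : ∀ {u v w t} → u + v ≡ w + t → exp u ⋆ exp v ≈ exp w ⋆ exp t
  exp-eq {u} {v} {w} {t} e = ≈-trans (exp-+ u v) (≈-trans (≡⇒≈ (cong exp e)) (≈-sym (exp-+ w t)))
  XY≈PZ : X ⋆ Y ≈ P ⋆ Zb
  XY≈PZ = exp-eq (lem x y a b)
    where
    lem : ∀ x y a b → x * a + y * b ≡ x * (a - b) + (x + y) * b
    lem = solve-∀ ringℚ
  XYe≈QZ : (X ⋆ Y) ⋆ exp y ≈ Q ⋆ Za
  XYe≈QZ = ≈-trans (⋆-cong (exp-+ (x * a) (y * b)) ≈-refl) (exp-eq (lem x y a b))
    where
    lem : ∀ x y a b → (x * a + y * b) + y ≡ y * (1ℚ - (a - b)) + (x + y) * a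
    lem = solve-∀ ringℚ
  hX≈hP : κ (h b) ⋆ X ≈ κ (h b) ⋆ P
  hX≈hP = ≈-trans (⋆-cong ≈-refl (≈-trans (≡⇒≈ (cong exp (lem x a b))) (≈-sym (exp-+ (x * b) (x * (a - b))))))
    (≈-trans (≈-sym (⋆-assoc (κ (h b)) (exp (x * b)) P)) (⋆-cong (κh-exp b x) ≈-refl))
    where
    lem : ∀ x a b → x * a ≡ x * b + x * (a - b)
    lem = solve-∀ ringℚ

-- The product on the left contributes `h² x y z t²`. The correction doubles it, and `2 h² = h` then
-- lets the common factor `W = c α z = c β z` be taken out; this is what fixes the quarter.
three-term-≡ : ∀ {α β} a i j x y → InUnit a →
  α ≡ a + ℤ→ℚ i → β ≡ a + ℤ→ℚ j → ThreeTerm α β x y (h a * h a)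
three-term-≡ {α} {β} a i j x y a∈ refl refl = begin
  κ z ⋆ (c α x ⋆ c β y) ⊕ κ (h a * h a) ⋆ T
    ≈⟨ ⊕-cong (⋆-cong ≈-refl (⋆-cong (c-InUnit a i x a∈ refl) (c-InUnit a j y a∈ refl))) (⋆-cong (κ-* (h a) (h a)) ≈-refl) ⟩
  κ z ⋆ ((𝕓 x ⋆ X ⊕ H ⋆ (κ x ⋆ 𝕥)) ⋆ (𝕓 y ⋆ Y ⊕ H ⋆ (κ y ⋆ 𝕥))) ⊕ (H ⋆ H) ⋆ T
    ≈⟨ solve 9 (λ z a X h x t b Y y →
         z :* ((a :* X :+ h :* (x :* t)) :* (b :* Y :+ h :* (y :* t))) :+ (h :* h) :* (x :* (y :* (z :* (t :* t)))) :=
         (z :* (a :* b)) :* (X :* Y) :+ (z :* t) :* (((h :* X) :* (a :* y) :+ (h :* Y) :* (b :* x)) :+ (h :* h :+ h :* h) :* (x :* (y :* t))))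
         ≈-refl (κ z) (𝕓 x) X H (κ x) 𝕥 (𝕓 y) Y (κ y) ⟩
  (κ z ⋆ (𝕓 x ⋆ 𝕓 y)) ⋆ (X ⋆ Y) ⊕ (κ z ⋆ 𝕥) ⋆ (((H ⋆ X) ⋆ (𝕓 x ⋆ κ y) ⊕ (H ⋆ Y) ⋆ (𝕓 y ⋆ κ x)) ⊕ (H ⋆ H ⊕ H ⋆ H) ⋆ (κ x ⋆ (κ y ⋆ 𝕥)))
    ≈⟨ ⊕-cong (⋆-cong (𝕓-three-term x y) XY≈Z) (⋆-cong ≈-refl (⊕-cong (⊕-cong (⋆-cong (κh-exp a x) ≈-refl) (⋆-cong (κh-exp a y) ≈-refl)) (⋆-cong (κh-square a) ≈-refl))) ⟩
  (κ y ⋆ (𝕓 x ⋆ 𝕓 z) ⊕ κ x ⋆ ((𝕓 y ⊕ κ y ⋆ 𝕥) ⋆ 𝕓 z)) ⋆ Z ⊕ (κ z ⋆ 𝕥) ⋆ ((H ⋆ (𝕓 x ⋆ κ y) ⊕ H ⋆ (𝕓 y ⋆ κ x)) ⊕ H ⋆ (κ x ⋆ (κ y ⋆ 𝕥)))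
    ≈⟨ solve 9 (λ y a d x b t Z z h →
         (y :* (a :* d) :+ x :* ((b :+ y :* t) :* d)) :* Z :+ (z :* t) :* ((h :* (a :* y) :+ h :* (b :* x)) :+ h :* (x :* (y :* t))) :=
         (d :* Z :+ h :* (z :* t)) :* ((y :* a :+ x :* b) :+ con 1 :* (x :* (y :* t)))) ≈-refl (κ y) (𝕓 x) (𝕓 z) (κ x) (𝕓 y) 𝕥 Z (κ z) H ⟩
  W ⋆ ((κ y ⋆ 𝕓 x ⊕ κ x ⋆ 𝕓 y) ⊕ 𝟙 ⋆ (κ x ⋆ (κ y ⋆ 𝕥)))
    -- Since `α - β` is an integer, each summand on the right must carry the `½` that turns `B₁`
    -- into 0. The leftover `x y t` provides these two halves.
    ≈⟨ ⋆-cong ≈-refl (⊕-congˡ (κ y ⋆ 𝕓 x ⊕ κ x ⋆ 𝕓 y) (⋆-cong (κ-+ ½ ½) ≈-refl)) ⟩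
  W ⋆ ((κ y ⋆ 𝕓 x ⊕ κ x ⋆ 𝕓 y) ⊕ (κ ½ ⊕ κ ½) ⋆ (κ x ⋆ (κ y ⋆ 𝕥)))
    ≈⟨ solve 7 (λ W y a x b g t → W :* ((y :* a :+ x :* b) :+ (g :+ g) :* (x :* (y :* t))) :=
         y :* ((a :* con 1 :+ g :* (x :* t)) :* W) :+ x :* ((b :* con 1 :+ g :* (y :* t)) :* W)) ≈-refl W (κ y) (𝕓 x) (κ x) (𝕓 y) (κ ½) 𝕥 ⟩
  κ y ⋆ ((𝕓 x ⋆ 𝟙 ⊕ κ ½ ⋆ (κ x ⋆ 𝕥)) ⋆ W) ⊕ κ x ⋆ ((𝕓 y ⋆ 𝟙 ⊕ κ ½ ⋆ (κ y ⋆ 𝕥)) ⋆ W)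
    ≈⟨ ⊕-cong
         (⋆-cong ≈-refl (⋆-cong (≈-sym (c-int x (i ℤ.- j) (lem (ℤ→ℚ i) (ℤ→ℚ j) i j refl refl))) (≈-sym (c-InUnit a j z a∈ refl))))
         (⋆-cong ≈-refl (⋆-cong (≈-sym (c-int y (j ℤ.- i) (lem (ℤ→ℚ j) (ℤ→ℚ i) j i refl refl))) (≈-sym (c-InUnit a i z a∈ refl)))) ⟩
  κ y ⋆ (c (α - β) x ⋆ c β z) ⊕ κ x ⋆ (c (β - α) y ⋆ c α z) ∎
  where
  open ≈-Reasoning
  z = x + y
  T = κ x ⋆ (κ y ⋆ (κ z ⋆ (𝕥 ⋆ 𝕥)))
  H = κ (h a)
  X = exp (x * a)
  Y = exp (y * a)
  Z = exp (z * a)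
  W = 𝕓 z ⋆ Z ⊕ H ⋆ (κ z ⋆ 𝕥)
  XY≈Z : X ⋆ Y ≈ Z
  XY≈Z = ≈-trans (exp-+ (x * a) (y * a)) (≡⇒≈ (cong exp (sym (ℚP.*-distribʳ-+ a x y))))
  shuffle : ∀ a i j → (a + i) - (a + j) ≡ 0ℚ + (i - j)
  shuffle = solve-∀ ringℚ
  lem : ∀ u v k l → u ≡ ℤ→ℚ k → v ≡ ℤ→ℚ l → (a + u) - (a + v) ≡ 0ℚ + ℤ→ℚ (k ℤ.- l)
  lem u v k l refl refl = trans (shuffle a u v) (cong (ℚ._+_ 0ℚ) (sym (ℤ→ℚ-- k l)))
  c-int : ∀ {γ} x k → γ ≡ 0ℚ + ℤ→ℚ k → c γ x ≈ 𝕓 x ⋆ 𝟙 ⊕ κ ½ ⋆ (κ x ⋆ 𝕥)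
  c-int x k e = ≈-trans (c-InUnit 0ℚ k x (ℚP.≤-refl , ℚP.positive⁻¹ 1ℚ) e)
    (⊕-cong (⋆-cong (≈-refl {𝕓 x}) (exp-0 (ℚP.*-zeroʳ x))) (≈-refl {κ ½ ⋆ (κ x ⋆ 𝕥)}))

c-three-term : ∀ α β x y → ThreeTerm α β x y (h (frac α) * h (frac β))
c-three-term α β x y with ℚP.<-cmp (frac α) (frac β)
... | tri> _ _ b<a = three-term-> (frac α) (frac β) (floor α) (floor β) x y (frac-InUnit α) (frac-InUnit β) b<a (frac+floor α) (frac+floor β)
... | tri≈ _ a≡b _ = subst (λ b → ThreeTerm α β x y (h (frac α) * h b)) a≡b
  (three-term-≡ (frac α) (floor α) (floor β) x y (frac-InUnit α) (frac+floor α) (trans (frac+floor β) (cong (_+ ℤ→ℚ (floor β)) (sym a≡b))))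
... | tri< a<b _ _ = begin
  κ (x + y) ⋆ (c α x ⋆ c β y) ⊕ κ (h (frac α) * h (frac β)) ⋆ (κ x ⋆ (κ y ⋆ (κ (x + y) ⋆ (𝕥 ⋆ 𝕥))))
    ≈⟨ solve 7 (λ z a b e x y t → z :* (a :* b) :+ e :* (x :* (y :* (z :* t))) := z :* (b :* a) :+ e :* (y :* (x :* (z :* t)))) ≈-refl
         (κ (x + y)) (c α x) (c β y) (κ (h (frac α) * h (frac β))) (κ x) (κ y) (𝕥 ⋆ 𝕥) ⟩
  κ (x + y) ⋆ (c β y ⋆ c α x) ⊕ κ (h (frac α) * h (frac β)) ⋆ (κ y ⋆ (κ x ⋆ (κ (x + y) ⋆ (𝕥 ⋆ 𝕥))))
    ≈⟨ swapped ⟩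
  κ x ⋆ (c (β - α) y ⋆ c α (x + y)) ⊕ κ y ⋆ (c (α - β) x ⋆ c β (x + y))
    ≈⟨ CommutativeSemiring.+-comm Seq-commutativeSemiring (κ x ⋆ (c (β - α) y ⋆ c α (x + y))) (κ y ⋆ (c (α - β) x ⋆ c β (x + y))) ⟩
  κ y ⋆ (c (α - β) x ⋆ c β (x + y)) ⊕ κ x ⋆ (c (β - α) y ⋆ c α (x + y)) ∎
  where
  open ≈-Reasoning
  swapped : κ (x + y) ⋆ (c β y ⋆ c α x) ⊕ κ (h (frac α) * h (frac β)) ⋆ (κ y ⋆ (κ x ⋆ (κ (x + y) ⋆ (𝕥 ⋆ 𝕥)))) ≈
    κ x ⋆ (c (β - α) y ⋆ c α (x + y)) ⊕ κ y ⋆ (c (α - β) x ⋆ c β (x + y))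
  swapped = subst₂ (λ z ε → κ z ⋆ (c β y ⋆ c α x) ⊕ κ ε ⋆ (κ y ⋆ (κ x ⋆ (κ z ⋆ (𝕥 ⋆ 𝕥)))) ≈
      κ x ⋆ (c (β - α) y ⋆ c α z) ⊕ κ y ⋆ (c (α - β) x ⋆ c β z))
    (ℚP.+-comm y x) (ℚP.*-comm (h (frac β)) (h (frac α)))
    (three-term-> (frac β) (frac α) (floor β) (floor α) y x (frac-InUnit β) (frac-InUnit α) a<b (frac+floor β) (frac+floor α))

-- The distribution relation

c-cong : ∀ {α β x y} → α ≡ β → x ≡ y → c α x ≈ c β y
c-cong refl refl = ≈-refl

module Distribution (m : ℕ) .{{_ : NonZero m}} where
  M : ℚ
  M = ℕ→ℚ m

  S : ℚ → Seq
  S β n = sumℚ m (λ l → c ((β + ℕ→ℚ l) * inv m) M n)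

  -- Raising `β` by 1 shifts the summation index, and the terms at the two ends agree because their
  -- arguments differ by 1.
  S-suc : ∀ β n → S (β + 1ℚ) n ≡ S β n
  S-suc β n = begin
    sumℚ m (λ l → c (((β + 1ℚ) + ℕ→ℚ l) * inv m) M n)
      ≡⟨ sum-cong′ m (λ l → coeff (c-cong {x = M} (cong (_* inv m) (trans (ℚP.+-assoc β 1ℚ (ℕ→ℚ l)) (cong (ℚ._+_ β) (sym (ℕ→ℚ-suc l))))) refl) n) ⟩
    sumℚ m (λ l → c ((β + ℕ→ℚ (suc l)) * inv m) M n)
      ≡⟨ sum-shift m (λ l → c ((β + ℕ→ℚ l) * inv m) M n) (coeff (c-periodic {β = (β + 0ℚ) * inv m} (+ 1) M wrap) n) ⟩
    S β n ∎
    where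
    open ≡-Reasoning
    shuffle : ∀ β m i → (β + m) * i ≡ (β + 0ℚ) * i + i * m
    shuffle = solve-∀ ringℚ
    wrap : (β + M) * inv m ≡ (β + 0ℚ) * inv m + 1ℚ
    wrap = trans (shuffle β M (inv m)) (cong (ℚ._+_ ((β + 0ℚ) * inv m)) (inv-* m))

  S-+ : ∀ β k n → S (β + ℕ→ℚ k) n ≡ S β n
  S-+ β zero    n = cong (λ γ → S γ n) (ℚP.+-identityʳ β)
  S-+ β (suc k) n = trans (cong (λ γ → S γ n) (trans (cong (ℚ._+_ β) (ℕ→ℚ-suc k)) (shuffle β (ℕ→ℚ k)))) (trans (S-suc (β + ℕ→ℚ k) n) (S-+ β k n))
    where
    shuffle : ∀ β k → β + (1ℚ + k) ≡ (β + k) + 1ℚ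
    shuffle = solve-∀ ringℚ

  S-periodic : ∀ β z n → S (β + ℤ→ℚ z) n ≡ S β n
  S-periodic β (+ k)         n = S-+ β k n
  S-periodic β (ℤ.-[1+ k ]) n = trans (sym (S-+ (β + ℤ→ℚ ℤ.-[1+ k ]) (suc k) n)) (cong (λ γ → S γ n)
    (trans (ℚP.+-assoc β _ _) (trans (cong (ℚ._+_ β) (trans (sym (ℤ→ℚ-+ ℤ.-[1+ k ] (+ suc k))) (cong ℤ→ℚ (ℤP.+-inverseˡ (+ suc k))))) (ℚP.+-identityʳ β))))

  -- For `y` in `[0, 1)` all `(y + l)/m` with `l < m` stay in `[0, 1)`, so the exponentials add up
  -- to the sum in `B-multiplication`. Only `l = 0` can give an integer argument, which leaves a
  -- single `h`.
  S-InUnit : ∀ y → InUnit y → ∀ n → S y n ≡ M * ((B ⋆ exp y) n + h y * 𝕥 n)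
  S-InUnit y y∈@(0≤y , y<1) n = begin
    S y n
      ≡⟨ sum-cong m (λ l l<m → trans (coeff (c-InUnit (yₗ l) (+ 0) M (yₗ∈ l l<m) (sym (ℚP.+-identityʳ (yₗ l)))) n) (cong₂ _+_ (coeff (factor l) n) (scalar (h (yₗ l))))) ⟩
    sumℚ m (λ l → (exp (ℕ→ℚ l) ⋆ (𝕓 M ⋆ exp y)) n + (M * 𝕥 n) * h (yₗ l))
      ≡⟨ sum-+ m (λ l → (exp (ℕ→ℚ l) ⋆ (𝕓 M ⋆ exp y)) n) (λ l → (M * 𝕥 n) * h (yₗ l)) ⟩
    sumℚ m (λ l → (exp (ℕ→ℚ l) ⋆ (𝕓 M ⋆ exp y)) n) + sumℚ m (λ l → (M * 𝕥 n) * h (yₗ l))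
      ≡⟨ cong₂ _+_ (sum-⋆ m (λ l → exp (ℕ→ℚ l)) (𝕓 M ⋆ exp y) n) (sum-only-head m (λ l → (M * 𝕥 n) * h (yₗ l)) vanish) ⟩
    (E ⋆ (𝕓 M ⋆ exp y)) n + (M * 𝕥 n) * h (yₗ 0)
      ≡⟨ cong₂ _+_ (coeff collect n) (cong ((M * 𝕥 n) *_) h-head) ⟩
    M * (B ⋆ exp y) n + (M * 𝕥 n) * h y
      ≡⟨ shuffle M ((B ⋆ exp y) n) (𝕥 n) (h y) ⟩
    M * ((B ⋆ exp y) n + h y * 𝕥 n) ∎
    where
    open ≡-Reasoning
    yₗ : ℕ → ℚ
    yₗ l = (y + ℕ→ℚ l) * inv m
    E : Seq
    E j = sumℚ m (λ l → powℚ (ℕ→ℚ l) j)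
    yₗ*m : ∀ l → M * yₗ l ≡ y + ℕ→ℚ l
    yₗ*m l = trans (comm M (y + ℕ→ℚ l) (inv m)) (trans (cong ((y + ℕ→ℚ l) *_) (inv-* m)) (ℚP.*-identityʳ _))
      where
      comm : ∀ a b c → a * (b * c) ≡ b * (c * a)
      comm = solve-∀ ringℚ
    instance
      M-pos : ℚ.Positive M
      M-pos = ℕ→ℚ-pos m
      M-nonNeg : ℚ.NonNegative M
      M-nonNeg = ℚP.pos⇒nonNeg M
    yₗ∈ : ∀ l → l < m → InUnit (yₗ l)
    yₗ∈ l l<m =
      ℚP.*-cancelˡ-≤-pos M (subst₂ ℚ._≤_ (sym (ℚP.*-zeroʳ M)) (sym (yₗ*m l)) (ℚP.≤-trans 0≤y (subst (ℚ._≤ y + ℕ→ℚ l) (ℚP.+-identityʳ y) (ℚP.+-monoʳ-≤ y (ℕ→ℚ-nonNeg l))))) ,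
      ℚP.*-cancelˡ-<-nonNeg M (subst₂ ℚ._<_ (sym (yₗ*m l)) (sym (ℚP.*-identityʳ M))
        (ℚP.<-≤-trans (ℚP.+-monoˡ-< (ℕ→ℚ l) y<1) (subst (ℚ._≤ M) (ℕ→ℚ-suc l) (ℤ→ℚ-mono-≤ (ℤ.+≤+ l<m)))))
    factor : ∀ l → 𝕓 M ⋆ exp (M * yₗ l) ≈ exp (ℕ→ℚ l) ⋆ (𝕓 M ⋆ exp y)
    factor l = ≈-trans (⋆-cong ≈-refl (≈-trans (≡⇒≈ (cong exp (yₗ*m l))) (≈-sym (exp-+ y (ℕ→ℚ l)))))
      (solve 3 (λ b y l → b :* (y :* l) := l :* (b :* y)) ≈-refl (𝕓 M) (exp y) (exp (ℕ→ℚ l)))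
    scalar : ∀ k → (κ k ⋆ (κ M ⋆ 𝕥)) n ≡ (M * 𝕥 n) * k
    scalar k = trans (coeff (κ-⋆ k (κ M ⋆ 𝕥)) n) (trans (cong (k *_) (coeff (κ-⋆ M 𝕥) n)) (ℚP.*-comm k (M * 𝕥 n)))
    vanish : ∀ l → suc l < m → (M * 𝕥 n) * h (yₗ (suc l)) ≡ 0ℚ
    vanish l _ = trans (cong ((M * 𝕥 n) *_) (h-nonzero nonzero)) (ℚP.*-zeroʳ (M * 𝕥 n))
      where
      nonzero : yₗ (suc l) ≢ 0ℚ
      nonzero e = ℚP.<⇒≢ (ℚP.+-mono-≤-< 0≤y (ℚP.positive⁻¹ (ℕ→ℚ (suc l)) {{ℕ→ℚ-pos (suc l)}}))
        (trans (sym (ℚP.*-zeroʳ M)) (trans (cong (M *_) (sym e)) (yₗ*m (suc l))))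
    h-head : h (yₗ 0) ≡ h y
    h-head with h-cases y
    ... | inj₂ (y≡0 , h≡½) = trans (cong h (trans (cong (λ y → (y + 0ℚ) * inv m) y≡0) (ℚP.*-zeroˡ (inv m)))) (sym h≡½)
    ... | inj₁ (y≢0 , h≡0) = trans (h-nonzero (λ e → y≢0 (trans (sym (ℚP.+-identityʳ y)) (trans (sym (yₗ*m 0)) (trans (cong (M *_) e) (ℚP.*-zeroʳ M)))))) (sym h≡0)
    collect : E ⋆ (𝕓 M ⋆ exp y) ≈ M · (B ⋆ exp y)
    collect = ≈-trans (solve 3 (λ e b y → e :* (b :* y) := (b :* e) :* y) ≈-refl E (𝕓 M) (exp y))
      (≈-trans (⋆-cong (B-multiplication m) ≈-refl) (≈-trans (⋆-assoc (κ M) B (exp y)) (κ-⋆ M (B ⋆ exp y))))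
    shuffle : ∀ m b t h → m * b + (m * t) * h ≡ m * (b + h * t)
    shuffle = solve-∀ ringℚ

  -- The classical `Σ B̄ₙ((β + l)/m) = m^(1-n) B̄ₙ(β)`, with the power of `m` absorbed into the
  -- scale of the variable.
  c-distribution : ∀ β x n → sumℚ m (λ l → c ((β + ℕ→ℚ l) * inv m) (M * x) n) ≡ M * c β x n
  c-distribution β x n = begin
    sumℚ m (λ l → c ((β + ℕ→ℚ l) * inv m) (M * x) n)
      ≡⟨ sum-cong′ m (λ l → trans (cong (_* Bbar n ((β + ℕ→ℚ l) * inv m)) (powℚ-* M x n)) (shuffle (powℚ M n) (powℚ x n) (Bbar n ((β + ℕ→ℚ l) * inv m)))) ⟩
    sumℚ m (λ l → powℚ x n * c ((β + ℕ→ℚ l) * inv m) M n)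
      ≡⟨ sum-*ˡ m (powℚ x n) (λ l → c ((β + ℕ→ℚ l) * inv m) M n) ⟩
    powℚ x n * S β n
      ≡⟨ cong (powℚ x n *_) (trans (cong (λ γ → S γ n) (frac+floor β)) (trans (S-periodic (frac β) (floor β) n) (S-InUnit (frac β) (frac-InUnit β) n))) ⟩
    powℚ x n * (M * ((B ⋆ exp (frac β)) n + h (frac β) * 𝕥 n))
      ≡⟨ cong (λ y → powℚ x n * (M * y)) (trans (sym (Bbar-InUnit n (floor β) (frac-InUnit β))) (cong (Bbar n) (sym (frac+floor β)))) ⟩
    powℚ x n * (M * Bbar n β)
      ≡⟨ shuffle′ (powℚ x n) M (Bbar n β) ⟩
    M * c β x n ∎
    where
    open ≡-Reasoning
    shuffle : ∀ a b c → (a * b) * c ≡ b * (a * c)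
    shuffle = solve-∀ ringℚ
    shuffle′ : ∀ a b c → a * (b * c) ≡ b * (a * c)
    shuffle′ = solve-∀ ringℚ

open Distribution using (c-distribution)

-- Reciprocity

D : (q p : ℕ) .{{_ : NonZero q}} → ℚ → ℚ → Seq
D q p u w n = sumℚ q (λ k → (c ((+ k) / q) u ⋆ c ((+ (p ℕ.* k)) / q) w) n)

sum-⋆ʳ : ∀ m (f : ℕ → Seq) b n → sumℚ m (λ k → (b ⋆ f k) n) ≡ (b ⋆ (λ j → sumℚ m (λ k → f k j))) n
sum-⋆ʳ m f b n = trans (sum-cong′ m (λ k → coeff (⋆-comm b (f k)) n)) (trans (sum-⋆ m f b n) (coeff (⋆-comm _ b) n))

frac-/ : ∀ k q .{{_ : NonZero q}} → k < q → frac ((+ k) / q) ≡ (+ k) / q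
frac-/ k q k<q = trans (cong frac (sym (ℚP.+-identityʳ x))) (frac-unique (+ 0) (0≤x , x<1))
  where
  x = (+ k) / q
  instance
    q-pos : ℚ.Positive (ℕ→ℚ q)
    q-pos = ℕ→ℚ-pos q
    q-nonNeg : ℚ.NonNegative (ℕ→ℚ q)
    q-nonNeg = ℚP.pos⇒nonNeg (ℕ→ℚ q)
  0≤x : 0ℚ ℚ.≤ x
  0≤x = ℚP.*-cancelʳ-≤-pos (ℕ→ℚ q) (subst₂ ℚ._≤_ (sym (ℚP.*-zeroˡ (ℕ→ℚ q))) (sym (/-*-cancel (+ k) q)) (ℕ→ℚ-nonNeg k))
  x<1 : x ℚ.< 1ℚ
  x<1 = ℚP.*-cancelʳ-<-nonNeg (ℕ→ℚ q) (subst₂ ℚ._<_ (sym (/-*-cancel (+ k) q)) (sym (ℚP.*-identityˡ (ℕ→ℚ q))) (ℤ→ℚ-mono-< (ℤ.+<+ k<q)))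

suc/≢0 : ∀ k q .{{_ : NonZero q}} → (+ suc k) / q ≢ 0ℚ
suc/≢0 k q e = ℚP.<⇒≢ (ℚP.positive⁻¹ (ℕ→ℚ (suc k)) {{ℕ→ℚ-pos (suc k)}})
  (sym (trans (sym (/-*-cancel (+ suc k) q)) (trans (cong (_* ℕ→ℚ q) e) (ℚP.*-zeroˡ (ℕ→ℚ q)))))

h-frac-suc : ∀ k q .{{_ : NonZero q}} → suc k < q → h (frac ((+ suc k) / q)) ≡ 0ℚ
h-frac-suc k q k<q = h-nonzero (λ e → suc/≢0 k q (trans (sym (frac-/ (suc k) q k<q)) e))

h-frac-0 : ∀ q .{{_ : NonZero q}} → h (frac ((+ 0) / q)) ≡ ½
h-frac-0 q = trans (cong (λ x → h (frac x)) (ℚP.0/n≡0 q)) refl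

module Reciprocity (q p : ℕ) .{{_ : NonZero q}} .{{_ : NonZero p}} (u v w : ℚ)
  (qv≡u+pw : ℕ→ℚ q * v ≡ u + ℕ→ℚ p * w) (n : ℕ) where
  open ≡-Reasoning

  Q P : ℚ
  Q = ℕ→ℚ q
  P = ℕ→ℚ p

  ξ : ℕ → ℚ
  ξ k = (+ k) / q

  -- These points are the `p`-th parts of `p k/q`, but also `k/q + l/p`, and hence the `q`-th parts
  -- of `q l/p`. So the distribution relation applies both over `l` and over `k`.
  η : ℕ → ℕ → ℚ
  η k l = ((+ (p ℕ.* k)) / q + ℕ→ℚ l) * inv p

  ε : ℕ → ℕ → ℚ
  ε k l = h (frac (ξ k)) * h (frac (η k l))

  pk/q : ∀ k → (+ (p ℕ.* k)) / q ≡ P * ξ k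
  pk/q k = trans (/-inv (+ (p ℕ.* k)) q) (trans (cong (_* inv q) (ℕ→ℚ-* p k)) (trans (ℚP.*-assoc P (ℕ→ℚ k) (inv q)) (cong (P *_) (sym (/-inv (+ k) q)))))

  η≡ : ∀ k l → η k l ≡ ξ k + (+ l) / p
  η≡ k l = begin
    ((+ (p ℕ.* k)) / q + ℕ→ℚ l) * inv p      ≡⟨ cong (λ x → (x + ℕ→ℚ l) * inv p) (pk/q k) ⟩
    (P * ξ k + ℕ→ℚ l) * inv p                ≡⟨ shuffle P (ξ k) (ℕ→ℚ l) (inv p) ⟩
    (inv p * P) * ξ k + ℕ→ℚ l * inv p        ≡⟨ cong₂ (λ x y → x * ξ k + y) (inv-* p) (sym (/-inv (+ l) p)) ⟩
    1ℚ * ξ k + (+ l) / p                     ≡⟨ cong (_+ (+ l) / p) (ℚP.*-identityˡ (ξ k)) ⟩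
    ξ k + (+ l) / p                          ∎
    where
    shuffle : ∀ P a l i → (P * a + l) * i ≡ (i * P) * a + l * i
    shuffle = solve-∀ ringℚ

  η≡′ : ∀ k l → η k l ≡ (Q * ((+ l) / p) + ℕ→ℚ k) * inv q
  η≡′ k l = begin
    η k l                                            ≡⟨ η≡ k l ⟩
    ξ k + (+ l) / p                                  ≡⟨ cong₂ _+_ (/-inv (+ k) q) (sym (ℚP.*-identityˡ _)) ⟩
    ℕ→ℚ k * inv q + 1ℚ * ((+ l) / p)                 ≡⟨ cong (λ x → ℕ→ℚ k * inv q + x * ((+ l) / p)) (sym (inv-* q)) ⟩
    ℕ→ℚ k * inv q + (inv q * Q) * ((+ l) / p)        ≡⟨ shuffle (ℕ→ℚ k) (inv q) Q ((+ l) / p) ⟩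
    (Q * ((+ l) / p) + ℕ→ℚ k) * inv q                ∎
    where
    shuffle : ∀ k i Q x → k * i + (i * Q) * x ≡ (Q * x + k) * i
    shuffle = solve-∀ ringℚ

  ξ-η : ∀ k l → ξ k - η k l ≡ - ((+ l) / p)
  ξ-η k l = trans (cong (ℚ._-_ (ξ k)) (η≡ k l)) (shuffle (ξ k) ((+ l) / p))
    where
    shuffle : ∀ a b → a - (a + b) ≡ - b
    shuffle = solve-∀ ringℚ

  η-ξ : ∀ k l → η k l - ξ k ≡ (0ℚ + ℕ→ℚ l) * inv p
  η-ξ k l = trans (cong (_- ξ k) (η≡ k l)) (trans (shuffle (ξ k) ((+ l) / p)) (trans (/-inv (+ l) p) (cong (_* inv p) (sym (ℚP.+-identityˡ (ℕ→ℚ l))))))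
    where
    shuffle : ∀ a b → (a + b) - a ≡ b
    shuffle = solve-∀ ringℚ

  ξ≡ : ∀ k → ξ k ≡ (0ℚ + ℕ→ℚ k) * inv q
  ξ≡ k = trans (/-inv (+ k) q) (cong (_* inv q) (sym (ℚP.+-identityˡ (ℕ→ℚ k))))

  pw qv : ℚ
  pw = P * w
  qv = Q * v

  t² : ℚ
  t² = (𝕥 ⋆ 𝕥) n

  -- The three-term relation at `ξ k` and `η k l` with variables `u` and `p w`, chosen so that their
  -- sum is `q v`.
  pointwise : ∀ k l →
    qv * (c (ξ k) u ⋆ c (η k l) pw) n + (u * (pw * (qv * t²))) * ε k l ≡
    pw * (c (- ((+ l) / p)) u ⋆ c ((Q * ((+ l) / p) + ℕ→ℚ k) * inv q) qv) n +
    u * (c ((0ℚ + ℕ→ℚ l) * inv p) pw ⋆ c ((0ℚ + ℕ→ℚ k) * inv q) qv) n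
  pointwise k l = begin
    qv * (c (ξ k) u ⋆ c (η k l) pw) n + (u * (pw * (qv * t²))) * ε k l
      ≡⟨ cong₂ _+_ (sym (coeff (κ-⋆ qv (c (ξ k) u ⋆ c (η k l) pw)) n)) (sym correction) ⟩
    (κ qv ⋆ (c (ξ k) u ⋆ c (η k l) pw)) n + (κ (ε k l) ⋆ (κ u ⋆ (κ pw ⋆ (κ qv ⋆ (𝕥 ⋆ 𝕥))))) n
      ≡⟨ coeff three n ⟩
    (κ pw ⋆ (c (ξ k - η k l) u ⋆ c (η k l) qv)) n + (κ u ⋆ (c (η k l - ξ k) pw ⋆ c (ξ k) qv)) n
      ≡⟨ cong₂ _+_ (coeff (κ-⋆ pw (c (ξ k - η k l) u ⋆ c (η k l) qv)) n) (coeff (κ-⋆ u (c (η k l - ξ k) pw ⋆ c (ξ k) qv)) n) ⟩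
    pw * (c (ξ k - η k l) u ⋆ c (η k l) qv) n + u * (c (η k l - ξ k) pw ⋆ c (ξ k) qv) n
      ≡⟨ cong₂ (λ x y → pw * x + u * y)
           (cong₂ (λ a b → (c a u ⋆ c b qv) n) (ξ-η k l) (η≡′ k l))
           (cong₂ (λ a b → (c a pw ⋆ c b qv) n) (η-ξ k l) (ξ≡ k)) ⟩
    pw * (c (- ((+ l) / p)) u ⋆ c ((Q * ((+ l) / p) + ℕ→ℚ k) * inv q) qv) n +
    u * (c ((0ℚ + ℕ→ℚ l) * inv p) pw ⋆ c ((0ℚ + ℕ→ℚ k) * inv q) qv) n ∎
    where
    three : κ qv ⋆ (c (ξ k) u ⋆ c (η k l) pw) ⊕ κ (ε k l) ⋆ (κ u ⋆ (κ pw ⋆ (κ qv ⋆ (𝕥 ⋆ 𝕥)))) ≈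
      κ pw ⋆ (c (ξ k - η k l) u ⋆ c (η k l) qv) ⊕ κ u ⋆ (c (η k l - ξ k) pw ⋆ c (ξ k) qv)
    three = subst (λ z → κ z ⋆ (c (ξ k) u ⋆ c (η k l) pw) ⊕ κ (ε k l) ⋆ (κ u ⋆ (κ pw ⋆ (κ z ⋆ (𝕥 ⋆ 𝕥)))) ≈
      κ pw ⋆ (c (ξ k - η k l) u ⋆ c (η k l) z) ⊕ κ u ⋆ (c (η k l - ξ k) pw ⋆ c (ξ k) z)) (sym qv≡u+pw) (c-three-term (ξ k) (η k l) u pw)
    correction : (κ (ε k l) ⋆ (κ u ⋆ (κ pw ⋆ (κ qv ⋆ (𝕥 ⋆ 𝕥))))) n ≡ (u * (pw * (qv * t²))) * ε k l
    correction = trans (coeff (κ-⋆ (ε k l) _) n) (trans (cong (ε k l *_)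
      (trans (coeff (κ-⋆ u _) n) (cong (u *_) (trans (coeff (κ-⋆ pw _) n) (cong (pw *_) (coeff (κ-⋆ qv (𝕥 ⋆ 𝕥)) n))))))
      (ℚP.*-comm (ε k l) _))

  Σ₁ : sumℚ q (λ k → sumℚ p (λ l → (c (ξ k) u ⋆ c (η k l) pw) n)) ≡ P * D q p u w n
  Σ₁ = trans (sum-cong′ q inner) (sum-*ˡ q P _)
    where
    inner : ∀ k → sumℚ p (λ l → (c (ξ k) u ⋆ c (η k l) pw) n) ≡ P * (c (ξ k) u ⋆ c ((+ (p ℕ.* k)) / q) w) n
    inner k = begin
      sumℚ p (λ l → (c (ξ k) u ⋆ c (η k l) pw) n)
        ≡⟨ sum-⋆ʳ p (λ l → c (η k l) pw) (c (ξ k) u) n ⟩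
      (c (ξ k) u ⋆ (λ j → sumℚ p (λ l → c (η k l) pw j))) n
        ≡⟨ coeff (⋆-cong (≈-refl {c (ξ k) u}) ⟨ (λ j → c-distribution p ((+ (p ℕ.* k)) / q) w j) ⟩) n ⟩
      (c (ξ k) u ⋆ (P · c ((+ (p ℕ.* k)) / q) w)) n
        ≡⟨ coeff (⋆-· P (c (ξ k) u) (c ((+ (p ℕ.* k)) / q) w)) n ⟩
      P * (c (ξ k) u ⋆ c ((+ (p ℕ.* k)) / q) w) n ∎

  -- Both arguments are integers only for `k = l = 0`, so the correction is counted once although
  -- `p q` relations are added.
  Σε : sumℚ q (λ k → sumℚ p (λ l → ε k l)) ≡ ½ * ½
  Σε = begin
    sumℚ q (λ k → sumℚ p (ε k))
      ≡⟨ sum-only-head q (λ k → sumℚ p (ε k)) (λ k k<q → trans (sum-cong′ p (λ l → trans (cong (_* h (frac (η (suc k) l))) (h-frac-suc k q k<q)) (ℚP.*-zeroˡ (h (frac (η (suc k) l)))))) (sum-zero p)) ⟩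
    sumℚ p (ε 0)
      ≡⟨ sum-cong′ p (λ l → cong₂ _*_ (h-frac-0 q) (cong (λ x → h (frac x)) (trans (η≡ 0 l) (trans (cong (_+ (+ l) / p) (ℚP.0/n≡0 q)) (ℚP.+-identityˡ ((+ l) / p)))))) ⟩
    sumℚ p (λ l → ½ * h (frac ((+ l) / p)))
      ≡⟨ sum-only-head p (λ l → ½ * h (frac ((+ l) / p))) (λ l l<p → trans (cong (½ *_) (h-frac-suc l p l<p)) (ℚP.*-zeroʳ ½)) ⟩
    ½ * h (frac ((+ 0) / p))
      ≡⟨ cong (½ *_) (h-frac-0 p) ⟩
    ½ * ½ ∎

  -- The sum with multiplier `-q` modulo `p`, kept in this shape until a natural number congruent to
  -- `-q` is chosen.
  D′ : ℚ
  D′ = sumℚ p (λ l → (c (- ((+ l) / p)) u ⋆ c (Q * ((+ l) / p)) v) n)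

  Σ₂ : sumℚ q (λ k → sumℚ p (λ l → (c (- ((+ l) / p)) u ⋆ c ((Q * ((+ l) / p) + ℕ→ℚ k) * inv q) qv) n)) ≡ Q * D′
  Σ₂ = trans (sum-swap q p _) (trans (sum-cong′ p inner) (sum-*ˡ p Q _))
    where
    inner : ∀ l → sumℚ q (λ k → (c (- ((+ l) / p)) u ⋆ c ((Q * ((+ l) / p) + ℕ→ℚ k) * inv q) qv) n) ≡ Q * (c (- ((+ l) / p)) u ⋆ c (Q * ((+ l) / p)) v) n
    inner l = trans (sum-⋆ʳ q (λ k → c ((Q * ((+ l) / p) + ℕ→ℚ k) * inv q) qv) (c (- ((+ l) / p)) u) n)
      (trans (coeff (⋆-cong (≈-refl {c (- ((+ l) / p)) u}) ⟨ (λ j → c-distribution q (Q * ((+ l) / p)) v j) ⟩) n)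
        (coeff (⋆-· Q (c (- ((+ l) / p)) u) (c (Q * ((+ l) / p)) v)) n))

  Σ₃ : sumℚ q (λ k → sumℚ p (λ l → (c ((0ℚ + ℕ→ℚ l) * inv p) pw ⋆ c ((0ℚ + ℕ→ℚ k) * inv q) qv) n)) ≡ P * (Q * (c 0ℚ v ⋆ c 0ℚ w) n)
  Σ₃ = begin
    sumℚ q (λ k → sumℚ p (λ l → (cp l ⋆ cq k) n))
      ≡⟨ sum-cong′ q (λ k → trans (sum-⋆ p cp (cq k) n) (trans (coeff (⋆-cong ⟨ (λ j → c-distribution p 0ℚ w j) ⟩ (≈-refl {cq k})) n) (coeff (·-⋆ P (c 0ℚ w) (cq k)) n))) ⟩
    sumℚ q (λ k → P * (c 0ℚ w ⋆ cq k) n)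
      ≡⟨ sum-*ˡ q P (λ k → (c 0ℚ w ⋆ cq k) n) ⟩
    P * sumℚ q (λ k → (c 0ℚ w ⋆ cq k) n)
      ≡⟨ cong (P *_) (trans (sum-⋆ʳ q cq (c 0ℚ w) n) (trans (coeff (⋆-cong (≈-refl {c 0ℚ w}) ⟨ (λ j → c-distribution q 0ℚ v j) ⟩) n) (coeff (⋆-· Q (c 0ℚ w) (c 0ℚ v)) n))) ⟩
    P * (Q * (c 0ℚ w ⋆ c 0ℚ v) n)
      ≡⟨ cong (λ x → P * (Q * x)) (coeff (⋆-comm (c 0ℚ w) (c 0ℚ v)) n) ⟩
    P * (Q * (c 0ℚ v ⋆ c 0ℚ w) n) ∎
    where
    cp cq : ℕ → Seq
    cp l = c ((0ℚ + ℕ→ℚ l) * inv p) pw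
    cq k = c ((0ℚ + ℕ→ℚ k) * inv q) qv

  sum₂-linear : ∀ a b (f g : ℕ → ℕ → ℚ) → sumℚ q (λ k → sumℚ p (λ l → a * f k l + b * g k l)) ≡
    a * sumℚ q (λ k → sumℚ p (f k)) + b * sumℚ q (λ k → sumℚ p (g k))
  sum₂-linear a b f g = trans (sum-cong′ q (λ k → trans (sum-+ p (λ l → a * f k l) (λ l → b * g k l)) (cong₂ _+_ (sum-*ˡ p a (f k)) (sum-*ˡ p b (g k)))))
    (trans (sum-+ q (λ k → a * sumℚ p (f k)) (λ k → b * sumℚ p (g k))) (cong₂ _+_ (sum-*ˡ q a _) (sum-*ˡ q b _)))

  summed : qv * (P * D q p u w n) + (u * (pw * (qv * t²))) * (½ * ½) ≡ pw * (Q * D′) + u * (P * (Q * (c 0ℚ v ⋆ c 0ℚ w) n))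
  summed = begin
    qv * (P * D q p u w n) + (u * (pw * (qv * t²))) * (½ * ½)
      ≡⟨ cong₂ (λ x y → qv * x + (u * (pw * (qv * t²))) * y) (sym Σ₁) (sym Σε) ⟩
    qv * sumℚ q (λ k → sumℚ p (f k)) + (u * (pw * (qv * t²))) * sumℚ q (λ k → sumℚ p (ε k))
      ≡⟨ sym (sum₂-linear qv (u * (pw * (qv * t²))) f ε) ⟩
    sumℚ q (λ k → sumℚ p (λ l → qv * f k l + (u * (pw * (qv * t²))) * ε k l))
      ≡⟨ sum-cong′ q (λ k → sum-cong′ p (pointwise k)) ⟩
    sumℚ q (λ k → sumℚ p (λ l → pw * g k l + u * g′ k l))
      ≡⟨ sum₂-linear pw u g g′ ⟩
    pw * sumℚ q (λ k → sumℚ p (g k)) + u * sumℚ q (λ k → sumℚ p (g′ k))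
      ≡⟨ cong₂ (λ x y → pw * x + u * y) Σ₂ Σ₃ ⟩
    pw * (Q * D′) + u * (P * (Q * (c 0ℚ v ⋆ c 0ℚ w) n)) ∎
    where
    f g g′ : ℕ → ℕ → ℚ
    f k l = (c (ξ k) u ⋆ c (η k l) pw) n
    g k l = (c (- ((+ l) / p)) u ⋆ c ((Q * ((+ l) / p) + ℕ→ℚ k) * inv q) qv) n
    g′ k l = (c ((0ℚ + ℕ→ℚ l) * inv p) pw ⋆ c ((0ℚ + ℕ→ℚ k) * inv q) qv) n

  divided : v * D q p u w n + (u * v * w) * (½ * ½ * t²) ≡ w * D′ + u * (c 0ℚ v ⋆ c 0ℚ w) n
  divided = *-cancel-ℕ q (*-cancel-ℕ p (trans (shuffle Q P u v w (D q p u w n) t²) (trans summed (shuffle′ Q P u w D′ ((c 0ℚ v ⋆ c 0ℚ w) n)))))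
    where
    shuffle : ∀ Q P u v w d t → ((v * d + (u * v * w) * (½ * ½ * t)) * Q) * P ≡ (Q * v) * (P * d) + (u * ((P * w) * ((Q * v) * t))) * (½ * ½)
    shuffle = solve-∀ ringℚ
    shuffle′ : ∀ Q P u w d e → (P * w) * (Q * d) + u * (P * (Q * e)) ≡ ((w * d + u * e) * Q) * P
    shuffle′ = solve-∀ ringℚ

  module _ (p₂ b : ℕ) (p₂+q≡bp : p₂ ℕ.+ q ≡ b ℕ.* p) where

    p₂≡ : ℕ→ℚ p₂ ≡ ℕ→ℚ b * P - Q
    p₂≡ = trans (shuffle (ℕ→ℚ p₂) Q) (cong (_- Q) (trans (sym (ℕ→ℚ-+ p₂ q)) (trans (cong ℕ→ℚ p₂+q≡bp) (ℕ→ℚ-* b p))))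
      where
      shuffle : ∀ x y → x ≡ (x + y) - y
      shuffle = solve-∀ ringℚ

    p∸l/p : ∀ l → l < p → (+ (p ∸ l)) / p ≡ - ((+ l) / p) + 1ℚ
    p∸l/p l l<p = *-cancel-ℕ p (trans (/-*-cancel (+ (p ∸ l)) p) (trans (trans (cong ℤ→ℚ (trans (sym (ℤP.⊖-≥ (ℕP.<⇒≤ l<p))) (sym (ℤP.m-n≡m⊖n p l)))) (ℤ→ℚ-- (+ p) (+ l)))
      (trans (cong (ℚ._-_ P) (sym (/-*-cancel (+ l) p))) (shuffle P ((+ l) / p)))))
      where
      shuffle : ∀ P x → P - x * P ≡ (- x + 1ℚ) * P
      shuffle = solve-∀ ringℚ

    p₂[p∸l]/p : ∀ l → l < p → (+ (p₂ ℕ.* (p ∸ l))) / p ≡ Q * ((+ l) / p) + ℤ→ℚ ((+ p₂) ℤ.- (+ b) ℤ.* (+ l))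
    p₂[p∸l]/p l l<p = begin
      (+ (p₂ ℕ.* (p ∸ l))) / p
        ≡⟨ trans (/-inv (+ (p₂ ℕ.* (p ∸ l))) p) (trans (cong (_* inv p) (ℕ→ℚ-* p₂ (p ∸ l))) (trans (ℚP.*-assoc (ℕ→ℚ p₂) _ _) (cong (ℕ→ℚ p₂ *_) (sym (/-inv (+ (p ∸ l)) p))))) ⟩
      ℕ→ℚ p₂ * ((+ (p ∸ l)) / p)
        ≡⟨ cong (ℕ→ℚ p₂ *_) (p∸l/p l l<p) ⟩
      ℕ→ℚ p₂ * (- ((+ l) / p) + 1ℚ)
        ≡⟨ shuffle₁ (ℕ→ℚ p₂) ((+ l) / p) ⟩
      ℕ→ℚ p₂ - ℕ→ℚ p₂ * ((+ l) / p)
        ≡⟨ cong (λ x → ℕ→ℚ p₂ - x * ((+ l) / p)) p₂≡ ⟩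
      ℕ→ℚ p₂ - (ℕ→ℚ b * P - Q) * ((+ l) / p)
        ≡⟨ shuffle₂ (ℕ→ℚ p₂) (ℕ→ℚ b) P Q ((+ l) / p) ⟩
      Q * ((+ l) / p) + (ℕ→ℚ p₂ - ℕ→ℚ b * (((+ l) / p) * P))
        ≡⟨ cong (λ x → Q * ((+ l) / p) + (ℕ→ℚ p₂ - ℕ→ℚ b * x)) (/-*-cancel (+ l) p) ⟩
      Q * ((+ l) / p) + (ℕ→ℚ p₂ - ℕ→ℚ b * ℕ→ℚ l)
        ≡⟨ cong (ℚ._+_ (Q * ((+ l) / p))) (sym (trans (ℤ→ℚ-- (+ p₂) ((+ b) ℤ.* (+ l))) (cong (ℚ._-_ (ℕ→ℚ p₂)) (ℤ→ℚ-* (+ b) (+ l))))) ⟩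
      Q * ((+ l) / p) + ℤ→ℚ ((+ p₂) ℤ.- (+ b) ℤ.* (+ l)) ∎
      where
      shuffle₁ : ∀ a x → a * (- x + 1ℚ) ≡ a - a * x
      shuffle₁ = solve-∀ ringℚ
      shuffle₂ : ∀ a b P Q x → a - (b * P - Q) * x ≡ Q * x + (a - b * (x * P))
      shuffle₂ = solve-∀ ringℚ

    -- Reflecting `l` to `p - l` turns `l/p` into `-l/p` modulo 1, and `p₂ l/p` into `q l/p` modulo
    -- 1 because `p₂` is congruent to `-q` modulo `p`.
    D′≡D : D′ ≡ D p p₂ u v n
    D′≡D = sym (trans (sum-reflect p f f-periodic) (sum-cong p (λ l l<p →
      coeff (⋆-cong (c-periodic {β = - ((+ l) / p)} (+ 1) u (p∸l/p l l<p)) (c-periodic {β = Q * ((+ l) / p)} ((+ p₂) ℤ.- (+ b) ℤ.* (+ l)) v (p₂[p∸l]/p l l<p))) n)))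
      where
      f : ℕ → ℚ
      f l = (c ((+ l) / p) u ⋆ c ((+ (p₂ ℕ.* l)) / p) v) n
      wrap : ∀ a → (+ (a ℕ.* p)) / p ≡ (+ (a ℕ.* 0)) / p + ℤ→ℚ (+ a)
      wrap a = *-cancel-ℕ p (trans (/-*-cancel (+ (a ℕ.* p)) p) (trans (ℕ→ℚ-* a p) (sym (trans (ℚP.*-distribʳ-+ P ((+ (a ℕ.* 0)) / p) (ℕ→ℚ a))
        (trans (cong (_+ ℕ→ℚ a * P) (trans (/-*-cancel (+ (a ℕ.* 0)) p) (cong ℕ→ℚ (ℕP.*-zeroʳ a)))) (ℚP.+-identityˡ _))))))
      wrap₁ : (+ p) / p ≡ (+ 0) / p + 1ℚ
      wrap₁ = subst (λ m → (+ m) / p ≡ (+ 0) / p + 1ℚ) (ℕP.*-identityˡ p) (wrap 1)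
      f-periodic : f p ≡ f 0
      f-periodic = coeff (⋆-cong (c-periodic {β = (+ 0) / p} (+ 1) u wrap₁) (c-periodic {β = (+ (p₂ ℕ.* 0)) / p} (+ p₂) v (wrap p₂))) n

    reciprocity : v * D q p u w n + (u * v * w) * (½ * ½ * (𝕥 ⋆ 𝕥) n) ≡ w * D p p₂ u v n + u * (c 0ℚ v ⋆ c 0ℚ w) n
    reciprocity = trans divided (cong (λ x → w * x + u * (c 0ℚ v ⋆ c 0ℚ w) n) D′≡D)

open Reciprocity using (reciprocity)

-- Integral forms and unimodular cones

-- Integral binary forms of fixed degree, presented as sums of products of integral linear forms.
data Form : ℕ → Set where
  const : ℤ → Form 0
  lin : ∀ {n} → ℤ → ℤ → Form n → Form (suc n)
  _⊞_ : ∀ {n} → Form n → Form n → Form n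

eval : ∀ {n} → Form n → ℚ → ℚ → ℚ
eval (const z)     v w = ℤ→ℚ z
eval (lin a b F) v w = (ℤ→ℚ a * v + ℤ→ℚ b * w) * eval F v w
eval (F ⊞ G)     v w = eval F v w + eval G v w

IsForm : ℕ → (ℚ → ℚ → ℚ) → Set
IsForm n f = Σ[ F ∈ Form n ] (∀ v w → eval F v w ≡ f v w)

isForm-cong : ∀ {n f g} → (∀ v w → f v w ≡ g v w) → IsForm n f → IsForm n g
isForm-cong f≗g (F , F≗f) = F , (λ v w → trans (F≗f v w) (f≗g v w))

isForm-+ : ∀ {n f g} → IsForm n f → IsForm n g → IsForm n (λ v w → f v w + g v w)
isForm-+ (F , F≗f) (G , G≗g) = F ⊞ G , (λ v w → cong₂ _+_ (F≗f v w) (G≗g v w))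

isForm-lin : ∀ {n f} a b → IsForm n f → IsForm (suc n) (λ v w → (ℤ→ℚ a * v + ℤ→ℚ b * w) * f v w)
isForm-lin a b (F , F≗f) = lin a b F , (λ v w → cong ((ℤ→ℚ a * v + ℤ→ℚ b * w) *_) (F≗f v w))

isForm-zero : ∀ n → IsForm n (λ _ _ → 0ℚ)
isForm-zero zero    = const (+ 0) , (λ _ _ → refl)
isForm-zero (suc n) = isForm-cong (λ v w → ℚP.*-zeroʳ (0ℚ * v + 0ℚ * w)) (isForm-lin (+ 0) (+ 0) (isForm-zero n))

scale : ∀ {n} → ℤ → Form n → Form n
scale z (const y)     = const (z ℤ.* y)
scale z (lin a b F) = lin a b (scale z F)
scale z (F ⊞ G)     = scale z F ⊞ scale z G

eval-scale : ∀ {n} z (F : Form n) v w → eval (scale z F) v w ≡ ℤ→ℚ z * eval F v w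
eval-scale z (const y)     v w = ℤ→ℚ-* z y
eval-scale z (lin a b F) v w = trans (cong ((ℤ→ℚ a * v + ℤ→ℚ b * w) *_) (eval-scale z F v w)) (shuffle (ℤ→ℚ a * v + ℤ→ℚ b * w) (ℤ→ℚ z) (eval F v w))
  where
  shuffle : ∀ a b c → a * (b * c) ≡ b * (a * c)
  shuffle = solve-∀ ringℚ
eval-scale z (F ⊞ G)     v w = trans (cong₂ _+_ (eval-scale z F v w) (eval-scale z G v w)) (sym (ℚP.*-distribˡ-+ (ℤ→ℚ z) _ _))

isForm-scale : ∀ {n f} z → IsForm n f → IsForm n (λ v w → ℤ→ℚ z * f v w)
isForm-scale z (F , F≗f) = scale z F , (λ v w → trans (eval-scale z F v w) (cong (ℤ→ℚ z *_) (F≗f v w)))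

-- An integral change of lattice basis; splitting a cone replaces the basis, and integrality of the
-- form must survive this.
substitute : ∀ {n} → ℤ → ℤ → ℤ → ℤ → Form n → Form n
substitute a b c d (const z)     = const z
substitute a b c d (lin x y F) = lin (x ℤ.* a ℤ.+ y ℤ.* c) (x ℤ.* b ℤ.+ y ℤ.* d) (substitute a b c d F)
substitute a b c d (F ⊞ G)     = substitute a b c d F ⊞ substitute a b c d G

eval-substitute : ∀ {n} a b c d (F : Form n) v w →
  eval (substitute a b c d F) v w ≡ eval F (ℤ→ℚ a * v + ℤ→ℚ b * w) (ℤ→ℚ c * v + ℤ→ℚ d * w)
eval-substitute a b c d (const z)     v w = refl
eval-substitute a b c d (lin x y F) v w = cong₂ _*_ (trans (cong₂ (λ e f → e * v + f * w) (hom x a y c) (hom x b y d))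
    (shuffle (ℤ→ℚ x) (ℤ→ℚ y) (ℤ→ℚ a) (ℤ→ℚ b) (ℤ→ℚ c) (ℤ→ℚ d) v w)) (eval-substitute a b c d F v w)
  where
  hom : ∀ x a y c → ℤ→ℚ (x ℤ.* a ℤ.+ y ℤ.* c) ≡ ℤ→ℚ x * ℤ→ℚ a + ℤ→ℚ y * ℤ→ℚ c
  hom x a y c = trans (ℤ→ℚ-+ (x ℤ.* a) (y ℤ.* c)) (cong₂ _+_ (ℤ→ℚ-* x a) (ℤ→ℚ-* y c))
  shuffle : ∀ x y a b c d v w → (x * a + y * c) * v + (x * b + y * d) * w ≡ x * (a * v + b * w) + y * (c * v + d * w)
  shuffle = solve-∀ ringℚ
eval-substitute a b c d (F ⊞ G)     v w = cong₂ _+_ (eval-substitute a b c d F v w) (eval-substitute a b c d G v w)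

isForm-linear-* : ∀ {n f} (l : ℚ → ℚ → ℚ) a b → (∀ v w → ℤ→ℚ a * v + ℤ→ℚ b * w ≡ l v w) →
  IsForm n f → IsForm (suc n) (λ v w → l v w * f v w)
isForm-linear-* {f = f} l a b e F = isForm-cong (λ v w → cong (_* f v w) (e v w)) (isForm-lin a b F)

isForm-pow : ∀ (l : ℚ → ℚ → ℚ) a b → (∀ v w → ℤ→ℚ a * v + ℤ→ℚ b * w ≡ l v w) → ∀ n → IsForm n (λ v w → powℚ (l v w) n)
isForm-pow l a b e zero    = const (+ 1) , (λ _ _ → refl)
isForm-pow l a b e (suc n) = isForm-linear-* l a b e (isForm-pow l a b e n)

first : ∀ v w → ℤ→ℚ (+ 1) * v + ℤ→ℚ (+ 0) * w ≡ v
first = lem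
  where
  lem : ∀ v w → 1ℚ * v + 0ℚ * w ≡ v
  lem = solve-∀ ringℚ

second : ∀ v w → ℤ→ℚ (+ 0) * v + ℤ→ℚ (+ 1) * w ≡ w
second = lem
  where
  lem : ∀ v w → 0ℚ * v + 1ℚ * w ≡ w
  lem = solve-∀ ringℚ

isForm-monomial : ∀ a b → IsForm (a ℕ.+ b) (λ v w → powℚ v a * powℚ w b)
isForm-monomial zero    b = isForm-cong (λ v w → sym (ℚP.*-identityˡ (powℚ w b))) (isForm-pow (λ v w → w) (+ 0) (+ 1) second b)
isForm-monomial (suc a) b = isForm-cong (λ v w → sym (ℚP.*-assoc v (powℚ v a) (powℚ w b)))
  (isForm-linear-* (λ v w → v) (+ 1) (+ 0) first (isForm-monomial a b))

isForm-sum : ∀ {n} m (f : ℕ → ℚ → ℚ → ℚ) → (∀ k → k < m → IsForm n (f k)) → IsForm n (λ v w → sumℚ m (λ k → f k v w))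
isForm-sum {n} zero f F = isForm-zero n
isForm-sum (suc m) f F = isForm-+ (isForm-sum m f (λ k k<m → F k (ℕP.m<n⇒m<1+n k<m))) (F m (ℕP.n<1+n m))

-- Integrality of the Bernoulli coefficients

IsInteger : ℚ → Set
IsInteger x = ∃ λ z → x ≡ ℤ→ℚ z

denominator-∣⇒IsInteger : ∀ x m → ↧ₙ x ∣ m → IsInteger (ℕ→ℚ m * x)
denominator-∣⇒IsInteger x@record{} m (divides k m≡k*d) = (+ k) ℤ.* ↥ x , (begin
  ℕ→ℚ m * x                        ≡⟨ cong (λ m → ℕ→ℚ m * x) m≡k*d ⟩
  ℕ→ℚ (k ℕ.* ↧ₙ x) * x             ≡⟨ cong (_* x) (ℕ→ℚ-* k (↧ₙ x)) ⟩
  (ℕ→ℚ k * ℕ→ℚ (↧ₙ x)) * x         ≡⟨ shuffle (ℕ→ℚ k) (ℕ→ℚ (↧ₙ x)) x ⟩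
  ℕ→ℚ k * (x * ℕ→ℚ (↧ₙ x))         ≡⟨ cong (ℕ→ℚ k *_) (trans (cong (_* ℕ→ℚ (↧ₙ x)) (sym (ℚP.↥p/↧p≡p x))) (/-*-cancel (↥ x) (↧ₙ x))) ⟩
  ℕ→ℚ k * ℤ→ℚ (↥ x)                ≡⟨ sym (ℤ→ℚ-* (+ k) (↥ x)) ⟩
  ℤ→ℚ ((+ k) ℤ.* ↥ x)              ∎)
  where
  open ≡-Reasoning
  shuffle : ∀ a b c → (a * b) * c ≡ a * (c * b)
  shuffle = solve-∀ ringℚ

rTerm : ℕ → ℕ → ℚ
rTerm N i = ℕ→ℚ (β N) * ℕ→ℚ (N C suc i) * B (suc i) * B (N ∸ suc i)

rAux-step : ∀ N i → rAux N i ∣ rAux N (suc i)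
rAux-step N i with i ℕ.% 2
... | 0 = ℕD.∣-refl
... | 1 = m∣lcm[m,n] (rAux N i) _
... | suc (suc _) = ℕD.∣-refl

rAux-odd : ∀ N i → i ℕ.% 2 ≡ 1 → ↧ₙ (rTerm N i) ∣ rAux N (suc i)
rAux-odd N i eq with i ℕ.% 2
rAux-odd N i refl | .1 = n∣lcm[m,n] (rAux N i) _

rAux-∣ : ∀ N m i → i < m → i ℕ.% 2 ≡ 1 → ↧ₙ (rTerm N i) ∣ rAux N m
rAux-∣ N (suc m) i i<1+m odd = [ below , top ]′ (ℕP.m≤n⇒m<n∨m≡n (ℕP.≤-pred i<1+m))
  where
  below : i < m → ↧ₙ (rTerm N i) ∣ rAux N (suc m)
  below i<m = ℕD.∣-trans (rAux-∣ N m i i<m odd) (rAux-step N m)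
  top : i ≡ m → ↧ₙ (rTerm N i) ∣ rAux N (suc m)
  top i≡m = subst (λ k → ↧ₙ (rTerm N i) ∣ rAux N (suc k)) i≡m (rAux-odd N i odd)

-- The Bernoulli numbers with `B₁` replaced by 0, so that all those of odd index vanish.
Bs : ℕ → ℚ
Bs n = Bbar n 0ℚ

Bs-≥2 : ∀ n → Bs (suc (suc n)) ≡ B (suc (suc n))
Bs-≥2 n = trans (Bbar-integer (suc (suc n)) 0ℚ refl) (trans (cong (ℚ._+_ (B (suc (suc n)))) (ℚP.*-zeroʳ ½)) (ℚP.+-identityʳ _))

Bs-odd : ∀ m → Bs (suc (m ℕ.+ m)) ≡ 0ℚ
Bs-odd zero    = refl
Bs-odd (suc m) = trans (Bs-≥2 (m ℕ.+ suc m)) (B-odd m)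

parity : ∀ i → (i ℕ.% 2 ≡ 1) ⊎ (∃ λ m → i ≡ m ℕ.+ m)
parity i with i ℕ.% 2 in eq | ℕDM.m%n<n i 2
... | 0 | _ = inj₂ (i ℕ./ 2 , trans (ℕDM.m≡m%n+[m/n]*n i 2) (trans (cong (ℕ._+ (i ℕ./ 2) ℕ.* 2) eq) (trans (ℕP.*-comm (i ℕ./ 2) 2) (cong ((i ℕ./ 2) ℕ.+_) (ℕP.+-identityʳ (i ℕ./ 2))))))
... | 1 | _ = inj₁ refl
... | suc (suc _) | s≤s (s≤s ())

-- The multiplier that makes everything integral: `β N` turns `B N` into its numerator, and `r N`
-- clears the denominators left in the products of two Bernoulli numbers.
K : ℕ → ℚ
K N = ℕ→ℚ (β N) * ℕ→ℚ (r N)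

A : ℕ → ℚ
A N = ℤ→ℚ (α N ℤ.* (+ r N))

K*B : ∀ N → K N * B N ≡ A N
K*B N = begin
  (ℕ→ℚ (β N) * ℕ→ℚ (r N)) * B N      ≡⟨ shuffle (ℕ→ℚ (β N)) (ℕ→ℚ (r N)) (B N) ⟩
  (B N * ℕ→ℚ (β N)) * ℕ→ℚ (r N)      ≡⟨ cong (_* ℕ→ℚ (r N)) (trans (cong (_* ℕ→ℚ (β N)) (sym (ℚP.↥p/↧p≡p (B N)))) (/-*-cancel (↥ B N) (↧ₙ B N))) ⟩
  ℤ→ℚ (↥ B N) * ℕ→ℚ (r N)            ≡⟨ sym (ℤ→ℚ-* (↥ B N) (+ r N)) ⟩
  A N                                ∎
  where
  open ≡-Reasoning
  shuffle : ∀ a b c → (a * b) * c ≡ (c * a) * b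
  shuffle = solve-∀ ringℚ

module _ {N M : ℕ} (N≡2+M : N ≡ suc (suc M)) where

  Bs-N : Bs N ≡ B N
  Bs-N = trans (cong Bs N≡2+M) (trans (Bs-≥2 M) (cong B (sym N≡2+M)))

  -- Terms with B₁ or an odd-index Bernoulli number vanish; the denominators of the others divide r N.
  coefficient-integer : ∀ a → a ≤ M → IsInteger (K N * (ℕ→ℚ (N C suc a) * (Bs (suc a) * Bs (suc (M ∸ a)))))
  coefficient-integer a a≤M = [ odd-case (M ∸ a) refl , even-case ]′ (parity a)
    where
    open ≡-Reasoning
    C′ = ℕ→ℚ (N C suc a)
    even-case : (∃ λ m → a ≡ m ℕ.+ m) → IsInteger (K N * (C′ * (Bs (suc a) * Bs (suc (M ∸ a)))))
    even-case (m , a≡2m) = + 0 , trans (cong (λ x → K N * (C′ * (x * Bs (suc (M ∸ a))))) (trans (cong (λ k → Bs (suc k)) a≡2m) (Bs-odd m)))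
      (vanish (K N) C′ (Bs (suc (M ∸ a))))
      where
      vanish : ∀ k c b → k * (c * (0ℚ * b)) ≡ 0ℚ
      vanish = solve-∀ ringℚ
    odd-case : ∀ d → M ∸ a ≡ d → a ℕ.% 2 ≡ 1 → IsInteger (K N * (C′ * (Bs (suc a) * Bs (suc (M ∸ a)))))
    odd-case zero M∸a≡0 _ = + 0 , trans (cong (λ x → K N * (C′ * (Bs (suc a) * x))) (cong (λ k → Bs (suc k)) M∸a≡0)) (vanish (K N) C′ (Bs (suc a)))
      where
      vanish : ∀ k c b → k * (c * (b * 0ℚ)) ≡ 0ℚ
      vanish = solve-∀ ringℚ
    odd-case (suc d) M∸a≡1+d odd = proj₁ integer , (begin
      K N * (C′ * (Bs (suc a) * Bs (suc (M ∸ a))))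
        ≡⟨ cong₂ (λ x y → K N * (C′ * (x * y))) (Bs-suc a odd) (trans (cong (λ k → Bs (suc k)) M∸a≡1+d) (trans (Bs-≥2 d) (cong B (sym N∸suca)))) ⟩
      K N * (C′ * (B (suc a) * B (N ∸ suc a)))
        ≡⟨ shuffle (ℕ→ℚ (β N)) (ℕ→ℚ (r N)) C′ (B (suc a)) (B (N ∸ suc a)) ⟩
      ℕ→ℚ (r N) * rTerm N a
        ≡⟨ proj₂ integer ⟩
      ℤ→ℚ (proj₁ integer) ∎)
      where
      N∸suca : N ∸ suc a ≡ suc (suc d)
      N∸suca = trans (cong (_∸ suc a) N≡2+M) (trans (ℕP.+-∸-assoc 1 a≤M) (cong suc M∸a≡1+d))
      Bs-suc : ∀ a → a ℕ.% 2 ≡ 1 → Bs (suc a) ≡ B (suc a)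
      Bs-suc (suc a) _ = Bs-≥2 a
      integer : IsInteger (ℕ→ℚ (r N) * rTerm N a)
      integer = denominator-∣⇒IsInteger (rTerm N a) (r N) (rAux-∣ N (N ∸ 1) a (subst (λ k → a < k ∸ 1) (sym N≡2+M) (s≤s a≤M)) odd)
      shuffle : ∀ β r c x y → (β * r) * (c * (x * y)) ≡ r * (β * c * x * y)
      shuffle = solve-∀ ringℚ

  -- In the binomial expansion only the two end terms lack the factor `v w`. They contain `B₀ B_N`
  -- and are the polar terms; the coefficients of the others are integers by `coefficient-integer`.
  unimodular : Σ[ F ∈ Form M ] (∀ v w →
    K N * (c 0ℚ v ⋆ c 0ℚ w) N ≡ A N * (v * powℚ v (suc M) + w * powℚ w (suc M)) + v * w * eval F v w)
  unimodular = proj₁ F , (λ v w → trans (expand v w) (cong (λ x → A N * (v * powℚ v (suc M) + w * powℚ w (suc M)) + v * w * x) (sym (proj₂ F v w))))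
    where
    open ≡-Reasoning
    z : ℕ → ℚ
    z a = K N * (ℕ→ℚ (N C suc a) * (Bs (suc a) * Bs (suc (M ∸ a))))
    F : IsForm M (λ v w → sumℚ (suc M) (λ a → z a * (powℚ v a * powℚ w (M ∸ a))))
    F = isForm-sum (suc M) (λ a v w → z a * (powℚ v a * powℚ w (M ∸ a))) term
      where
      term : ∀ a → a < suc M → IsForm M (λ v w → z a * (powℚ v a * powℚ w (M ∸ a)))
      term a a<1+M = let (y , z≡y) = coefficient-integer a (ℕP.≤-pred a<1+M) in
        isForm-cong (λ v w → cong (_* (powℚ v a * powℚ w (M ∸ a))) (sym z≡y))
          (isForm-scale y (subst (λ n → IsForm n (λ v w → powℚ v a * powℚ w (M ∸ a))) (ℕP.m+[n∸m]≡n (ℕP.≤-pred a<1+M)) (isForm-monomial a (M ∸ a))))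
    expand : ∀ v w → K N * (c 0ℚ v ⋆ c 0ℚ w) N ≡ A N * (v * powℚ v (suc M) + w * powℚ w (suc M)) + v * w * sumℚ (suc M) (λ a → z a * (powℚ v a * powℚ w (M ∸ a)))
    expand v w = begin
      K N * (c 0ℚ v ⋆ c 0ℚ w) N
        ≡⟨ cong (K N *_) (binomial-⋆ (c 0ℚ v) (c 0ℚ w) N) ⟩
      K N * sumℚ (suc N) T
        ≡⟨ cong (λ n → K N * sumℚ (suc n) T) N≡2+M ⟩
      K N * (sumℚ (suc (suc M)) T + T (suc (suc M)))
        ≡⟨ cong₂ (λ x y → K N * (x + y)) (sum-head (suc M) T) (cong T (sym N≡2+M)) ⟩
      K N * ((T 0 + sumℚ (suc M) (λ a → T (suc a))) + T N)
        ≡⟨ distribute (K N) (T 0) (sumℚ (suc M) (λ a → T (suc a))) (T N) ⟩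
      (K N * T 0 + K N * T N) + K N * sumℚ (suc M) (λ a → T (suc a))
        ≡⟨ cong₂ _+_ (cong₂ _+_ end₀ endN) (sym (sum-*ˡ (suc M) (K N) (λ a → T (suc a)))) ⟩
      (A N * powℚ w N + A N * powℚ v N) + sumℚ (suc M) (λ a → K N * T (suc a))
        ≡⟨ cong₂ _+_ (trans (collect (A N) (powℚ w N) (powℚ v N)) (cong (λ n → A N * (powℚ v n + powℚ w n)) N≡2+M)) (trans (sum-cong (suc M) middle) (sum-*ˡ (suc M) (v * w) _)) ⟩
      A N * (v * powℚ v (suc M) + w * powℚ w (suc M)) + v * w * sumℚ (suc M) (λ a → z a * (powℚ v a * powℚ w (M ∸ a))) ∎
      where
      T : ℕ → ℚ
      T k = ℕ→ℚ (N C k) * ((powℚ v k * Bs k) * (powℚ w (N ∸ k) * Bs (N ∸ k)))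
      distribute : ∀ k a s b → k * ((a + s) + b) ≡ (k * a + k * b) + k * s
      distribute = solve-∀ ringℚ
      collect : ∀ a x y → a * x + a * y ≡ a * (y + x)
      collect = solve-∀ ringℚ
      end₀ : K N * T 0 ≡ A N * powℚ w N
      end₀ = trans (cong (λ x → K N * (1ℚ * ((1ℚ * 1ℚ) * (powℚ w N * x)))) Bs-N) (trans (lem (K N) (powℚ w N) (B N)) (cong (_* powℚ w N) (K*B N)))
        where
        lem : ∀ k x b → k * (1ℚ * ((1ℚ * 1ℚ) * (x * b))) ≡ (k * b) * x
        lem = solve-∀ ringℚ
      endN : K N * T N ≡ A N * powℚ v N
      endN = begin
        K N * (ℕ→ℚ (N C N) * ((powℚ v N * Bs N) * (powℚ w (N ∸ N) * Bs (N ∸ N))))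
          ≡⟨ cong₂ (λ m k → K N * (ℕ→ℚ m * ((powℚ v N * Bs N) * (powℚ w k * Bs k)))) (nCn≡1 N) (ℕP.n∸n≡0 N) ⟩
        K N * (1ℚ * ((powℚ v N * Bs N) * (1ℚ * 1ℚ)))
          ≡⟨ cong (λ x → K N * (1ℚ * ((powℚ v N * x) * (1ℚ * 1ℚ)))) Bs-N ⟩
        K N * (1ℚ * ((powℚ v N * B N) * (1ℚ * 1ℚ)))
          ≡⟨ lem (K N) (powℚ v N) (B N) ⟩
        (K N * B N) * powℚ v N
          ≡⟨ cong (_* powℚ v N) (K*B N) ⟩
        A N * powℚ v N ∎
        where
        lem : ∀ k x b → k * (1ℚ * ((x * b) * (1ℚ * 1ℚ))) ≡ (k * b) * x
        lem = solve-∀ ringℚ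
      middle : ∀ a → a < suc M → K N * T (suc a) ≡ (v * w) * (z a * (powℚ v a * powℚ w (M ∸ a)))
      middle a a<1+M = trans (cong (λ m → K N * (ℕ→ℚ (N C suc a) * ((powℚ v (suc a) * Bs (suc a)) * (powℚ w m * Bs m)))) (trans (cong (_∸ suc a) N≡2+M) (ℕP.+-∸-assoc 1 (ℕP.≤-pred a<1+M))))
        (lem (K N) (ℕ→ℚ (N C suc a)) v (powℚ v a) (Bs (suc a)) w (powℚ w (M ∸ a)) (Bs (suc (M ∸ a))))
        where
        lem : ∀ k c v x b w y d → k * (c * (((v * x) * b) * ((w * y) * d))) ≡ (v * w) * ((k * (c * (b * d))) * (x * y))
        lem = solve-∀ ringℚ

-- The correction of the reciprocity law lives in degree 2 and so matters only for `N = 2`.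
correction : ∀ {N} M → N ≡ suc (suc M) → IsForm M (λ _ _ → K N * (½ * ½ * (𝕥 ⋆ 𝕥) N))
-- `β 2 = 6`, `r 2 = 1` and the exponential coefficient of `t²` is 2, so the value is
-- `6 · ¼ · 2 = 3`.
correction     zero    refl   = const (+ 3) , (λ _ _ → refl)
correction {N} (suc M) N≡3+M = isForm-cong (λ _ _ → sym (trans (cong (λ x → K N * (½ * ½ * x)) (trans (cong (𝕥 ⋆ 𝕥) N≡3+M) (𝕥²-higher M))) (vanish (K N)))) (isForm-zero (suc M))
  where
  vanish : ∀ k → k * (½ * ½ * 0ℚ) ≡ 0ℚ
  vanish = solve-∀ ringℚ

-- The quotient of `x^(2m+1) + y^(2m+1)` by `x + y`. The recursion divides `x² (x^(2m+1) + y^(2m+1))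
-- + (y² - x²) y^(2m+1)`.
oddQuotient : ℕ → ℚ → ℚ → ℚ
oddQuotient zero    x y = 1ℚ
oddQuotient (suc m) x y = x * (x * oddQuotient m x y) + (y - x) * powℚ y (suc (m ℕ.+ m))

oddQuotient-spec : ∀ m x y → powℚ x (suc (m ℕ.+ m)) + powℚ y (suc (m ℕ.+ m)) ≡ (x + y) * oddQuotient m x y
oddQuotient-spec zero    x y = lem x y
  where
  lem : ∀ x y → x * 1ℚ + y * 1ℚ ≡ (x + y) * 1ℚ
  lem = solve-∀ ringℚ
oddQuotient-spec (suc m) x y = begin
  powℚ x (suc (suc m ℕ.+ suc m)) + powℚ y (suc (suc m ℕ.+ suc m))
    ≡⟨ cong (λ k → powℚ x (suc (suc k)) + powℚ y (suc (suc k))) (ℕP.+-suc m m) ⟩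
  x * (x * X) + y * (y * Y)
    ≡⟨ lem₁ x y X Y ⟩
  x * (x * (X + Y)) + (y * y - x * x) * Y
    ≡⟨ cong (λ e → x * (x * e) + (y * y - x * x) * Y) (oddQuotient-spec m x y) ⟩
  x * (x * ((x + y) * oddQuotient m x y)) + (y * y - x * x) * Y
    ≡⟨ lem₂ x y (oddQuotient m x y) Y ⟩
  (x + y) * (x * (x * oddQuotient m x y) + (y - x) * Y) ∎
  where
  open ≡-Reasoning
  X = powℚ x (suc (m ℕ.+ m))
  Y = powℚ y (suc (m ℕ.+ m))
  lem₁ : ∀ x y X Y → x * (x * X) + y * (y * Y) ≡ x * (x * (X + Y)) + (y * y - x * x) * Y
  lem₁ = solve-∀ ringℚ
  lem₂ : ∀ x y Q Y → x * (x * ((x + y) * Q)) + (y * y - x * x) * Y ≡ (x + y) * (x * (x * Q) + (y - x) * Y)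
  lem₂ = solve-∀ ringℚ

isForm-oddQuotient : ∀ m → IsForm (m ℕ.+ m) (oddQuotient m)
isForm-oddQuotient zero    = const (+ 1) , (λ _ _ → refl)
isForm-oddQuotient (suc m) = subst (λ k → IsForm (suc k) (oddQuotient (suc m))) (sym (ℕP.+-suc m m))
  (isForm-+ (isForm-linear-* (λ x y → x) (+ 1) (+ 0) first (isForm-linear-* (λ x y → x) (+ 1) (+ 0) first (isForm-oddQuotient m)))
            (isForm-linear-* (λ x y → y - x) (ℤ.- (+ 1)) (+ 1) lem (isForm-pow (λ x y → y) (+ 0) (+ 1) second (suc (m ℕ.+ m)))))
  where
  lem′ : ∀ v w → (- 1ℚ) * v + 1ℚ * w ≡ w - v
  lem′ = solve-∀ ringℚ
  lem : ∀ v w → ℤ→ℚ (ℤ.- (+ 1)) * v + ℤ→ℚ (+ 1) * w ≡ w - v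
  lem = lem′

-- The quotient of `x^(n+1) - y^(n+1)` by `x - y`.
differenceQuotient : ℕ → ℚ → ℚ → ℚ
differenceQuotient zero    x y = 1ℚ
differenceQuotient (suc n) x y = x * differenceQuotient n x y + powℚ y (suc n)

differenceQuotient-spec : ∀ n x y → powℚ x (suc n) ≡ powℚ y (suc n) + (x - y) * differenceQuotient n x y
differenceQuotient-spec zero    x y = lem x y
  where
  lem : ∀ x y → x * 1ℚ ≡ y * 1ℚ + (x - y) * 1ℚ
  lem = solve-∀ ringℚ
differenceQuotient-spec (suc n) x y = trans (cong (x *_) (differenceQuotient-spec n x y)) (lem x y (powℚ y (suc n)) (differenceQuotient n x y))
  where
  lem : ∀ x y Y Q → x * (Y + (x - y) * Q) ≡ y * Y + (x - y) * (x * Q + Y)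
  lem = solve-∀ ringℚ

isForm-differenceQuotient : ∀ n → IsForm n (differenceQuotient n)
isForm-differenceQuotient zero    = const (+ 1) , (λ _ _ → refl)
isForm-differenceQuotient (suc n) = isForm-+ (isForm-linear-* (λ x y → x) (+ 1) (+ 0) first (isForm-differenceQuotient n)) (isForm-pow (λ x y → y) (+ 0) (+ 1) second (suc n))

-- One step of the continued fraction with minus signs: `b` is `q/p` rounded up, with `p = p₀ + 1`,
-- computed as `q + p₀` divided by `p` and rounded down. Hence `p₂ = b p - q` lies between 0 and
-- `p₀`.
negative-quotient : ∀ q p₀ → ∃ λ p₂ → ∃ λ b → p₂ ≤ p₀ × p₂ ℕ.+ q ≡ b ℕ.* suc p₀
negative-quotient q p₀ = p₀ ∸ ρ , d , ℕP.m∸n≤m p₀ ρ , ℕP.+-cancelˡ-≡ ρ _ _ (begin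
  ρ ℕ.+ (p₀ ∸ ρ ℕ.+ q)     ≡⟨ sym (ℕP.+-assoc ρ (p₀ ∸ ρ) q) ⟩
  ρ ℕ.+ (p₀ ∸ ρ) ℕ.+ q     ≡⟨ cong (ℕ._+ q) (ℕP.m+[n∸m]≡n ρ≤p₀) ⟩
  p₀ ℕ.+ q                 ≡⟨ ℕP.+-comm p₀ q ⟩
  q ℕ.+ p₀                 ≡⟨ ℕDM.m≡m%n+[m/n]*n (q ℕ.+ p₀) (suc p₀) ⟩
  ρ ℕ.+ d ℕ.* suc p₀       ∎)
  where
  open ≡-Reasoning
  ρ = (q ℕ.+ p₀) ℕ.% suc p₀
  d = (q ℕ.+ p₀) ℕ./ suc p₀
  ρ≤p₀ : ρ ≤ p₀
  ρ≤p₀ = ℕP.≤-pred (ℕDM.m%n<n (q ℕ.+ p₀) (suc p₀))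

-- Polar terms along the boundary rays

module Polar (N m : ℕ) (N≡2+2m : N ≡ suc (suc (m ℕ.+ m))) where
  M : ℕ
  M = m ℕ.+ m

  -- In the basis v, w of the lattice generated by u, w and (u + p w) / q, up to an integral form the
  -- sum is given by the polar parts at its two boundary rays u and w.
  PolarDecomposition : (q p : ℕ) .{{_ : NonZero q}} → ℤ → Form M → Set
  PolarDecomposition q p p′ H = ∀ u w v v⋆ → 0ℚ ℚ.< u → 0ℚ ℚ.< w →
    ℕ→ℚ q * v ≡ u + ℕ→ℚ p * w → ℕ→ℚ q * v⋆ ≡ ℤ→ℚ p′ * u + w →
    K N * D q p u w N ≡ A N * (u * powℚ v (suc M) + w * powℚ v⋆ (suc M)) + u * w * eval H v w

  -- The cone is unimodular with `v = u`, but modulo 1 every `p′` is an inverse, so `v⋆ = p′ u + w`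
  -- need not be `w`. Exchanging `w^(N-1)` for `v⋆^(N-1)` costs a multiple of `v⋆ - w = p′ u`, which
  -- goes into the form.
  polar-base : ∀ p′ → Σ[ H ∈ Form M ] PolarDecomposition 1 0 p′ H
  polar-base p′ = proj₁ H , λ u w v v⋆ _ _ v≡ v⋆≡ →
    let v≡u : v ≡ u
        v≡u = trans (sym (ℚP.*-identityˡ v)) (trans v≡ (trans (cong (ℚ._+_ u) (ℚP.*-zeroˡ w)) (ℚP.+-identityʳ u)))
        v⋆≡l : v⋆ ≡ l u w
        v⋆≡l = trans (sym (ℚP.*-identityˡ v⋆)) v⋆≡
    in begin
    K N * D 1 0 u w N
      ≡⟨ cong (K N *_) (ℚP.+-identityˡ _) ⟩
    K N * (c 0ℚ u ⋆ c 0ℚ w) N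
      ≡⟨ proj₂ (unimodular N≡2+2m) u w ⟩
    A N * (u * powℚ u (suc M) + w * powℚ w (suc M)) + u * w * eval I u w
      ≡⟨ lem (A N) u w (powℚ u (suc M)) (powℚ w (suc M)) (powℚ (l u w) (suc M)) (ℤ→ℚ p′) (dq u w) (eval I u w) (differenceQuotient-spec M (l u w) w) ⟩
    A N * (u * powℚ u (suc M) + w * powℚ (l u w) (suc M)) + u * w * (eval I u w + (- (A N * ℤ→ℚ p′)) * dq u w)
      ≡⟨ cong (λ x → A N * (u * powℚ u (suc M) + w * powℚ (l u w) (suc M)) + u * w * x) (sym (proj₂ H u w)) ⟩
    A N * (u * powℚ u (suc M) + w * powℚ (l u w) (suc M)) + u * w * eval (proj₁ H) u w
      ≡⟨ cong₂ (λ x y → A N * (u * powℚ x (suc M) + w * powℚ y (suc M)) + u * w * eval (proj₁ H) x w) (sym v≡u) (sym v⋆≡l) ⟩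
    A N * (u * powℚ v (suc M) + w * powℚ v⋆ (suc M)) + u * w * eval (proj₁ H) v w ∎
    where
    open ≡-Reasoning
    I = proj₁ (unimodular N≡2+2m)
    l dq : ℚ → ℚ → ℚ
    l u w = ℤ→ℚ p′ * u + w
    dq u w = differenceQuotient M (l u w) w
    a : ℤ
    a = ℤ.- (α N ℤ.* (+ r N) ℤ.* p′)
    a≡ : ℤ→ℚ a ≡ - (A N * ℤ→ℚ p′)
    a≡ = trans (ℤ→ℚ-neg (α N ℤ.* (+ r N) ℤ.* p′)) (cong -_ (ℤ→ℚ-* (α N ℤ.* (+ r N)) p′))
    dq-form : IsForm M dq
    dq-form = let (F , F≡) = isForm-differenceQuotient M in
      substitute p′ (+ 1) (+ 0) (+ 1) F ,
      λ u w → trans (eval-substitute p′ (+ 1) (+ 0) (+ 1) F u w)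
        (trans (F≡ _ _) (cong₂ (differenceQuotient M) (cong (ℚ._+_ (ℤ→ℚ p′ * u)) (ℚP.*-identityˡ w)) (second u w)))
    H : IsForm M (λ u w → eval I u w + (- (A N * ℤ→ℚ p′)) * dq u w)
    H = isForm-+ (I , λ _ _ → refl) (isForm-cong (λ u w → cong (_* dq u w) a≡) (isForm-scale a dq-form))
    expand : ∀ A u w U W p d i → A * (u * U + w * (W + ((p * u + w) - w) * d)) + u * w * (i + (- (A * p)) * d) ≡ A * (u * U + w * W) + u * w * i
    expand = solve-∀ ringℚ
    lem : ∀ A u w U W L p d i → L ≡ W + ((p * u + w) - w) * d →
      A * (u * U + w * W) + u * w * i ≡ A * (u * U + w * L) + u * w * (i + (- (A * p)) * d)
    lem A u w U W L p d i refl = sym (expand A u w U W p d i)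

  -- From `p p′ = 1 + q t`, the number `t` inverts `-q`, hence `p₂`, modulo `p`. It takes the role
  -- of `p′` for the cone spanned by `u` and `v`, whose lattice basis is `v₂`, `v`.
  module Step (q p : ℕ) .{{_ : NonZero q}} .{{_ : NonZero p}} (p₂ b : ℕ) (p₂+q≡bp : p₂ ℕ.+ q ≡ b ℕ.* p)
    (p′ t : ℤ) (pp′≡1+qt : (+ p) ℤ.* p′ ≡ (+ 1) ℤ.+ (+ q) ℤ.* t)
    (H′ : Form M) (polar′ : PolarDecomposition p p₂ t H′) where
    open ≡-Reasoning

    I = proj₁ (unimodular N≡2+2m)
    T = proj₁ (correction M N≡2+2m)
    a : ℤ
    a = α N ℤ.* (+ r N) ℤ.* (+ b)
    bℚ : ℚ
    bℚ = ℕ→ℚ b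
    v₂ oq : ℚ → ℚ → ℚ
    v₂ v w = bℚ * v - w
    oq v w = oddQuotient m (v₂ v w) w

    v₂-linear : ∀ v w → ℤ→ℚ (+ b) * v + ℤ→ℚ (ℤ.- (+ 1)) * w ≡ v₂ v w
    v₂-linear v w = lem bℚ v w
      where
      lem : ∀ b v w → b * v + (- 1ℚ) * w ≡ b * v - w
      lem = solve-∀ ringℚ

    oq-form : IsForm M oq
    oq-form = let (F , F≡) = isForm-oddQuotient m in
      substitute (+ b) (ℤ.- (+ 1)) (+ 0) (+ 1) F ,
      λ v w → trans (eval-substitute (+ b) (ℤ.- (+ 1)) (+ 0) (+ 1) F v w)
        (trans (F≡ _ _) (cong₂ (oddQuotient m) (v₂-linear v w) (second v w)))

    H : IsForm M (λ v w → (eval H′ (v₂ v w) v + eval I v w) + ((A N * bℚ) * oq v w + (- 1ℚ) * eval T v w))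
    H = isForm-+ (isForm-+ H′-form (I , λ _ _ → refl))
      (isForm-+ (isForm-cong (λ v w → cong (_* oq v w) (ℤ→ℚ-* (α N ℤ.* (+ r N)) (+ b))) (isForm-scale a oq-form))
                (isForm-scale (ℤ.- (+ 1)) (T , λ _ _ → refl)))
      where
      H′-form : IsForm M (λ v w → eval H′ (v₂ v w) v)
      H′-form = substitute (+ b) (ℤ.- (+ 1)) (+ 1) (+ 0) H′ ,
        λ v w → trans (eval-substitute (+ b) (ℤ.- (+ 1)) (+ 1) (+ 0) H′ v w) (cong₂ (eval H′) (v₂-linear v w) (first v w))

    polar : PolarDecomposition q p p′ (proj₁ H)
    -- The statement is proved after multiplication by `v`; the positivity of `u` and `w` serves to
    -- make `v` positive and cancellable.
    polar u w v v⋆ u>0 w>0 qv≡ qv⋆≡ = *-cancelˡ-pos v>0 (begin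
      v * (K N * d)
        ≡⟨ lem₁ v (K N) d (u * v * w) τ ⟩
      K N * (v * d + u * v * w * τ) - u * v * w * (K N * τ)
        ≡⟨ cong₂ (λ x y → K N * x - u * v * w * y) (reciprocity q p u v w qv≡ N p₂ b p₂+q≡bp) (sym (proj₂ (correction M N≡2+2m) v w)) ⟩
      K N * (w * d′ + u * cc) - u * v * w * eval T v w
        ≡⟨ lem₂ (K N) w d′ u cc (u * v * w * eval T v w) ⟩
      (w * (K N * d′) + u * (K N * cc)) - u * v * w * eval T v w
        ≡⟨ cong₂ (λ x y → (w * x + u * y) - u * v * w * eval T v w) (polar′ u v (v₂ v w) v⋆ u>0 v>0 pv₂≡ pv⋆≡) (proj₂ (unimodular N≡2+2m) v w) ⟩
      (w * (A N * (u * X + v * S) + u * v * eval H′ (v₂ v w) v) + u * (A N * (v * V + w * W) + v * w * eval I v w)) - u * v * w * eval T v w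
        ≡⟨ lem₃ (A N) u v w X S V W (eval H′ (v₂ v w) v) (eval I v w) (eval T v w) ⟩
      v * (A N * (u * V + w * S) + u * w * ((eval H′ (v₂ v w) v + eval I v w) + (- 1ℚ) * eval T v w)) + A N * u * w * (X + W)
        -- Only the polar terms at `v` are left without a visible factor `v`; as `v₂ + w` is `b v`,
        -- the odd quotient exposes it.
        ≡⟨ cong (λ x → v * (A N * (u * V + w * S) + u * w * ((eval H′ (v₂ v w) v + eval I v w) + (- 1ℚ) * eval T v w)) + A N * u * w * x) (oddQuotient-spec m (v₂ v w) w) ⟩
      v * (A N * (u * V + w * S) + u * w * ((eval H′ (v₂ v w) v + eval I v w) + (- 1ℚ) * eval T v w)) + A N * u * w * ((v₂ v w + w) * oq v w)
        ≡⟨ lem₄ (A N) u v w V S (eval H′ (v₂ v w) v) (eval I v w) (eval T v w) bℚ (oq v w) ⟩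
      v * (A N * (u * V + w * S) + u * w * ((eval H′ (v₂ v w) v + eval I v w) + ((A N * bℚ) * oq v w + (- 1ℚ) * eval T v w)))
        ≡⟨ cong (λ x → v * (A N * (u * V + w * S) + u * w * x)) (sym (proj₂ H v w)) ⟩
      v * (A N * (u * V + w * S) + u * w * eval (proj₁ H) v w) ∎)
      where
      Q P : ℚ
      Q = ℕ→ℚ q
      P = ℕ→ℚ p
      d = D q p u w N
      d′ = D p p₂ u v N
      cc = (c 0ℚ v ⋆ c 0ℚ w) N
      τ = ½ * ½ * (𝕥 ⋆ 𝕥) N
      X = powℚ (v₂ v w) (suc M)
      S = powℚ v⋆ (suc M)
      V = powℚ v (suc M)
      W = powℚ w (suc M)
      v>0 : 0ℚ ℚ.< v
      v>0 = ℚP.*-cancelˡ-<-nonNeg Q {{ℚP.pos⇒nonNeg Q {{ℕ→ℚ-pos q}}}} (subst₂ ℚ._<_ (sym (ℚP.*-zeroʳ Q)) (sym qv≡)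
        (ℚP.positive⁻¹ (u + P * w) {{ℚP.pos+pos⇒pos u {{ℚ.positive u>0}} (P * w) {{ℚP.pos*pos⇒pos P {{ℕ→ℚ-pos p}} w {{ℚ.positive w>0}}}}}}))
      bP≡ : bℚ * P ≡ ℕ→ℚ p₂ + Q
      bP≡ = trans (sym (ℕ→ℚ-* b p)) (trans (cong ℕ→ℚ (sym p₂+q≡bp)) (ℕ→ℚ-+ p₂ q))
      pv₂≡ : P * v₂ v w ≡ u + ℕ→ℚ p₂ * v
      pv₂≡ = begin
        P * (bℚ * v - w)                       ≡⟨ lem P bℚ v w ⟩
        (bℚ * P) * v - P * w                   ≡⟨ cong (λ x → x * v - P * w) bP≡ ⟩
        (ℕ→ℚ p₂ + Q) * v - P * w               ≡⟨ lem′ (ℕ→ℚ p₂) Q v (P * w) ⟩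
        ℕ→ℚ p₂ * v + (Q * v - P * w)           ≡⟨ cong (λ x → ℕ→ℚ p₂ * v + (x - P * w)) qv≡ ⟩
        ℕ→ℚ p₂ * v + ((u + P * w) - P * w)     ≡⟨ lem″ (ℕ→ℚ p₂ * v) u (P * w) ⟩
        u + ℕ→ℚ p₂ * v                         ∎
        where
        lem : ∀ P b v w → P * (b * v - w) ≡ (b * P) * v - P * w
        lem = solve-∀ ringℚ
        lem′ : ∀ a Q v x → (a + Q) * v - x ≡ a * v + (Q * v - x)
        lem′ = solve-∀ ringℚ
        lem″ : ∀ a u x → a + ((u + x) - x) ≡ u + a
        lem″ = solve-∀ ringℚ
      Pp′≡ : P * ℤ→ℚ p′ ≡ 1ℚ + Q * ℤ→ℚ t
      Pp′≡ = trans (sym (ℤ→ℚ-* (+ p) p′)) (trans (cong ℤ→ℚ pp′≡1+qt) (trans (ℤ→ℚ-+ (+ 1) ((+ q) ℤ.* t)) (cong (ℚ._+_ 1ℚ) (ℤ→ℚ-* (+ q) t))))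
      -- Cutting off the cone of `v` and `w` does not touch the ray `u`, so the same neighbour `v⋆`
      -- serves the smaller cone and its polar term passes through the recursion unchanged.
      pv⋆≡ : P * v⋆ ≡ ℤ→ℚ t * u + v
      pv⋆≡ = *-cancel-ℕ q (begin
        (P * v⋆) * Q                         ≡⟨ lem P v⋆ Q ⟩
        P * (Q * v⋆)                         ≡⟨ cong (P *_) qv⋆≡ ⟩
        P * (ℤ→ℚ p′ * u + w)                 ≡⟨ lem′ P (ℤ→ℚ p′) u w ⟩
        (P * ℤ→ℚ p′) * u + P * w             ≡⟨ cong (λ x → x * u + P * w) Pp′≡ ⟩
        (1ℚ + Q * ℤ→ℚ t) * u + P * w         ≡⟨ lem″ Q (ℤ→ℚ t) u (P * w) ⟩
        (Q * ℤ→ℚ t) * u + (u + P * w)        ≡⟨ cong (ℚ._+_ ((Q * ℤ→ℚ t) * u)) (sym qv≡) ⟩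
        (Q * ℤ→ℚ t) * u + Q * v              ≡⟨ lem‴ Q (ℤ→ℚ t) u v ⟩
        (ℤ→ℚ t * u + v) * Q                  ∎)
        where
        lem : ∀ P v Q → (P * v) * Q ≡ P * (Q * v)
        lem = solve-∀ ringℚ
        lem′ : ∀ P a u w → P * (a * u + w) ≡ (P * a) * u + P * w
        lem′ = solve-∀ ringℚ
        lem″ : ∀ Q t u x → (1ℚ + Q * t) * u + x ≡ (Q * t) * u + (u + x)
        lem″ = solve-∀ ringℚ
        lem‴ : ∀ Q t u v → (Q * t) * u + Q * v ≡ (t * u + v) * Q
        lem‴ = solve-∀ ringℚ
      lem₁ : ∀ v k d e τ → v * (k * d) ≡ k * (v * d + e * τ) - e * (k * τ)
      lem₁ = solve-∀ ringℚ
      lem₂ : ∀ k w d u e f → k * (w * d + u * e) - f ≡ (w * (k * d) + u * (k * e)) - f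
      lem₂ = solve-∀ ringℚ
      lem₃ : ∀ A u v w X S V W H I T →
        (w * (A * (u * X + v * S) + u * v * H) + u * (A * (v * V + w * W) + v * w * I)) - u * v * w * T ≡
        v * (A * (u * V + w * S) + u * w * ((H + I) + (- 1ℚ) * T)) + A * u * w * (X + W)
      lem₃ = solve-∀ ringℚ
      lem₄ : ∀ A u v w V S H I T b o →
        v * (A * (u * V + w * S) + u * w * ((H + I) + (- 1ℚ) * T)) + A * u * w * (((b * v - w) + w) * o) ≡
        v * (A * (u * V + w * S) + u * w * ((H + I) + ((A * b) * o + (- 1ℚ) * T)))
      lem₄ = solve-∀ ringℚ

  next-inverse : ∀ (q p p₂ b : ℕ) (p′ t : ℤ) → p₂ ℕ.+ q ≡ b ℕ.* p → (+ p) ℤ.* p′ ≡ (+ 1) ℤ.+ (+ q) ℤ.* t →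
    (+ p₂) ℤ.* t ≡ (+ 1) ℤ.+ (+ p) ℤ.* ((+ b) ℤ.* t ℤ.- p′)
  next-inverse q p p₂ b p′ t p₂+q≡bp pp′≡1+qt = begin
    (+ p₂) ℤ.* t
      ≡⟨ lem₁ (+ p₂) (+ q) t ⟩
    ((+ p₂) ℤ.+ (+ q)) ℤ.* t ℤ.+ (+ 1) ℤ.- ((+ 1) ℤ.+ (+ q) ℤ.* t)
      ≡⟨ cong₂ (λ x y → x ℤ.* t ℤ.+ (+ 1) ℤ.- y) (trans (cong +_ p₂+q≡bp) (ℤP.pos-* b p)) (sym pp′≡1+qt) ⟩
    ((+ b) ℤ.* (+ p)) ℤ.* t ℤ.+ (+ 1) ℤ.- (+ p) ℤ.* p′
      ≡⟨ lem₂ (+ b) (+ p) t p′ ⟩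
    (+ 1) ℤ.+ (+ p) ℤ.* ((+ b) ℤ.* t ℤ.- p′) ∎
    where
    open ≡-Reasoning
    lem₁ : ∀ a q t → a ℤ.* t ≡ (a ℤ.+ q) ℤ.* t ℤ.+ (+ 1) ℤ.- ((+ 1) ℤ.+ q ℤ.* t)
    lem₁ = ℤRing.solve-∀
    lem₂ : ∀ b p t x → (b ℤ.* p) ℤ.* t ℤ.+ (+ 1) ℤ.- p ℤ.* x ≡ (+ 1) ℤ.+ p ℤ.* (b ℤ.* t ℤ.- x)
    lem₂ = ℤRing.solve-∀

  -- Descent on `p`, bounded by `n`. Coprimality is carried by the equation `p p′ = 1 + q t`, for
  -- which `next-inverse` supplies the next quotient.
  polar-decomposition : ∀ n q p .{{_ : NonZero q}} → p ≤ n → (p′ t : ℤ) → (+ p) ℤ.* p′ ≡ (+ 1) ℤ.+ (+ q) ℤ.* t →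
    Σ[ H ∈ Form M ] PolarDecomposition q p p′ H
  polar-decomposition n (suc zero) zero _ p′ t e = polar-base p′
  -- At `p = 0` the equation reads `0 = 1 + q t`, so `q` divides 1.
  polar-decomposition n (suc (suc q)) zero _ p′ t e = contradiction (ℕD.∣1⇒≡1 (ℕD.divides ℤ.∣ t ∣ one)) λ ()
    where
    lem : ∀ q t → + 1 ≡ ((+ 1) ℤ.+ q ℤ.* t) ℤ.- t ℤ.* q
    lem = ℤRing.solve-∀
    lem′ : + 1 ≡ ℤ.- (t ℤ.* (+ suc (suc q)))
    lem′ = trans (lem (+ suc (suc q)) t) (trans (cong (ℤ._- t ℤ.* (+ suc (suc q))) (sym e)) (ℤP.+-identityˡ _))
    one : 1 ≡ ℤ.∣ t ∣ ℕ.* suc (suc q)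
    one = trans (cong ℤ.∣_∣ lem′) (trans (ℤP.∣-i∣≡∣i∣ (t ℤ.* (+ suc (suc q)))) (ℤP.abs-* t (+ suc (suc q))))
  polar-decomposition (suc n) q (suc p₀) (s≤s p₀≤n) p′ t e =
    let (p₂ , b , p₂≤p₀ , p₂+q≡bp) = negative-quotient q p₀
        (H′ , polar′) = polar-decomposition n (suc p₀) p₂ (ℕP.≤-trans p₂≤p₀ p₀≤n) t ((+ b) ℤ.* t ℤ.- p′)
          (next-inverse q (suc p₀) p₂ b p′ t p₂+q≡bp e)
    in proj₁ (Step.H q (suc p₀) p₂ b p₂+q≡bp p′ t e H′ polar′) , Step.polar q (suc p₀) p₂ b p₂+q≡bp p′ t e H′ polar′

-- Comparison of coefficients

poly : Seq → ℕ → ℚ → ℚ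
poly f n x = sumℚ n (λ a → f a * powℚ x a)

poly-head : ∀ f n x → poly f (suc n) x ≡ f 0 + x * poly (tail f) n x
poly-head f n x = trans (sum-head n (λ a → f a * powℚ x a)) (cong₂ _+_ (ℚP.*-identityʳ (f 0))
  (trans (sum-cong′ n (λ a → lem (f (suc a)) x (powℚ x a))) (sum-*ˡ n x (λ a → f (suc a) * powℚ x a))))
  where
  lem : ∀ f x y → f * (x * y) ≡ x * (f * y)
  lem = solve-∀ ringℚ

poly-⊕ : ∀ f g n x → poly (f ⊕ g) n x ≡ poly f n x + poly g n x
poly-⊕ f g n x = trans (sum-cong′ n (λ a → ℚP.*-distribʳ-+ (powℚ x a) (f a) (g a))) (sum-+ n _ _)

poly-· : ∀ k f n x → poly (k · f) n x ≡ k * poly f n x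
poly-· k f n x = trans (sum-cong′ n (λ a → ℚP.*-assoc k (f a) (powℚ x a))) (sum-*ˡ n k _)

poly-extend : ∀ f n x → f n ≡ 0ℚ → poly f (suc n) x ≡ poly f n x
poly-extend f n x fn≡0 = trans (cong (ℚ._+_ (poly f n x)) (trans (cong (_* powℚ x n) fn≡0) (ℚP.*-zeroˡ (powℚ x n)))) (ℚP.+-identityʳ _)

shift : Seq → Seq
shift f zero    = 0ℚ
shift f (suc n) = f n

poly-shift : ∀ f n x → poly (shift f) (suc n) x ≡ x * poly f n x
poly-shift f n x = trans (poly-head (shift f) n x) (ℚP.+-identityˡ _)

-- Synthetic division by X - ρ of the polynomial with coefficients f 0, …, f n.
quotient : Seq → ℕ → ℚ → Seq
quotient f zero    ρ j       = 0ℚ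
quotient f (suc n) ρ zero    = poly (tail f) (suc n) ρ
quotient f (suc n) ρ (suc j) = quotient (tail f) n ρ j

quotient-spec : ∀ f n ρ x → poly f (suc n) x ≡ poly f (suc n) ρ + (x - ρ) * poly (quotient f n ρ) n x
quotient-spec f zero    ρ x = lem (f 0) (x - ρ)
  where
  lem : ∀ a b → 0ℚ + a * 1ℚ ≡ (0ℚ + a * 1ℚ) + b * 0ℚ
  lem = solve-∀ ringℚ
quotient-spec f (suc n) ρ x = begin
  poly f (suc (suc n)) x                                ≡⟨ poly-head f (suc n) x ⟩
  f 0 + x * poly (tail f) (suc n) x                     ≡⟨ cong (λ y → f 0 + x * y) (quotient-spec (tail f) n ρ x) ⟩
  f 0 + x * (L + (x - ρ) * Q)                           ≡⟨ lem (f 0) x ρ L Q ⟩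
  (f 0 + ρ * L) + (x - ρ) * (L + x * Q)                 ≡⟨ cong₂ (λ y z → y + (x - ρ) * z) (sym (poly-head f (suc n) ρ)) (sym (poly-head (quotient f (suc n) ρ) n x)) ⟩
  poly f (suc (suc n)) ρ + (x - ρ) * poly (quotient f (suc n) ρ) (suc n) x ∎
  where
  open ≡-Reasoning
  L = poly (tail f) (suc n) ρ
  Q = poly (quotient (tail f) n ρ) n x
  lem : ∀ f x ρ L Q → f + x * (L + (x - ρ) * Q) ≡ (f + ρ * L) + (x - ρ) * (L + x * Q)
  lem = solve-∀ ringℚ

-- The leading entry of the quotient is the value of `tail f` at `ρ`, so its vanishing is exactly
-- the root condition for the recursion on the tail.
quotient-zero : ∀ f n ρ → (∀ j → j < n → quotient f n ρ j ≡ 0ℚ) → poly f (suc n) ρ ≡ 0ℚ → ∀ j → j < suc n → f j ≡ 0ℚ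
quotient-zero f zero    ρ Q≡0 root zero    _         = trans (sym (trans (ℚP.+-identityˡ _) (ℚP.*-identityʳ (f 0)))) root
quotient-zero f zero    ρ Q≡0 root (suc j) (s≤s ())
quotient-zero f (suc n) ρ Q≡0 root zero    _         = begin
  f 0                                  ≡⟨ sym (trans (cong (λ y → f 0 + ρ * y) (Q≡0 0 (s≤s z≤n))) (trans (cong (ℚ._+_ (f 0)) (ℚP.*-zeroʳ ρ)) (ℚP.+-identityʳ (f 0)))) ⟩
  f 0 + ρ * poly (tail f) (suc n) ρ    ≡⟨ sym (poly-head f (suc n) ρ) ⟩
  poly f (suc (suc n)) ρ               ≡⟨ root ⟩
  0ℚ                                   ∎
  where open ≡-Reasoning
quotient-zero f (suc n) ρ Q≡0 root (suc j) (s≤s j<n) = quotient-zero (tail f) n ρ (λ k k<n → Q≡0 (suc k) (s≤s k<n)) (Q≡0 0 (s≤s z≤n)) j j<n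

-- Dividing by `X - ρ` leaves a quotient that vanishes at `ρ + 1, ρ + 2, …`; the moving start `ρ`
-- lets the induction continue there.
poly-zero : ∀ n f ρ → (∀ k → poly f n (ℕ→ℚ (ρ ℕ.+ k)) ≡ 0ℚ) → ∀ j → j < n → f j ≡ 0ℚ
poly-zero (suc n) f ρ roots = quotient-zero f n (ℕ→ℚ ρ) (poly-zero n (quotient f n (ℕ→ℚ ρ)) (suc ρ) roots′) root
  where
  open ≡-Reasoning
  root : poly f (suc n) (ℕ→ℚ ρ) ≡ 0ℚ
  root = trans (cong (λ m → poly f (suc n) (ℕ→ℚ m)) (sym (ℕP.+-identityʳ ρ))) (roots 0)
  difference : ∀ k → ℕ→ℚ (suc ρ ℕ.+ k) - ℕ→ℚ ρ ≡ ℕ→ℚ (suc k)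
  difference k = trans (cong (λ m → ℕ→ℚ m - ℕ→ℚ ρ) (sym (ℕP.+-suc ρ k))) (trans (cong (_- ℕ→ℚ ρ) (ℕ→ℚ-+ ρ (suc k))) (lem (ℕ→ℚ ρ) (ℕ→ℚ (suc k))))
    where
    lem : ∀ a b → (a + b) - a ≡ b
    lem = solve-∀ ringℚ
  roots′ : ∀ k → poly (quotient f n (ℕ→ℚ ρ)) n (ℕ→ℚ (suc ρ ℕ.+ k)) ≡ 0ℚ
  roots′ k = *-cancel-ℕ (suc k) (begin
    y * ℕ→ℚ (suc k)                                          ≡⟨ ℚP.*-comm y (ℕ→ℚ (suc k)) ⟩
    ℕ→ℚ (suc k) * y                                          ≡⟨ cong (_* y) (sym (difference k)) ⟩
    (x - ℕ→ℚ ρ) * y                                          ≡⟨ sym (ℚP.+-identityˡ _) ⟩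
    0ℚ + (x - ℕ→ℚ ρ) * y                                     ≡⟨ cong (_+ (x - ℕ→ℚ ρ) * y) (sym root) ⟩
    poly f (suc n) (ℕ→ℚ ρ) + (x - ℕ→ℚ ρ) * y                 ≡⟨ sym (quotient-spec f n (ℕ→ℚ ρ) x) ⟩
    poly f (suc n) x                                         ≡⟨ trans (cong (λ m → poly f (suc n) (ℕ→ℚ m)) (sym (ℕP.+-suc ρ k))) (roots (suc k)) ⟩
    0ℚ                                                       ≡⟨ sym (ℚP.*-zeroˡ (ℕ→ℚ (suc k))) ⟩
    0ℚ * ℕ→ℚ (suc k)                                         ∎)
    where
    x = ℕ→ℚ (suc ρ ℕ.+ k)
    y = poly (quotient f n (ℕ→ℚ ρ)) n x

-- Evaluation starts at 1 because the polar decomposition is available for positive `u` only.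
poly-injective : ∀ n f g → (∀ k → poly f n (ℕ→ℚ (suc k)) ≡ poly g n (ℕ→ℚ (suc k))) → ∀ j → j < n → f j ≡ g j
poly-injective n f g f≗g j j<n = trans (lem (f j) (g j)) (trans (cong (_+ g j) (poly-zero n (f ⊕ ((- 1ℚ) · g)) 1 roots j j<n)) (ℚP.+-identityˡ (g j)))
  where
  lem : ∀ a b → a ≡ (a + (- 1ℚ) * b) + b
  lem = solve-∀ ringℚ
  lem′ : ∀ a → a + (- 1ℚ) * a ≡ 0ℚ
  lem′ = solve-∀ ringℚ
  roots : ∀ k → poly (f ⊕ ((- 1ℚ) · g)) n (ℕ→ℚ (suc k)) ≡ 0ℚ
  roots k = trans (poly-⊕ f ((- 1ℚ) · g) n (ℕ→ℚ (suc k))) (trans (cong₂ _+_ (f≗g k) (poly-· (- 1ℚ) g n (ℕ→ℚ (suc k)))) (lem′ (poly g n (ℕ→ℚ (suc k)))))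

isInteger-+ : ∀ {x y} → IsInteger x → IsInteger y → IsInteger (x + y)
isInteger-+ (a , x≡a) (b , y≡b) = a ℤ.+ b , trans (cong₂ _+_ x≡a y≡b) (sym (ℤ→ℚ-+ a b))

isInteger-* : ∀ {x y} → IsInteger x → IsInteger y → IsInteger (x * y)
isInteger-* (a , x≡a) (b , y≡b) = a ℤ.* b , trans (cong₂ _*_ x≡a y≡b) (sym (ℤ→ℚ-* a b))

-- Vanishing above the degree is recorded because multiplication by a linear form lengthens the
-- polynomial by one coefficient.
dehomogenise : ∀ {n} (F : Form n) → Σ[ f ∈ Seq ] ((∀ a → IsInteger (f a)) × (∀ a → n < a → f a ≡ 0ℚ) × (∀ x → eval F x 1ℚ ≡ poly f (suc n) x))
dehomogenise (const z) = κ (ℤ→ℚ z) , (λ { zero → z , refl ; (suc a) → + 0 , refl }) , (λ { (suc a) _ → refl }) , (λ x → lem (ℤ→ℚ z))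
  where
  lem : ∀ z → z ≡ 0ℚ + z * 1ℚ
  lem = solve-∀ ringℚ
dehomogenise {suc n} (lin a b F) with dehomogenise F
... | f , integral , support , evaluate = f′ , integral′ , support′ , evaluate′
  where
  open ≡-Reasoning
  aℚ bℚ : ℚ
  aℚ = ℤ→ℚ a
  bℚ = ℤ→ℚ b
  f′ : Seq
  f′ = (bℚ · f) ⊕ shift (aℚ · f)
  integral′ : ∀ k → IsInteger (f′ k)
  integral′ zero    = isInteger-+ (isInteger-* (b , refl) (integral 0)) (+ 0 , refl)
  integral′ (suc k) = isInteger-+ (isInteger-* (b , refl) (integral (suc k))) (isInteger-* (a , refl) (integral k))
  support′ : ∀ k → suc n < k → f′ k ≡ 0ℚ
  support′ (suc k) (s≤s n<k) = trans (cong₂ (λ x y → bℚ * x + aℚ * y) (support (suc k) (ℕP.m<n⇒m<1+n n<k)) (support k n<k)) (lem aℚ bℚ)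
    where
    lem : ∀ a b → b * 0ℚ + a * 0ℚ ≡ 0ℚ
    lem = solve-∀ ringℚ
  evaluate′ : ∀ x → (aℚ * x + bℚ * 1ℚ) * eval F x 1ℚ ≡ poly f′ (suc (suc n)) x
  evaluate′ x = sym (begin
    poly f′ (suc (suc n)) x
      ≡⟨ poly-⊕ (bℚ · f) (shift (aℚ · f)) (suc (suc n)) x ⟩
    poly (bℚ · f) (suc (suc n)) x + poly (shift (aℚ · f)) (suc (suc n)) x
      ≡⟨ cong₂ _+_ (trans (poly-· bℚ f (suc (suc n)) x) (cong (bℚ *_) (poly-extend f (suc n) x (support (suc n) (ℕP.n<1+n n))))) (trans (poly-shift (aℚ · f) (suc n) x) (cong (x *_) (poly-· aℚ f (suc n) x))) ⟩
    bℚ * poly f (suc n) x + x * (aℚ * poly f (suc n) x)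
      ≡⟨ lem aℚ bℚ x (poly f (suc n) x) ⟩
    (aℚ * x + bℚ * 1ℚ) * poly f (suc n) x
      ≡⟨ cong ((aℚ * x + bℚ * 1ℚ) *_) (sym (evaluate x)) ⟩
    (aℚ * x + bℚ * 1ℚ) * eval F x 1ℚ ∎)
    where
    lem : ∀ a b x y → b * y + x * (a * y) ≡ (a * x + b * 1ℚ) * y
    lem = solve-∀ ringℚ
dehomogenise {n} (F ⊞ G) with dehomogenise F | dehomogenise G
... | f , f-int , f-supp , f-eval | g , g-int , g-supp , g-eval = f ⊕ g ,
  (λ k → isInteger-+ (f-int k) (g-int k)) , (λ k n<k → cong₂ _+_ (f-supp k n<k) (g-supp k n<k)) ,
  (λ x → trans (cong₂ _+_ (f-eval x) (g-eval x)) (sym (poly-⊕ f g (suc n) x)))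

-- One factor `q` per linear form turns `q v` into `u + p w`. For the form of degree `N - 2` this is
-- the power of `q` in the theorem.
clearDenominators : ∀ {n} (q p : ℕ) (F : Form n) → Σ[ G ∈ Form n ] (∀ u v w →
  ℕ→ℚ q * v ≡ u + ℕ→ℚ p * w → powℚ (ℕ→ℚ q) n * eval F v w ≡ eval G u w)
clearDenominators q p (const z) = const z , λ _ _ _ _ → ℚP.*-identityˡ (ℤ→ℚ z)
clearDenominators {suc n} q p (lin a b F) = lin a a′ (proj₁ G) , λ u v w qv≡ → begin
  (Q * powℚ Q n) * ((ℤ→ℚ a * v + ℤ→ℚ b * w) * eval F v w)
    ≡⟨ lem Q (powℚ Q n) (ℤ→ℚ a) v (ℤ→ℚ b) w (eval F v w) ⟩
  (ℤ→ℚ a * (Q * v) + ℤ→ℚ b * (Q * w)) * (powℚ Q n * eval F v w)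
    ≡⟨ cong₂ (λ x y → (ℤ→ℚ a * x + ℤ→ℚ b * (Q * w)) * y) qv≡ (proj₂ G u v w qv≡) ⟩
  (ℤ→ℚ a * (u + P * w) + ℤ→ℚ b * (Q * w)) * eval (proj₁ G) u w
    ≡⟨ cong (_* eval (proj₁ G) u w) (trans (lem′ (ℤ→ℚ a) u P w (ℤ→ℚ b) Q) (cong (λ x → ℤ→ℚ a * u + x * w) (sym a′≡))) ⟩
  (ℤ→ℚ a * u + ℤ→ℚ a′ * w) * eval (proj₁ G) u w ∎
  where
  open ≡-Reasoning
  Q P : ℚ
  Q = ℕ→ℚ q
  P = ℕ→ℚ p
  a′ : ℤ
  a′ = a ℤ.* (+ p) ℤ.+ b ℤ.* (+ q)
  a′≡ : ℤ→ℚ a′ ≡ ℤ→ℚ a * P + ℤ→ℚ b * Q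
  a′≡ = trans (ℤ→ℚ-+ (a ℤ.* (+ p)) (b ℤ.* (+ q))) (cong₂ _+_ (ℤ→ℚ-* a (+ p)) (ℤ→ℚ-* b (+ q)))
  G = clearDenominators q p F
  lem : ∀ Q R a v b w e → (Q * R) * ((a * v + b * w) * e) ≡ (a * (Q * v) + b * (Q * w)) * (R * e)
  lem = solve-∀ ringℚ
  lem′ : ∀ a u P w b Q → a * (u + P * w) + b * (Q * w) ≡ a * u + (a * P + b * Q) * w
  lem′ = solve-∀ ringℚ
clearDenominators {n} q p (F ⊞ G) = let (F′ , F≡) = clearDenominators q p F ; (G′ , G≡) = clearDenominators q p G in
  F′ ⊞ G′ , λ u v w qv≡ → trans (ℚP.*-distribˡ-+ (powℚ (ℕ→ℚ q) n) (eval F v w) (eval G v w)) (cong₂ _+_ (F≡ u v w qv≡) (G≡ u v w qv≡))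

-- Dedekind sums as coefficients

D-poly : ∀ q p .{{_ : NonZero q}} x N → D q p x 1ℚ N ≡ poly (λ a → ℕ→ℚ (N C a) * s a (N ∸ a) p q) (suc N) x
D-poly q p x N = begin
  sumℚ q (λ k → (c (ξ k) x ⋆ c (η k) 1ℚ) N)
    ≡⟨ sum-cong′ q (λ k → binomial-⋆ (c (ξ k) x) (c (η k) 1ℚ) N) ⟩
  sumℚ q (λ k → sumℚ (suc N) (λ a → ℕ→ℚ (N C a) * ((powℚ x a * Bbar a (ξ k)) * (powℚ 1ℚ (N ∸ a) * Bbar (N ∸ a) (η k)))))
    ≡⟨ sum-swap q (suc N) _ ⟩
  sumℚ (suc N) (λ a → sumℚ q (λ k → ℕ→ℚ (N C a) * ((powℚ x a * Bbar a (ξ k)) * (powℚ 1ℚ (N ∸ a) * Bbar (N ∸ a) (η k)))))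
    ≡⟨ sum-cong′ (suc N) (λ a → trans (sum-cong′ q (λ k → trans
         (cong (λ y → ℕ→ℚ (N C a) * ((powℚ x a * Bbar a (ξ k)) * (y * Bbar (N ∸ a) (η k)))) (powℚ-1 (N ∸ a)))
         (lem (ℕ→ℚ (N C a)) (powℚ x a) (Bbar a (ξ k)) (Bbar (N ∸ a) (η k)))))
         (trans (sum-*ˡ q (ℕ→ℚ (N C a) * powℚ x a) (λ k → Bbar a (ξ k) * Bbar (N ∸ a) (η k))) (lem′ (ℕ→ℚ (N C a)) (powℚ x a) (s a (N ∸ a) p q)))) ⟩
  poly (λ a → ℕ→ℚ (N C a) * s a (N ∸ a) p q) (suc N) x ∎
  where
  open ≡-Reasoning
  ξ η : ℕ → ℚ
  ξ k = (+ k) / q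
  η k = (+ (p ℕ.* k)) / q
  lem : ∀ c x a b → c * ((x * a) * (1ℚ * b)) ≡ (c * x) * (a * b)
  lem = solve-∀ ringℚ
  lem′ : ∀ c x s → (c * x) * s ≡ (c * s) * x
  lem′ = solve-∀ ringℚ

powℚ-binomial : ∀ x y n → powℚ (x + y) n ≡ poly (λ a → ℕ→ℚ (n C a) * powℚ y (n ∸ a)) (suc n) x
powℚ-binomial x y n = trans (sym (coeff (exp-+ x y) n)) (trans (binomial-⋆ (exp x) (exp y) n)
  (sum-cong′ (suc n) (λ a → lem (ℕ→ℚ (n C a)) (powℚ x a) (powℚ y (n ∸ a)))))
  where
  lem : ∀ c x y → c * (x * y) ≡ (c * y) * x
  lem = solve-∀ ringℚ

module Extraction (N m : ℕ) (N≡2+2m : N ≡ suc (suc (m ℕ.+ m))) (q p : ℕ) .{{_ : NonZero q}}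
  (p′ t : ℤ) (pp′≡1+qt : (+ p) ℤ.* p′ ≡ (+ 1) ℤ.+ (+ q) ℤ.* t) where
  open ≡-Reasoning

  private
    M : ℕ
    M = m ℕ.+ m
    Q P P′ : ℚ
    Q = ℕ→ℚ q
    P = ℕ→ℚ p
    P′ = ℤ→ℚ p′
    polar = Polar.polar-decomposition N m N≡2+2m p q p ℕP.≤-refl p′ t pp′≡1+qt
    H = proj₁ polar
    G = proj₁ (clearDenominators q p H)
    g : Seq
    g = proj₁ (dehomogenise G)
    g-integral = proj₁ (proj₂ (dehomogenise G))
    g-support = proj₁ (proj₂ (proj₂ (dehomogenise G)))
    g-eval = proj₂ (proj₂ (proj₂ (dehomogenise G)))

    -- With `w = 1`, the polar terms are `x (x + p)^(N-1)` and `(p′ x + 1)^(N-1)` up to a factor.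
    -- `f₁` and `f₂` list the binomial coefficients of the two powers, and `shift` is multiplication
    -- by `x`.
    lhs f₁ f₂ rhs : Seq
    lhs = (powℚ Q M * K N) · (λ a → ℕ→ℚ (N C a) * s a (N ∸ a) p q)
    f₁ a = ℕ→ℚ (suc M C a) * powℚ P (suc M ∸ a)
    f₂ a = ℕ→ℚ (suc M C a) * powℚ P′ a
    rhs = ((A N * inv q) · (shift f₁ ⊕ f₂)) ⊕ shift g

  -- The polar powers have one degree more than the form, so `q^n` leaves one `q` below: the
  -- denominator in the theorem.
  powℚ-inv : ∀ y n → powℚ Q n * powℚ (y * inv q) (suc n) ≡ powℚ y (suc n) * inv q
  powℚ-inv y zero    = lem y (inv q)
    where
    lem : ∀ y i → 1ℚ * ((y * i) * 1ℚ) ≡ (y * 1ℚ) * i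
    lem = solve-∀ ringℚ
  powℚ-inv y (suc n) = begin
    (Q * powℚ Q n) * ((y * inv q) * powℚ (y * inv q) (suc n))      ≡⟨ lem Q (powℚ Q n) y (inv q) (powℚ (y * inv q) (suc n)) ⟩
    (inv q * Q) * (y * (powℚ Q n * powℚ (y * inv q) (suc n)))      ≡⟨ cong₂ (λ a b → a * (y * b)) (inv-* q) (powℚ-inv y n) ⟩
    1ℚ * (y * (powℚ y (suc n) * inv q))                            ≡⟨ lem′ y (powℚ y (suc n)) (inv q) ⟩
    (y * powℚ y (suc n)) * inv q                                   ∎
    where
    lem : ∀ Q R y i x → (Q * R) * ((y * i) * x) ≡ (i * Q) * (y * (R * x))
    lem = solve-∀ ringℚ
    lem′ : ∀ y x i → 1ℚ * (y * (x * i)) ≡ (y * x) * i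
    lem′ = solve-∀ ringℚ

  private
    f₂-binomial : ∀ x → powℚ (P′ * x + 1ℚ) (suc M) ≡ poly f₂ (suc N) x
    f₂-binomial x = begin
      powℚ (P′ * x + 1ℚ) (suc M)
        ≡⟨ powℚ-binomial (P′ * x) 1ℚ (suc M) ⟩
      sumℚ (suc (suc M)) (λ a → (ℕ→ℚ (suc M C a) * powℚ 1ℚ (suc M ∸ a)) * powℚ (P′ * x) a)
        ≡⟨ sum-cong′ (suc (suc M)) (λ a → trans (cong₂ (λ y z → (ℕ→ℚ (suc M C a) * y) * z) (powℚ-1 (suc M ∸ a)) (powℚ-* P′ x a)) (lem (ℕ→ℚ (suc M C a)) (powℚ P′ a) (powℚ x a))) ⟩
      poly f₂ (suc (suc M)) x
        ≡⟨ sym (poly-extend f₂ (suc (suc M)) x (trans (cong (λ k → ℕ→ℚ k * powℚ P′ (suc (suc M))) (k>n⇒nCk≡0 (ℕP.n<1+n (suc M)))) (ℚP.*-zeroˡ (powℚ P′ (suc (suc M)))))) ⟩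
      poly f₂ (suc (suc (suc M))) x
        ≡⟨ cong (λ n → poly f₂ (suc n) x) (sym N≡2+2m) ⟩
      poly f₂ (suc N) x ∎
      where
      lem : ∀ c a b → (c * 1ℚ) * (a * b) ≡ (c * a) * b
      lem = solve-∀ ringℚ

    f₁-binomial : ∀ x → x * powℚ (x + P * 1ℚ) (suc M) ≡ poly (shift f₁) (suc N) x
    f₁-binomial x = begin
      x * powℚ (x + P * 1ℚ) (suc M)       ≡⟨ cong (λ y → x * powℚ (x + y) (suc M)) (ℚP.*-identityʳ P) ⟩
      x * powℚ (x + P) (suc M)            ≡⟨ cong (x *_) (powℚ-binomial x P (suc M)) ⟩
      x * poly f₁ (suc (suc M)) x         ≡⟨ sym (poly-shift f₁ (suc (suc M)) x) ⟩
      poly (shift f₁) (suc (suc (suc M))) x   ≡⟨ cong (λ n → poly (shift f₁) (suc n) x) (sym N≡2+2m) ⟩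
      poly (shift f₁) (suc N) x            ∎

    g-shift : ∀ x → x * eval G x 1ℚ ≡ poly (shift g) (suc N) x
    g-shift x = begin
      x * eval G x 1ℚ                          ≡⟨ cong (x *_) (g-eval x) ⟩
      x * poly g (suc M) x                    ≡⟨ sym (poly-shift g (suc M) x) ⟩
      poly (shift g) (suc (suc M)) x          ≡⟨ sym (poly-extend (shift g) (suc (suc M)) x (g-support (suc M) (ℕP.n<1+n M))) ⟩
      poly (shift g) (suc (suc (suc M))) x    ≡⟨ cong (λ n → poly (shift g) (suc n) x) (sym N≡2+2m) ⟩
      poly (shift g) (suc N) x                 ∎

    lhs≗rhs : ∀ k → poly lhs (suc N) (ℕ→ℚ (suc k)) ≡ poly rhs (suc N) (ℕ→ℚ (suc k))
    lhs≗rhs k = begin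
      poly lhs (suc N) x
        ≡⟨ trans (poly-· (powℚ Q M * K N) _ (suc N) x) (cong ((powℚ Q M * K N) *_) (sym (D-poly q p x N))) ⟩
      (powℚ Q M * K N) * D q p x 1ℚ N
        ≡⟨ ℚP.*-assoc (powℚ Q M) (K N) (D q p x 1ℚ N) ⟩
      powℚ Q M * (K N * D q p x 1ℚ N)
        ≡⟨ cong (powℚ Q M *_) (proj₂ polar x 1ℚ v v⋆ (ℚP.positive⁻¹ x {{ℕ→ℚ-pos (suc k)}}) (ℚP.positive⁻¹ 1ℚ) (Q*inv (x + P * 1ℚ)) (Q*inv (P′ * x + 1ℚ))) ⟩
      powℚ Q M * (A N * (x * powℚ v (suc M) + 1ℚ * powℚ v⋆ (suc M)) + x * 1ℚ * eval H v 1ℚ)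
        ≡⟨ lem (powℚ Q M) (A N) x (powℚ v (suc M)) (powℚ v⋆ (suc M)) (eval H v 1ℚ) ⟩
      A N * (x * (powℚ Q M * powℚ v (suc M)) + powℚ Q M * powℚ v⋆ (suc M)) + x * (powℚ Q M * eval H v 1ℚ)
        ≡⟨ cong₂ _+_ (cong₂ (λ y z → A N * (x * y + z)) (powℚ-inv (x + P * 1ℚ) M) (powℚ-inv (P′ * x + 1ℚ) M))
             (cong (x *_) (proj₂ (clearDenominators q p H) x v 1ℚ (Q*inv (x + P * 1ℚ)))) ⟩
      A N * (x * (powℚ (x + P * 1ℚ) (suc M) * inv q) + powℚ (P′ * x + 1ℚ) (suc M) * inv q) + x * eval G x 1ℚ
        ≡⟨ cong (_+ x * eval G x 1ℚ) (lem′ (A N) x (powℚ (x + P * 1ℚ) (suc M)) (inv q) (powℚ (P′ * x + 1ℚ) (suc M))) ⟩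
      (A N * inv q) * (x * powℚ (x + P * 1ℚ) (suc M) + powℚ (P′ * x + 1ℚ) (suc M)) + x * eval G x 1ℚ
        ≡⟨ cong₂ (λ y z → (A N * inv q) * y + z) (cong₂ _+_ (f₁-binomial x) (f₂-binomial x)) (g-shift x) ⟩
      (A N * inv q) * (poly (shift f₁) (suc N) x + poly f₂ (suc N) x) + poly (shift g) (suc N) x
        ≡⟨ cong (λ y → (A N * inv q) * y + poly (shift g) (suc N) x) (sym (poly-⊕ (shift f₁) f₂ (suc N) x)) ⟩
      (A N * inv q) * poly (shift f₁ ⊕ f₂) (suc N) x + poly (shift g) (suc N) x
        ≡⟨ cong (_+ poly (shift g) (suc N) x) (sym (poly-· (A N * inv q) (shift f₁ ⊕ f₂) (suc N) x)) ⟩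
      poly ((A N * inv q) · (shift f₁ ⊕ f₂)) (suc N) x + poly (shift g) (suc N) x
        ≡⟨ sym (poly-⊕ ((A N * inv q) · (shift f₁ ⊕ f₂)) (shift g) (suc N) x) ⟩
      poly rhs (suc N) x ∎
      where
      x v v⋆ : ℚ
      x = ℕ→ℚ (suc k)
      v = (x + P * 1ℚ) * inv q
      v⋆ = (P′ * x + 1ℚ) * inv q
      Q*inv : ∀ y → Q * (y * inv q) ≡ y
      Q*inv y = trans (comm Q y (inv q)) (trans (cong (y *_) (inv-* q)) (ℚP.*-identityʳ y))
        where
        comm : ∀ Q y i → Q * (y * i) ≡ y * (i * Q)
        comm = solve-∀ ringℚ
      lem : ∀ R A x V S H → R * (A * (x * V + 1ℚ * S) + x * 1ℚ * H) ≡ A * (x * (R * V) + R * S) + x * (R * H)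
      lem = solve-∀ ringℚ
      lem′ : ∀ A x V i S → A * (x * (V * i) + S * i) ≡ (A * i) * (x * V + S)
      lem′ = solve-∀ ringℚ

  extraction : ∀ i → suc i ≤ N → IsInteger ((powℚ Q M * K N) * (ℕ→ℚ (N C suc i) * s (suc i) (N ∸ suc i) p q)
    -- The coefficient of index `suc i` in `shift g` is the integer `g i`.
    - (A N * inv q) * (ℕ→ℚ (suc M C i) * powℚ P (suc M ∸ i) + ℕ→ℚ (suc M C suc i) * powℚ P′ (suc i)))
  extraction i i<N = proj₁ (g-integral i) , trans (cong (_- X) (poly-injective (suc N) lhs rhs lhs≗rhs (suc i) (s≤s i<N)))
    (trans (lem X (g i)) (proj₂ (g-integral i)))
    where
    X = (A N * inv q) * (f₁ i + f₂ (suc i))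
    lem : ∀ x g → (x + g) - x ≡ g
    lem = solve-∀ ringℚ

-- Translation into the notation of the theorem

assemble : ∀ N i j m → i ℕ.+ j ≡ N → 1 ≤ i → N ≡ suc m ℕ.* 2 →
  (p q : ℕ) → .{{_ : NonZero q}} → (p′ t : ℤ) → (+ p) ℤ.* p′ ≡ (+ 1) ℤ.+ (+ q) ℤ.* t →
  ∃ λ (z : ℤ) →
    ℕ→ℚ ((N C i) ℕ.* β N ℕ.* r N) * powℚ (ℕ→ℚ q) (N ∸ 2) * s i j p q
    - (ℤ→ℚ ((p′ ℤ.^ i) ℤ.* α N ℤ.* (+ r N) ℤ.* (+ ((N ∸ 1) C i)))
       + ℤ→ℚ (((+ p) ℤ.^ j) ℤ.* α N ℤ.* (+ r N) ℤ.* (+ ((N ∸ 1) C j))))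
      * ((+ 1) / q)
    ≡ ℤ→ℚ z
assemble N (suc i) j m i+j≡N _ N≡[1+m]*2 p q p′ t pp′≡1+qt = proj₁ integer , trans rearrange (proj₂ integer)
  where
  open ≡-Reasoning
  M = m ℕ.+ m
  N≡2+M : N ≡ suc (suc M)
  N≡2+M = trans N≡[1+m]*2 (cong (λ k → suc (suc k)) (trans (ℕP.*-comm m 2) (cong (m ℕ.+_) (ℕP.+-identityʳ m))))
  integer = Extraction.extraction N m N≡2+M q p p′ t pp′≡1+qt i (ℕP.≤-trans (ℕP.m≤m+n (suc i) j) (ℕP.≤-reflexive i+j≡N))
  N∸i : N ∸ suc i ≡ j
  N∸i = trans (cong (_∸ suc i) (sym i+j≡N)) (ℕP.m+n∸m≡n (suc i) j)
  i+j≡1+M : i ℕ.+ j ≡ suc M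
  i+j≡1+M = ℕP.suc-injective (trans i+j≡N N≡2+M)
  1+M∸i : suc M ∸ i ≡ j
  1+M∸i = trans (cong (_∸ i) (sym i+j≡1+M)) (ℕP.m+n∸m≡n i j)
  -- Here `i` is one less than the first index of the Dedekind sum, so `i + j = N - 1` and the
  -- symmetry of binomial coefficients applies.
  Cij : suc M C i ≡ suc M C j
  Cij = trans (nCk≡nC[n∸k] (subst (i ≤_) i+j≡1+M (ℕP.m≤m+n i j))) (cong (suc M C_) 1+M∸i)
  Q P P′ : ℚ
  Q = ℕ→ℚ q
  P = ℕ→ℚ p
  P′ = ℤ→ℚ p′
  term : ∀ (a : ℤ) k n → ℤ→ℚ ((a ℤ.^ k) ℤ.* α N ℤ.* (+ r N) ℤ.* (+ ((N ∸ 1) C n))) ≡ A N * (ℕ→ℚ (suc M C n) * powℚ (ℤ→ℚ a) k)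
  term a k n = begin
    ℤ→ℚ ((a ℤ.^ k) ℤ.* α N ℤ.* (+ r N) ℤ.* (+ ((N ∸ 1) C n)))
      ≡⟨ ℤ→ℚ-* ((a ℤ.^ k) ℤ.* α N ℤ.* (+ r N)) (+ ((N ∸ 1) C n)) ⟩
    ℤ→ℚ ((a ℤ.^ k) ℤ.* α N ℤ.* (+ r N)) * ℕ→ℚ ((N ∸ 1) C n)
      ≡⟨ cong₂ _*_ (trans (cong ℤ→ℚ (ℤP.*-assoc (a ℤ.^ k) (α N) (+ r N))) (trans (ℤ→ℚ-* (a ℤ.^ k) (α N ℤ.* (+ r N))) (cong (_* A N) (ℤ→ℚ-^ a k))))
           (cong (λ l → ℕ→ℚ (l C n)) (cong (_∸ 1) N≡2+M)) ⟩
    (powℚ (ℤ→ℚ a) k * A N) * ℕ→ℚ (suc M C n)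
      ≡⟨ lem (powℚ (ℤ→ℚ a) k) (A N) (ℕ→ℚ (suc M C n)) ⟩
    A N * (ℕ→ℚ (suc M C n) * powℚ (ℤ→ℚ a) k) ∎
    where
    lem : ∀ x a c → (x * a) * c ≡ a * (c * x)
    lem = solve-∀ ringℚ
  R≡ : ℕ→ℚ ((N C suc i) ℕ.* β N ℕ.* r N) ≡ (ℕ→ℚ (N C suc i) * ℕ→ℚ (β N)) * ℕ→ℚ (r N)
  R≡ = trans (ℕ→ℚ-* ((N C suc i) ℕ.* β N) (r N)) (cong (_* ℕ→ℚ (r N)) (ℕ→ℚ-* (N C suc i) (β N)))
  rearrange : ℕ→ℚ ((N C suc i) ℕ.* β N ℕ.* r N) * powℚ Q (N ∸ 2) * s (suc i) j p q
    - (ℤ→ℚ ((p′ ℤ.^ suc i) ℤ.* α N ℤ.* (+ r N) ℤ.* (+ ((N ∸ 1) C suc i)))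
       + ℤ→ℚ (((+ p) ℤ.^ j) ℤ.* α N ℤ.* (+ r N) ℤ.* (+ ((N ∸ 1) C j)))) * inv q
    ≡ (powℚ Q M * K N) * (ℕ→ℚ (N C suc i) * s (suc i) (N ∸ suc i) p q)
    - (A N * inv q) * (ℕ→ℚ (suc M C i) * powℚ P (suc M ∸ i) + ℕ→ℚ (suc M C suc i) * powℚ P′ (suc i))
  rearrange = begin
    ℕ→ℚ ((N C suc i) ℕ.* β N ℕ.* r N) * powℚ Q (N ∸ 2) * s (suc i) j p q - _
      ≡⟨ cong₂ _-_ (cong₂ (λ x n → x * powℚ Q n * s (suc i) j p q) R≡ (cong (_∸ 2) N≡2+M)) (cong₂ (λ x y → (x + y) * inv q) (term p′ (suc i) (suc i)) (term (+ p) j j)) ⟩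
    ((ℕ→ℚ (N C suc i) * ℕ→ℚ (β N)) * ℕ→ℚ (r N)) * powℚ Q M * s (suc i) j p q
      - (A N * (ℕ→ℚ (suc M C suc i) * powℚ P′ (suc i)) + A N * (ℕ→ℚ (suc M C j) * powℚ P j)) * inv q
      ≡⟨ lem (ℕ→ℚ (N C suc i)) (ℕ→ℚ (β N)) (ℕ→ℚ (r N)) (powℚ Q M) (s (suc i) j p q) (A N) (ℕ→ℚ (suc M C suc i) * powℚ P′ (suc i)) (ℕ→ℚ (suc M C j) * powℚ P j) (inv q) ⟩
    (powℚ Q M * K N) * (ℕ→ℚ (N C suc i) * s (suc i) j p q)
      - (A N * inv q) * (ℕ→ℚ (suc M C j) * powℚ P j + ℕ→ℚ (suc M C suc i) * powℚ P′ (suc i))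
      ≡⟨ cong₂ (λ x y → (powℚ Q M * K N) * (ℕ→ℚ (N C suc i) * s (suc i) x p q) - (A N * inv q) * (y + ℕ→ℚ (suc M C suc i) * powℚ P′ (suc i)))
           (sym N∸i) (cong₂ (λ x y → ℕ→ℚ x * powℚ P y) (sym Cij) (sym 1+M∸i)) ⟩
    (powℚ Q M * K N) * (ℕ→ℚ (N C suc i) * s (suc i) (N ∸ suc i) p q)
      - (A N * inv q) * (ℕ→ℚ (suc M C i) * powℚ P (suc M ∸ i) + ℕ→ℚ (suc M C suc i) * powℚ P′ (suc i)) ∎
    where
    lem : ∀ c b r Q s A x y i → ((c * b) * r) * Q * s - (A * x + A * y) * i ≡ (Q * (b * r)) * (c * s) - (A * i) * (y + x)
    lem = solve-∀ ringℚ

theorem1p1 : (i j : ℕ) → 1 ≤ i → 1 ≤ j → 2 ℕD.∣ (i ℕ.+ j) →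
    (p q : ℕ) → .{{_ : NonZero q}} → Coprime p q → 0 < p → p < q →
    (p' : ℤ) → (+ q) ℤD.∣ (p' ℤ.* (+ p) ℤ.- ℤ.1ℤ) →
    ∃ λ (z : ℤ) →
    ℕ→ℚ (R i j) ℚ.* powℚ (ℕ→ℚ q) ((i ℕ.+ j) ∸ 2) ℚ.* s i j p q
    ℚ.- (ℤ→ℚ ((p' ℤ.^ i) ℤ.* α (i ℕ.+ j) ℤ.* (+ r (i ℕ.+ j)) ℤ.* (+ ((i ℕ.+ j ∸ 1) C i)))
    ℚ.+ ℤ→ℚ (((+ p) ℤ.^ j) ℤ.* α (i ℕ.+ j) ℤ.* (+ r (i ℕ.+ j)) ℤ.* (+ ((i ℕ.+ j ∸ 1) C j))))
    ℚ.* ((+ 1) / q)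
    ≡ ℤ→ℚ z
theorem1p1 i j 1≤i 1≤j (ℕD.divides zero i+j≡0) p q coprime 0<p p<q p' q∣p'p-1 =
  contradiction (ℕP.m+n≡0⇒m≡0 i i+j≡0) (λ i≡0 → ℕP.<⇒≢ 1≤i (sym i≡0))
-- Signed divisibility yields the quotient `t` as an integer; the recursion needs it as the inverse
-- for the next cone.
theorem1p1 i j 1≤i 1≤j (ℕD.divides (suc m) i+j≡[1+m]*2) p q coprime 0<p p<q p' q∣p'p-1 with ℤDS.∣ᵤ⇒∣ {+ q} {p' ℤ.* (+ p) ℤ.- ℤ.1ℤ} q∣p'p-1
... | ℤDS.divides t p'p-1≡tq = assemble (i ℕ.+ j) i j m refl 1≤i i+j≡[1+m]*2 p q p' t inverse
  where
  open ≡-Reasoning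
  lem₁ : ∀ p x → p ℤ.* x ≡ (+ 1) ℤ.+ (x ℤ.* p ℤ.- ℤ.1ℤ)
  lem₁ = ℤRing.solve-∀
  inverse : (+ p) ℤ.* p' ≡ (+ 1) ℤ.+ (+ q) ℤ.* t
  inverse = begin
    (+ p) ℤ.* p'                               ≡⟨ lem₁ (+ p) p' ⟩
    (+ 1) ℤ.+ (p' ℤ.* (+ p) ℤ.- ℤ.1ℤ)          ≡⟨ cong (ℤ._+_ (+ 1)) (trans p'p-1≡tq (ℤP.*-comm t (+ q))) ⟩
    (+ 1) ℤ.+ (+ q) ℤ.* t                      ∎
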